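{- Let $q\ge 3$ and $p\ge 2$ be integers and let $\ell=q+p$ be the number of vertices of the sparkler graph $S_{q,p}$. Then \begin{enumerate} \item $W'(S_{q,p})\ge\max\left(p,\,\ell-\frac12\,p-2-\frac12(p\bmod 2)\right)$; \item $D'(S_{q,p})\le\max\left(p,\,\ell-\frac12\,p-2-\frac12(p\bmod 2)\right)+2$. \end{enumerate}
   Context: Graphs are finite and simple. First-order sentences are over the vocabulary $\{\sim,=\}$ (adjacency and equality). A first-order sentence $\Phi$ defines a class of graphs $\mathcal C$ asymptotically over connected graphs if there is an integer $N$ such that for every connected graph $G$ with at least $N$ vertices, $G\models\Phi$ iff $G\in\mathcal C$. For a graph $F$, let $\mathcal C_F$ be the class of graphs containing a (not necessarily induced) subgraph isomorphic to $F$. $D'(F)$ is the minimum quantifier depth of a sentence defining $\mathcal C_F$ asymptotically over connected graphs, and $W'(F)$ is the minimum variable width (number of distinct first-order variables used) of such a sentence. The sparkler graph $S_{q,p}$ is obtained from the star $K_{1,q-1}$ and the path $P_p$ (on $p$ vertices) by adding an edge between an end vertex of $P_p$ and the central vertex of $K_{1,q-1}$; it has $q+p$ vertices. -}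

module Defs where

open import Data.Nat using (ℕ; zero; suc; _+_; _∸_; _≤_; _⊔_; _≡ᵇ_; _≤ᵇ_; _<ᵇ_; _/_; _%_)
open import Data.Nat.Properties using (_≟_)
open import Data.Bool using (Bool; true; false; _∧_; _∨_; not)
open import Data.Bool.Properties using (∨-comm)
open import Data.Fin using (Fin; toℕ)
open import Data.List using (List; []; _∷_; _++_; length; deduplicate)
open import Data.Maybe using (Maybe; just; nothing)
open import Data.Product using (Σ; _×_; _,_)
open import Data.Empty using (⊥)
open import Data.Sum using (_⊎_)
open import Data.Unit using (⊤)
open import Relation.Nullary using (¬_)
open import Relation.Binary.PropositionalEquality using (_≡_; refl)
open import Function using (Injective)

record Graph : Set where
  field
    size  : ℕ
    adj   : Fin size → Fin size → Bool
    sym   : ∀ u v → adj u v ≡ adj v u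
    irrefl : ∀ u → adj u u ≡ false
open Graph public

data Reach (G : Graph) : Fin (size G) → Fin (size G) → Set where
  here : ∀ {u} → Reach G u u
  step : ∀ {u w v} → adj G u w ≡ true → Reach G w v → Reach G u v

Connected : Graph → Set
Connected G = ∀ u v → Reach G u v

ContainsSubgraph : (F G : Graph) → Set
ContainsSubgraph F G =
  Σ (Fin (size F) → Fin (size G)) λ f →
    Injective _≡_ _≡_ f ×
    (∀ u v → adj F u v ≡ true → adj G (f u) (f v) ≡ true)

𝒞 : Graph → Graph → Set
𝒞 F G = ContainsSubgraph F G

data Formula : Set where
  _≐_ : ℕ → ℕ → Formula
  _∼_ : ℕ → ℕ → Formula
  ¬'_ : Formula → Formula
  _∧'_ : Formula → Formula → Formula
  _∨'_ : Formula → Formula → Formula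
  _⇒'_ : Formula → Formula → Formula
  ∃'  : ℕ → Formula → Formula
  ∀'  : ℕ → Formula → Formula

remove : ℕ → List ℕ → List ℕ
remove x [] = []
remove x (y ∷ ys) with x ≡ᵇ y
... | true  = remove x ys
... | false = y ∷ remove x ys

freeVars : Formula → List ℕ
freeVars (x ≐ y) = x ∷ y ∷ []
freeVars (x ∼ y) = x ∷ y ∷ []
freeVars (¬' φ) = freeVars φ
freeVars (φ ∧' ψ) = freeVars φ ++ freeVars ψ
freeVars (φ ∨' ψ) = freeVars φ ++ freeVars ψ
freeVars (φ ⇒' ψ) = freeVars φ ++ freeVars ψ
freeVars (∃' x φ) = remove x (freeVars φ)
freeVars (∀' x φ) = remove x (freeVars φ)

Sentence : Formula → Set
Sentence φ = freeVars φ ≡ []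

vars : Formula → List ℕ
vars (x ≐ y) = x ∷ y ∷ []
vars (x ∼ y) = x ∷ y ∷ []
vars (¬' φ) = vars φ
vars (φ ∧' ψ) = vars φ ++ vars ψ
vars (φ ∨' ψ) = vars φ ++ vars ψ
vars (φ ⇒' ψ) = vars φ ++ vars ψ
vars (∃' x φ) = x ∷ vars φ
vars (∀' x φ) = x ∷ vars φ

width : Formula → ℕ
width φ = length (deduplicate _≟_ (vars φ))

depth : Formula → ℕ
depth (x ≐ y) = 0
depth (x ∼ y) = 0
depth (¬' φ) = depth φ
depth (φ ∧' ψ) = depth φ ⊔ depth ψ
depth (φ ∨' ψ) = depth φ ⊔ depth ψ
depth (φ ⇒' ψ) = depth φ ⊔ depth ψ
depth (∃' x φ) = suc (depth φ)
depth (∀' x φ) = suc (depth φ)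

-- semantics (partial assignments; unassigned variables make atoms false,
-- irrelevant for sentences)
Env : Graph → Set
Env G = ℕ → Maybe (Fin (size G))

update : {G : Graph} → Env G → ℕ → Fin (size G) → Env G
update ρ x v y with x ≡ᵇ y
... | true  = just v
... | false = ρ y

Eq : {G : Graph} → Maybe (Fin (size G)) → Maybe (Fin (size G)) → Set
Eq (just u) (just v) = u ≡ v
Eq _ _ = ⊥

Adj : (G : Graph) → Maybe (Fin (size G)) → Maybe (Fin (size G)) → Set
Adj G (just u) (just v) = adj G u v ≡ true
Adj G _ _ = ⊥

Sat : (G : Graph) → Env G → Formula → Set
Sat G ρ (x ≐ y) = Eq {G} (ρ x) (ρ y)
Sat G ρ (x ∼ y) = Adj G (ρ x) (ρ y)
Sat G ρ (¬' φ) = ¬ Sat G ρ φ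
Sat G ρ (φ ∧' ψ) = Sat G ρ φ × Sat G ρ ψ
Sat G ρ (φ ∨' ψ) = Sat G ρ φ ⊎ Sat G ρ ψ
Sat G ρ (φ ⇒' ψ) = Sat G ρ φ → Sat G ρ ψ
Sat G ρ (∃' x φ) = Σ (Fin (size G)) λ v → Sat G (update {G} ρ x v) φ
Sat G ρ (∀' x φ) = (v : Fin (size G)) → Sat G (update {G} ρ x v) φ

_⊨_ : Graph → Formula → Set
G ⊨ φ = Sat G (λ _ → nothing) φ

DefinesAsympConn : Formula → (Graph → Set) → Set
DefinesAsympConn Φ C =
  Sentence Φ ×
  Σ ℕ λ N → (G : Graph) → Connected G → N ≤ size G →
    ((G ⊨ Φ → C G) × (C G → G ⊨ Φ))

-- Sparkler graph S_{q,p}: vertex 0 = star centre, 1..q-1 = leaves,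
-- q..q+p-1 = path (q adjacent to the centre).

edgeDir : ℕ → ℕ → ℕ → Bool
edgeDir q a b = ((a ≡ᵇ 0) ∧ ((1 ≤ᵇ b) ∧ (b ≤ᵇ q))) ∨ ((q ≤ᵇ a) ∧ (b ≡ᵇ suc a))

private
  n≢ᵇsn : ∀ n → (n ≡ᵇ suc n) ≡ false
  n≢ᵇsn zero = refl
  n≢ᵇsn (suc n) = n≢ᵇsn n

  ∧false : ∀ b → (b ∧ false) ≡ false
  ∧false true = refl
  ∧false false = refl

  edgeDir-irr : ∀ q a → edgeDir q a a ≡ false
  edgeDir-irr q zero = ∧false (q ≤ᵇ 0)
  edgeDir-irr q (suc a) rewrite n≢ᵇsn a = ∧false (q ≤ᵇ suc a)

sparkAdj : (q p : ℕ) → Fin (q + p) → Fin (q + p) → Bool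
sparkAdj q p u v = edgeDir q (toℕ u) (toℕ v) ∨ edgeDir q (toℕ v) (toℕ u)

Sparkler : (q p : ℕ) → Graph
Sparkler q p = record
  { size = q + p
  ; adj = sparkAdj q p
  ; sym = λ u v → ∨-comm (edgeDir q (toℕ u) (toℕ v)) (edgeDir q (toℕ v) (toℕ u))
  ; irrefl = λ u → irr (toℕ u)
  }
  where
  irr : ∀ a → (edgeDir q a a ∨ edgeDir q a a) ≡ false
  irr a rewrite edgeDir-irr q a = refl

-- the bound max(p, ℓ - p/2 - 2 - (p mod 2)/2) with ℓ = q + p,
-- written as ℓ ∸ ⌈p/2⌉ ∸ 2 where ⌈p/2⌉ = (p + p mod 2)/2 (exact, no truncation for q ≥ 3)
sparkBound : ℕ → ℕ → ℕ
sparkBound q p = p ⊔ ((q + p) ∸ ((p + p % 2) / 2) ∸ 2)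

{-# OPTIONS --safe #-}
-- Write s = ⌊p/2⌋, so that the bound is max(p, q + s − 2).
--
-- Lower bounds. If two graphs differ only in the size of a class of twins, and this size is at least k
-- in both, then no sentence of width k tells them apart. For each of p, q − 1 and (when s ≥ 2)
-- q + s − 2, enlarging a class of twins by one vertex makes a sparkler appear.
--
-- Upper bound. A sparkler with centre c is a path of p further vertices starting at c, y of them adjacent
-- to c, where c has degree at least q − 1 + y. If the last vertex of the path is adjacent to c, then
-- there is a cycle of length p + 1; in a large connected graph a vertex of degree at least q together with
-- such a cycle already forces a sparkler, centred at a vertex of huge degree if there is one and at
-- the beginning of a geodesic otherwise. So let y < p. The number n = q − 1 + y may exceed the available
-- depth d = max(p + 1, q + s − 1), but 2n ≤ 3d, and "|M| ≥ n" for the neighbourhood M of c can be replaced by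
-- a disjunction of depth d:
--   * M has a clique of size d, hence there is a cycle of length p + 1, or M has an independent set of
--     size d, of which the path contains at most s vertices;
--   * for some a, M has a homogeneous set of size a and fewer than n − a vertices of M never suffice to
--     make the rest of M homogeneous of the same kind;
--   * n vertices are found by repeatedly choosing a vertex and splitting the current part of M into its
--     neighbours and non-neighbours, with one quantifier for both parts at each step.
module Submission where

open import Defs
open import Data.Bool using (Bool; true; false; not; _∧_; _∨_; T)
import Data.Bool.Properties as Bool
open import Data.Empty using (⊥; ⊥-elim)
open import Data.Fin using (Fin; zero; suc; toℕ; fromℕ<; _↑ˡ_; _↑ʳ_; cast)
import Data.Fin.Properties as Fin
open import Data.List using (List; []; _∷_; _++_; length; filter; take; drop; map; allFin; tabulate; concatMap; lookup; replicate; applyUpTo; deduplicate; mapMaybe)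
open import Data.List.Properties using (length-++; length-take; length-drop; take++drop≡id; length-map; length-mapMaybe; length-tabulate; length-replicate; length-applyUpTo; length-filter; filter-accept; filter-reject; filter-all; filter-none; filter-some; filter-notAll; filter-++)
open import Data.List.Membership.Propositional using (_∈_; _∉_; find; lose)
open import Data.List.Membership.Propositional.Properties using (∈-++⁺ˡ; ∈-++⁺ʳ; ∈-++⁻; ∈-filter⁺; ∈-filter⁻; ∈-map⁺; ∈-map⁻; ∈-allFin; ∈-∃++; ∈-concatMap⁺; ∈-concatMap⁻; ∈-tabulate⁻; ∈-lookup; ∈-deduplicate⁺; ∈-applyUpTo⁺)
import Data.List.Membership.DecPropositional as DecMembership
open import Data.List.Relation.Unary.All using (All; []; _∷_)
import Data.List.Relation.Unary.All as All
import Data.List.Relation.Unary.All.Properties as Allₚ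
open import Data.List.Relation.Unary.AllPairs using (AllPairs; []; _∷_)
import Data.List.Relation.Unary.AllPairs as AllPairs
import Data.List.Relation.Unary.AllPairs.Properties as AllPairsₚ
open import Data.List.Relation.Unary.Any using (here; there)
import Data.List.Relation.Unary.Any as Any
open import Data.List.Relation.Unary.Unique.Propositional using (Unique)
import Data.List.Relation.Unary.Unique.Propositional.Properties as Uniqueₚ
open import Data.Maybe using (Maybe; just; nothing)
open import Data.Maybe.Properties using (just-injective; ≡-dec)
open import Data.Nat
open import Data.Nat.DivMod using (m≡m%n+[m/n]*n; m%n<n; m*n/n≡m)
open import Data.Nat.Properties
open import Data.Product using (Σ; ∃; ∃₂; _×_; _,_; proj₁; proj₂; swap)
import Data.Product as Product
import Data.Product.Properties as Productₚ
open import Data.Sum using (_⊎_; inj₁; inj₂; [_,_]′)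
import Data.Sum as Sum
open import Data.Unit using (⊤; tt)
open import Data.Vec using (Vec; []; _∷_) renaming (lookup to lookupᵛ; tail to tailᵛ)
open import Function using (_∘_; id; Equivalence; Injective)
open import Level using (0ℓ)
open import Relation.Binary.PropositionalEquality using (_≡_; _≢_; refl; trans; cong; cong₂; subst; subst₂; module ≡-Reasoning) renaming (sym to ≡-sym)
open import Relation.Nullary using (¬_; Dec; yes; no; ¬?; _×-dec_; does)
open import Relation.Unary using (Pred; Decidable)

-- Lists and walks

-- Once `c` is bound only d quantifiers are left, while n may be as large as q + p - 2, so counting
-- neighbours one by one is too expensive. Let e = n - d be the excess. Splitting at a vertex with
-- both neighbours and non-neighbours in the current part makes each new part smaller by at least
-- two at the price of one quantifier; this succeeds if n + e ≤ 2d, which is the condition 2n ≤ 3d,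
-- and no homogeneous set has more than e vertices. A homogeneous set of size a > e instead makes
-- the covering test affordable: a pair after n - a - 1 removals costs n - a + 1 ≤ d quantifiers.
-- Connectedness and size of the graph enter only when a cycle appears. For the lower bounds, the
-- growing class of twins is a clique that has to contain the whole path (p), the leaves of a hub (q
-- - 1), or one side of a complete bipartite graph that has to supply the q - 1 leaves and s - 1
-- vertices of the path (q + s - 2).

module _ {A : Set} where

  delete-member : ∀ {x : A} {ys} → x ∈ ys →
    ∃ λ zs → length ys ≡ suc (length zs) × (∀ {y} → y ∈ ys → y ≢ x → y ∈ zs)
  delete-member {ys = y ∷ ys} (here refl) =
    ys , refl , λ { (here refl) y≢x → ⊥-elim (y≢x refl) ; (there y∈) _ → y∈ }
  delete-member {ys = y ∷ ys} (there x∈) with delete-member x∈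
  ... | zs , eq , keep =
    y ∷ zs , cong suc eq , λ { (here refl) _ → here refl ; (there y∈) y≢x → there (keep y∈ y≢x) }

  unique-⊆⇒length≤ : ∀ {xs ys : List A} → Unique xs → (∀ {x} → x ∈ xs → x ∈ ys) → length xs ≤ length ys
  unique-⊆⇒length≤ {[]} _ _ = z≤n
  unique-⊆⇒length≤ {x ∷ xs} (x∉ ∷ u) sub with delete-member (sub (here refl))
  ... | zs , eq , keep = subst (suc (length xs) ≤_) (≡-sym eq)
    (s≤s (unique-⊆⇒length≤ u λ y∈ → keep (sub (there y∈)) λ y≡x → All.lookup x∉ y∈ (≡-sym y≡x)))

  filter-length-split : ∀ {P : Pred A 0ℓ} (P? : Decidable P) xs →
    length (filter P? xs) + length (filter (¬? ∘ P?) xs) ≡ length xs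
  filter-length-split P? [] = refl
  filter-length-split P? (x ∷ xs) with P? x
  ... | yes _ = cong suc (filter-length-split P? xs)
  ... | no _ = trans (+-suc _ _) (cong suc (filter-length-split P? xs))

  ∈-take : ∀ {x : A} n xs → x ∈ take n xs → x ∈ xs
  ∈-take (suc n) (_ ∷ _) (here eq) = here eq
  ∈-take (suc n) (_ ∷ xs) (there x∈) = there (∈-take n xs x∈)

  length-take-≤ : ∀ {n} {xs : List A} → n ≤ length xs → length (take n xs) ≡ n
  length-take-≤ {n} {xs} n≤ = trans (length-take n xs) (m≤n⇒m⊓n≡m n≤)

  ++-unique : ∀ {xs ys : List A} → Unique xs → Unique ys → (∀ {x} → x ∈ xs → x ∉ ys) → Unique (xs ++ ys)
  ++-unique u v disjoint = Uniqueₚ.++⁺ u v λ { (x∈ , y∈) → disjoint x∈ y∈ }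

  ++-unique⁻ : ∀ xs {ys : List A} → Unique (xs ++ ys) → Unique xs × Unique ys × (∀ {x} → x ∈ xs → x ∉ ys)
  ++-unique⁻ [] u = [] , u , λ ()
  ++-unique⁻ (x ∷ xs) (x∉ ∷ u) with ++-unique⁻ xs u
  ... | u₁ , u₂ , disj = Allₚ.++⁻ˡ xs x∉ ∷ u₁ , u₂ ,
    λ { (here refl) y∈ → All.lookup x∉ (∈-++⁺ʳ xs y∈) refl ; (there x∈) → disj x∈ }

  ∉⇒All≢ : ∀ {x : A} {xs} → x ∉ xs → All (x ≢_) xs
  ∉⇒All≢ x∉ = All.tabulate λ y∈ x≡y → x∉ (subst (_∈ _) (≡-sym x≡y) y∈)

  All≢⇒∉ : ∀ {x : A} {xs} → All (x ≢_) xs → x ∉ xs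
  All≢⇒∉ x≢ x∈ = All.lookup x≢ x∈ refl

module _ (G : Graph) where

  V : Set
  V = Fin (size G)

  data Walk : V → List V → Set where
    [] : ∀ {u} → Walk u []
    _∷_ : ∀ {u v vs} → adj G u v ≡ true → Walk v vs → Walk u (v ∷ vs)

  endpoint : V → List V → V
  endpoint u [] = u
  endpoint u (v ∷ vs) = endpoint v vs

  Adjacent : V → V → Set
  Adjacent u v = adj G u v ≡ true

  adjacent? : ∀ u → Decidable (Adjacent u)
  adjacent? u v = adj G u v Bool.≟ true

  neighbours : V → List V
  neighbours u = filter (adjacent? u) (allFin (size G))

  open DecMembership (Fin._≟_ {size G}) public using (_∈?_)

  record Sparkles (q p : ℕ) : Set where
    field
      centre : V
      leaves path : List V
      leaves-length : suc (length leaves) ≡ q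
      path-length : length path ≡ p
      distinct : Unique (centre ∷ leaves ++ path)
      leaves-adjacent : All (Adjacent centre) leaves
      path-walk : Walk centre path

module _ {G : Graph} where

  adjacent-sym : ∀ {u v b} → adj G u v ≡ b → adj G v u ≡ b
  adjacent-sym {u} {v} e = trans (sym G v u) e

  adjacent⇒≢ : ∀ {u v} → Adjacent G u v → u ≢ v
  adjacent⇒≢ {u} e refl with trans (≡-sym e) (irrefl G u)
  ... | ()

  walk-++ : ∀ {u xs ys} → Walk G u xs → Walk G (endpoint G u xs) ys → Walk G u (xs ++ ys)
  walk-++ [] w = w
  walk-++ (e ∷ w′) w = e ∷ walk-++ w′ w

  walk-take : ∀ {u xs} n → Walk G u xs → Walk G u (take n xs)
  walk-take zero w = []
  walk-take (suc n) [] = []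
  walk-take (suc n) (e ∷ w) = e ∷ walk-take n w

  ∈-neighbours : ∀ {u v} → Adjacent G u v → v ∈ neighbours G u
  ∈-neighbours {u} {v} e = ∈-filter⁺ (adjacent? G u) (∈-allFin v) e

  neighbours-unique : ∀ u → Unique (neighbours G u)
  neighbours-unique u = Uniqueₚ.filter⁺ (adjacent? G u) (Uniqueₚ.allFin⁺ _)

  neighbours-adjacent : ∀ u → All (Adjacent G u) (neighbours G u)
  neighbours-adjacent u = Allₚ.all-filter (adjacent? G u) (allFin (size G))

  -- Discarding from `M` the at most `y` vertices that lie on the path leaves `q ∸ 1` of them to
  -- serve as leaves. All sparklers of the soundness proof are obtained in this way, from neighbours
  -- that may overlap the path.
  sparkles-from : ∀ {q p c P M y} → 1 ≤ q → Walk G c P → Unique (c ∷ P) → length P ≡ p →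
    Unique M → All (Adjacent G c) M → length (filter (λ v → _∈?_ G v P) M) ≤ y →
    (q ∸ 1) + y ≤ length M → Sparkles G q p
  sparkles-from {suc q} {p} {c} {P} {M} {y} _ w (c∉P ∷ uP) lenP uM adjM few many = record
    { centre = c ; leaves = L ; path = P
    ; leaves-length = cong suc lenL
    ; path-length = lenP
    ; distinct = Allₚ.++⁺ (All.tabulate λ x∈ → adjacent⇒≢ (All.lookup adjM (L⊆M x∈))) c∉P
        ∷ ++-unique (Uniqueₚ.take⁺ q (Uniqueₚ.filter⁺ _ uM)) uP L∉P
    ; leaves-adjacent = All.tabulate λ x∈ → All.lookup adjM (L⊆M x∈)
    ; path-walk = w }
    where
    inP? = λ v → _∈?_ G v P
    F = filter (¬? ∘ inP?) M
    L = take q F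
    L⊆M : ∀ {x} → x ∈ L → x ∈ M
    L⊆M x∈ = proj₁ (∈-filter⁻ (¬? ∘ inP?) (∈-take q F x∈))
    L∉P : ∀ {x} → x ∈ L → x ∉ P
    L∉P x∈ = proj₂ (∈-filter⁻ (¬? ∘ inP?) {xs = M} (∈-take q F x∈))
    q≤F : q ≤ length F
    q≤F = +-cancelʳ-≤ y q (length F) (begin
      q + y ≤⟨ many ⟩
      length M ≡⟨ filter-length-split inP? M ⟨
      length (filter inP? M) + length F ≤⟨ +-monoˡ-≤ (length F) few ⟩
      y + length F ≡⟨ +-comm y _ ⟩
      length F + y ∎)
      where open ≤-Reasoning
    lenL : length L ≡ q
    lenL = length-take-≤ q≤F

-- Sparklers as lists of vertices

private
  T⇒≡ : ∀ {b} → T b → b ≡ true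
  T⇒≡ = Equivalence.to Bool.T-≡
  ≡⇒T : ∀ {b} → b ≡ true → T b
  ≡⇒T = Equivalence.from Bool.T-≡

edgeDir-centre : ∀ q {b} → b < q → edgeDir q 0 (suc b) ≡ true
edgeDir-centre q b<q = T⇒≡ (Equivalence.from Bool.T-∨ (inj₁ (≤⇒≤ᵇ b<q)))

edgeDir-path : ∀ q {a} → q ≤ a → edgeDir q a (suc a) ≡ true
edgeDir-path q {a} q≤a =
  T⇒≡ (Equivalence.from Bool.T-∨ (inj₂ (Equivalence.from Bool.T-∧ (≤⇒≤ᵇ q≤a , ≡⇒≡ᵇ (suc a) (suc a) refl))))

edgeDir⁻ : ∀ q a b → edgeDir q a b ≡ true → (a ≡ 0 × 1 ≤ b × b ≤ q) ⊎ (q ≤ a × b ≡ suc a)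
edgeDir⁻ q a b e with Equivalence.to Bool.T-∨ (≡⇒T e)
... | inj₁ t with Equivalence.to Bool.T-∧ t
...   | t₁ , t₂ with Equivalence.to Bool.T-∧ t₂
...     | t₃ , t₄ = inj₁ (≡ᵇ⇒≡ a 0 t₁ , ≤ᵇ⇒≤ 1 b t₃ , ≤ᵇ⇒≤ b q t₄)
edgeDir⁻ q a b e | inj₂ t with Equivalence.to Bool.T-∧ t
...   | t₁ , t₂ = inj₂ (≤ᵇ⇒≤ q a t₁ , ≡ᵇ⇒≡ b (suc a) t₂)

-- Lookup as a relation, so that a position in a concatenation can be analysed by pattern matching.
data At {A : Set} : List A → ℕ → A → Set where
  at-zero : ∀ {x xs} → At (x ∷ xs) 0 x
  at-suc : ∀ {x xs n y} → At xs n y → At (x ∷ xs) (suc n) y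

at-lookup : ∀ {A : Set} (xs : List A) i → At xs (toℕ i) (lookup xs i)
at-lookup (x ∷ xs) zero = at-zero
at-lookup (x ∷ xs) (suc i) = at-suc (at-lookup xs i)

at-++⁻ : ∀ {A : Set} (xs : List A) {ys n y} → At (xs ++ ys) n y →
  (n < length xs × y ∈ xs) ⊎ ∃ λ m → n ≡ length xs + m × At ys m y
at-++⁻ [] a = inj₂ (_ , refl , a)
at-++⁻ (x ∷ xs) at-zero = inj₁ (s≤s z≤n , here refl)
at-++⁻ (x ∷ xs) (at-suc a) with at-++⁻ xs a
... | inj₁ (n< , y∈) = inj₁ (s≤s n< , there y∈)
... | inj₂ (m , eq , a′) = inj₂ (m , cong suc eq , a′)

lookup-injective : ∀ {A : Set} {xs : List A} → Unique xs → ∀ i j → lookup xs i ≡ lookup xs j → i ≡ j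
lookup-injective (x∉ ∷ u) zero zero eq = refl
lookup-injective {xs = x ∷ xs} (x∉ ∷ u) zero (suc j) eq = ⊥-elim (All.lookup x∉ (∈-lookup {xs = xs} j) eq)
lookup-injective {xs = x ∷ xs} (x∉ ∷ u) (suc i) zero eq = ⊥-elim (All.lookup x∉ (∈-lookup {xs = xs} i) (≡-sym eq))
lookup-injective (x∉ ∷ u) (suc i) (suc j) eq = cong suc (lookup-injective u i j eq)

module _ {G : Graph} where

  walk-first : ∀ {u vs v} → Walk G u vs → At vs 0 v → Adjacent G u v
  walk-first (e ∷ w) at-zero = e

  walk-step : ∀ {u vs n v v′} → Walk G u vs → At vs n v → At vs (suc n) v′ → Adjacent G v v′
  walk-step (e ∷ w) at-zero (at-suc a) = walk-first w a
  walk-step (e ∷ w) (at-suc a) (at-suc a′) = walk-step w a a′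

  walk-tabulate : ∀ {n c} (f : Fin n → V G) → (∀ i → toℕ i ≡ 0 → Adjacent G c (f i)) →
    (∀ i j → toℕ j ≡ suc (toℕ i) → Adjacent G (f i) (f j)) → Walk G c (tabulate f)
  walk-tabulate {zero} f first next = []
  walk-tabulate {suc n} f first next =
    first zero refl ∷ walk-tabulate (f ∘ suc) (λ i eq → next zero (suc i) (cong suc eq))
                                    (λ i j eq → next (suc i) (suc j) (cong suc eq))

  sparkles⇒subgraph : ∀ {q p} → Sparkles G q p → 𝒞 (Sparkler q p) G
  sparkles⇒subgraph {suc q} {p} s = f , f-injective , f-edge
    where
    open Sparkles s
    -- This is the order in which `Sparkler` numbers its vertices, so the embedding is a plain
    -- lookup.
    XS = centre ∷ leaves ++ path
    lenL : length leaves ≡ q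
    lenL = suc-injective leaves-length
    lenXS : suc q + p ≡ length XS
    lenXS = cong suc (≡-sym (trans (length-++ leaves) (cong₂ _+_ lenL path-length)))
    f : Fin (suc q + p) → V G
    f i = lookup XS (cast lenXS i)
    f-injective : Injective _≡_ _≡_ f
    f-injective {i} {j} eq = Fin.toℕ-injective (begin
      toℕ i ≡⟨ Fin.toℕ-cast lenXS i ⟨
      toℕ (cast lenXS i) ≡⟨ cong toℕ (lookup-injective distinct _ _ eq) ⟩
      toℕ (cast lenXS j) ≡⟨ Fin.toℕ-cast lenXS j ⟩
      toℕ j ∎)
      where open ≡-Reasoning
    at-f : ∀ i → At XS (toℕ i) (f i)
    at-f i = subst (λ n → At XS n (f i)) (Fin.toℕ-cast lenXS i) (at-lookup XS (cast lenXS i))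
    edge : ∀ {a b x y} → At XS a x → At XS b y → edgeDir (suc q) a b ≡ true → Adjacent G x y
    edge {a} {b} ax ay e with edgeDir⁻ (suc q) a b e
    edge at-zero (at-suc ay) e | inj₁ (_ , _ , s≤s b≤q) with at-++⁻ leaves ay
    ... | inj₁ (_ , y∈) = All.lookup leaves-adjacent y∈
    -- The centre is joined to one number beyond the leaves, namely to the first vertex of the path.
    ... | inj₂ (zero , _ , ay′) = walk-first path-walk ay′
    ... | inj₂ (suc m , refl , _) = ⊥-elim (m+1+n≰m (length leaves) (subst (length leaves + suc m ≤_) (≡-sym lenL) b≤q))
    edge at-zero at-zero e | inj₁ (_ , () , _)
    edge (at-suc ax) (at-suc ay) e | inj₂ (s≤s q≤a , refl) with at-++⁻ leaves ax | at-++⁻ leaves ay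
    ... | inj₁ (a< , _) | _ = ⊥-elim (<⇒≱ a< (subst (_≤ _) (≡-sym lenL) q≤a))
    ... | inj₂ (m , refl , _) | inj₁ (a< , _) = ⊥-elim (<⇒≱ a< (≤-trans (m≤m+n _ m) (n≤1+n _)))
    ... | inj₂ (m , refl , ax′) | inj₂ (m′ , eq , ay′) =
      walk-step path-walk ax′ (subst (λ n → At path n _)
        (+-cancelˡ-≡ (length leaves) m′ (suc m) (trans (≡-sym eq) (≡-sym (+-suc _ m)))) ay′)
    f-edge : ∀ u v → sparkAdj (suc q) p u v ≡ true → Adjacent G (f u) (f v)
    f-edge u v e with Equivalence.to Bool.T-∨ (≡⇒T e)
    ... | inj₁ t = edge (at-f u) (at-f v) (T⇒≡ t)
    ... | inj₂ t = adjacent-sym {G = G} (edge (at-f v) (at-f u) (T⇒≡ t))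

  subgraph⇒sparkles : ∀ {q p} → 1 ≤ q → 𝒞 (Sparkler q p) G → Sparkles G q p
  subgraph⇒sparkles {suc q} {p} _ (f , f-injective , f-edge) = record
    { centre = f zero ; leaves = L ; path = P
    ; leaves-length = cong suc (length-tabulate leaf)
    ; path-length = length-tabulate node
    ; distinct = Allₚ.++⁺ {xs = L} (Allₚ.tabulate⁺ {f = leaf} λ i eq → Fin.0≢1+n (f-injective eq))
                          (Allₚ.tabulate⁺ {f = node} λ i eq → Fin.0≢1+n (f-injective eq))
        ∷ ++-unique (Uniqueₚ.tabulate⁺ λ eq → Fin.↑ˡ-injective p _ _ (Fin.suc-injective (f-injective eq)))
                    (Uniqueₚ.tabulate⁺ λ eq → Fin.↑ʳ-injective q _ _ (Fin.suc-injective (f-injective eq)))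
                    disjoint
    ; leaves-adjacent = Allₚ.tabulate⁺ λ i → f-edge zero _ (dir zero (suc (i ↑ˡ p))
        (edgeDir-centre (suc q) (subst (_< suc q) (≡-sym (Fin.toℕ-↑ˡ i p)) (m<n⇒m<1+n (Fin.toℕ<n i)))))
    ; path-walk = walk-tabulate node
        (λ i eq → f-edge zero _ (dir zero (suc (q ↑ʳ i))
          (edgeDir-centre (suc q) (s≤s (≤-reflexive (trans (Fin.toℕ-↑ʳ q i) (trans (cong (q +_) eq) (+-identityʳ q))))))))
        (λ i j eq → f-edge _ _ (dir (suc (q ↑ʳ i)) (suc (q ↑ʳ j)) (consecutive i j eq))) }
    where
    leaf : Fin q → V G
    leaf i = f (suc (i ↑ˡ p))
    node : Fin p → V G
    node i = f (suc (q ↑ʳ i))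
    L = tabulate leaf
    P = tabulate node
    dir : ∀ u v → edgeDir (suc q) (toℕ u) (toℕ v) ≡ true → sparkAdj (suc q) p u v ≡ true
    dir u v e = T⇒≡ (Equivalence.from Bool.T-∨ (inj₁ (≡⇒T e)))
    consecutive : ∀ i j → toℕ j ≡ suc (toℕ i) → edgeDir (suc q) (suc (toℕ (q ↑ʳ i))) (suc (toℕ (q ↑ʳ j))) ≡ true
    consecutive i j eq rewrite Fin.toℕ-↑ʳ q i | Fin.toℕ-↑ʳ q j | eq | +-suc q (toℕ i) =
      edgeDir-path (suc q) (s≤s (m≤m+n q (toℕ i)))
    disjoint : ∀ {x} → x ∈ L → x ∉ P
    disjoint x∈L x∈P with ∈-tabulate⁻ {f = leaf} x∈L | ∈-tabulate⁻ {f = node} x∈P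
    ... | i , refl | j , eq = <⇒≢ (≤-trans (Fin.toℕ<n i) (m≤m+n q (toℕ j))) (begin
      toℕ i ≡⟨ Fin.toℕ-↑ˡ i p ⟨
      toℕ (i ↑ˡ p) ≡⟨ cong toℕ (Fin.suc-injective (f-injective eq)) ⟩
      toℕ (q ↑ʳ j) ≡⟨ Fin.toℕ-↑ʳ q j ⟩
      q + toℕ j ∎)
      where open ≡-Reasoning

-- Definable properties

infix 2 _⇔_
_⇔_ : Set → Set → Set
A ⇔ B = (A → B) × (B → A)

≡ᵇ-refl : ∀ n → (n ≡ᵇ n) ≡ true
≡ᵇ-refl zero = refl
≡ᵇ-refl (suc n) = ≡ᵇ-refl n

≢⇒≡ᵇ-false : ∀ {m n} → m ≢ n → (m ≡ᵇ n) ≡ false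
≢⇒≡ᵇ-false {m} {n} m≢n with m ≡ᵇ n in eq
... | false = refl
... | true = ⊥-elim (m≢n (≡ᵇ⇒≡ m n (subst T (≡-sym eq) tt)))

update-same : ∀ {G} (ρ : Env G) x v → update {G} ρ x v x ≡ just v
update-same ρ x v rewrite ≡ᵇ-refl x = refl

update-other : ∀ {G} (ρ : Env G) {x y} v → x ≢ y → update {G} ρ x v y ≡ ρ y
update-other ρ v x≢y rewrite ≢⇒≡ᵇ-false x≢y = refl

Context : ℕ → Graph → Set
Context k G = Vec (Fin (size G)) k

-- The most recent vertex of a context comes first in the vector; variables are named by the order
-- in which they are bound, so the head of a context of length k + 1 interprets the variable k.
level : ∀ {k} → Fin k → ℕ
level {suc k} zero = k
level {suc k} (suc i) = level i

level< : ∀ {k} (i : Fin k) → level i < k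
level< {suc k} zero = ≤-refl
level< {suc k} (suc i) = m<n⇒m<1+n (level< i)

Agree : ∀ {G k} → Env G → Context k G → Set
Agree ρ vs = ∀ i → ρ (level i) ≡ just (lookupᵛ vs i)

agree-update : ∀ {G k} {ρ : Env G} {vs : Context k G} → Agree {G} ρ vs → ∀ v → Agree {G} (update {G} ρ k v) (v ∷ vs)
agree-update {G} {k} {ρ} ag v zero = update-same {G} ρ k v
agree-update {G} {k} {ρ} ag v (suc i) = trans (update-other {G} ρ v (λ eq → <⇒≢ (level< i) (≡-sym eq))) (ag i)

Property : ℕ → Set₁
Property k = (G : Graph) → Context k G → Set

record Definable (k d : ℕ) (P : Property k) : Set where
  field
    formula : Formula
    closed : All (_< k) (freeVars formula)
    bounded : depth formula ≤ d
    correct : ∀ {G ρ vs} → Agree {G} ρ vs → Sat G ρ formula ⇔ P G vs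

Class : ℕ → Set₁
Class k = (G : Graph) → Context k G → Fin (size G) → Set

-- Quantifier-free, so restricting a quantifier to such a class costs no depth. The variable `z`
-- stays a parameter because one class is tested at variables bound at different levels.
record DefinableClass (k : ℕ) (C : Class k) : Set where
  field
    formula : ℕ → Formula
    closed : ∀ z → All (λ x → x < k ⊎ x ≡ z) (freeVars (formula z))
    bounded : ∀ z → depth (formula z) ≤ 0
    correct : ∀ {G ρ vs} → Agree {G} ρ vs → ∀ {z v} → ρ z ≡ just v → Sat G ρ (formula z) ⇔ C G vs v

open Definable
open DefinableClass

remove-closed : ∀ {k} xs → All (_< suc k) xs → All (_< k) (remove k xs)
remove-closed [] [] = []
remove-closed {k} (x ∷ xs) (x< ∷ xs<) with k ≡ᵇ x in eq
... | true = remove-closed xs xs<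
... | false = ≤∧≢⇒< (s≤s⁻¹ x<) (λ { refl → true≢false (trans (≡-sym (≡ᵇ-refl k)) eq) }) ∷ remove-closed xs xs<
  where
  true≢false : true ≢ false
  true≢false ()

relax : ∀ {k d d′ P} → d ≤ d′ → Definable k d P → Definable k d′ P
relax d≤ D = record { formula = formula D ; closed = closed D ; bounded = ≤-trans (bounded D) d≤ ; correct = correct D }

infixr 6 _∧ᴰ_
infixr 5 _∨ᴰ_

∃ᴰ : ∀ {k d P} → Definable (suc k) d P → Definable k (suc d) (λ G vs → Σ (Fin (size G)) λ v → P G (v ∷ vs))
∃ᴰ {k} D = record
  { formula = ∃' k (formula D)
  ; closed = remove-closed _ (closed D)
  ; bounded = s≤s (bounded D)
  ; correct = λ ag → (λ { (v , t) → v , proj₁ (correct D (agree-update ag v)) t })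
                   , (λ { (v , t) → v , proj₂ (correct D (agree-update ag v)) t }) }

∀ᴰ : ∀ {k d P} → Definable (suc k) d P → Definable k (suc d) (λ G vs → ∀ v → P G (v ∷ vs))
∀ᴰ {k} D = record
  { formula = ∀' k (formula D)
  ; closed = remove-closed _ (closed D)
  ; bounded = s≤s (bounded D)
  ; correct = λ ag → (λ t v → proj₁ (correct D (agree-update ag v)) (t v))
                   , (λ t v → proj₂ (correct D (agree-update ag v)) (t v)) }

_∧ᴰ_ : ∀ {k d P Q} → Definable k d P → Definable k d Q → Definable k d (λ G vs → P G vs × Q G vs)
D ∧ᴰ E = record
  { formula = formula D ∧' formula E
  ; closed = Allₚ.++⁺ (closed D) (closed E)
  ; bounded = ⊔-lub (bounded D) (bounded E)
  ; correct = λ ag → Product.map (proj₁ (correct D ag)) (proj₁ (correct E ag))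
                   , Product.map (proj₂ (correct D ag)) (proj₂ (correct E ag)) }

_∨ᴰ_ : ∀ {k d P Q} → Definable k d P → Definable k d Q → Definable k d (λ G vs → P G vs ⊎ Q G vs)
D ∨ᴰ E = record
  { formula = formula D ∨' formula E
  ; closed = Allₚ.++⁺ (closed D) (closed E)
  ; bounded = ⊔-lub (bounded D) (bounded E)
  ; correct = λ ag → Sum.map (proj₁ (correct D ag)) (proj₁ (correct E ag))
                   , Sum.map (proj₂ (correct D ag)) (proj₂ (correct E ag)) }

eq-correct : ∀ {G} {ρ : Env G} {x y u v} → ρ x ≡ just u → ρ y ≡ just v → Sat G ρ (x ≐ y) ⇔ (u ≡ v)
eq-correct ex ey rewrite ex | ey = id , id

adj-correct : ∀ {G} {ρ : Env G} {x y u v} → ρ x ≡ just u → ρ y ≡ just v → Sat G ρ (x ∼ y) ⇔ (adj G u v ≡ true)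
adj-correct ex ey rewrite ex | ey = id , id

-- The syntax has no propositional constants, so even truth has to mention a variable that is
-- already bound; hence the context `suc k`.
⊤ᴰ : ∀ {k d} → Definable (suc k) d (λ _ _ → ⊤)
⊤ᴰ {k} = record
  { formula = k ≐ k ; closed = ≤-refl ∷ ≤-refl ∷ [] ; bounded = z≤n
  ; correct = λ {G} {ρ} ag → (λ _ → tt) , λ _ → proj₂ (eq-correct {G} {ρ} (ag zero) (ag zero)) refl }

⊥ᴰ : ∀ {k d} → Definable (suc k) d (λ _ _ → ⊥)
⊥ᴰ {k} = record
  { formula = ¬' (k ≐ k) ; closed = ≤-refl ∷ ≤-refl ∷ [] ; bounded = z≤n
  ; correct = λ {G} {ρ} ag → (λ n → n (proj₂ (eq-correct {G} {ρ} (ag zero) (ag zero)) refl)) , λ () }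

-- The condition `A` is decided while the formula is being built, and its proof may be used in
-- choosing the rest of the formula, as for the depth bounds in `balancedᴰ`.
guardᴰ : ∀ {k d P} {A : Set} → Dec A → (A → Definable (suc k) d P) → Definable (suc k) d (λ G vs → A × P G vs)
guardᴰ (yes a) D = record
  { formula = formula (D a) ; closed = closed (D a) ; bounded = bounded (D a)
  ; correct = λ ag → (λ t → a , proj₁ (correct (D a) ag) t) , λ { (_ , t) → proj₂ (correct (D a) ag) t } }
guardᴰ (no ¬a) _ = record
  { formula = formula (⊥ᴰ {d = 0}) ; closed = closed (⊥ᴰ {d = 0}) ; bounded = z≤n
  ; correct = λ {G} {ρ} {vs} ag → (λ t → ⊥-elim (proj₁ (correct (⊥ᴰ {d = 0}) {G} {ρ} {vs} ag) t)) , λ { (a , _) → ⊥-elim (¬a a) } }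

⋁ᴰ : ∀ {k d} n {P : Fin n → Property (suc k)} → (∀ i → Definable (suc k) d (P i)) →
  Definable (suc k) d (λ G vs → Σ (Fin n) λ i → P i G vs)
⋁ᴰ zero D = record
  { formula = formula (⊥ᴰ {d = 0}) ; closed = closed (⊥ᴰ {d = 0}) ; bounded = z≤n
  ; correct = λ {G} {ρ} {vs} ag → (λ t → ⊥-elim (proj₁ (correct (⊥ᴰ {d = 0}) {G} {ρ} {vs} ag) t)) , λ { (() , _) } }
⋁ᴰ (suc n) D = record
  { formula = formula E ; closed = closed E ; bounded = bounded E
  ; correct = λ ag →
      (λ t → [ (λ t₀ → zero , t₀) , (λ { (i , tᵢ) → suc i , tᵢ }) ]′ (proj₁ (correct E ag) t))
    , (λ { (zero , t₀) → proj₂ (correct E ag) (inj₁ t₀) ; (suc i , tᵢ) → proj₂ (correct E ag) (inj₂ (i , tᵢ)) }) }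
  where E = D zero ∨ᴰ ⋁ᴰ n (D ∘ suc)

weaken : ∀ {k C} → DefinableClass k C → DefinableClass (suc k) (λ G vs → C G (tailᵛ vs))
weaken D = record
  { formula = formula D
  ; closed = λ z → All.map (Sum.map₁ m<n⇒m<1+n) (closed D z)
  ; bounded = bounded D
  ; correct = λ { {vs = v ∷ vs} ag → correct D (λ i → ag (suc i)) } }

adjacentᴰ : ∀ {k d} (i j : Fin k) b → Definable k d (λ G vs → adj G (lookupᵛ vs i) (lookupᵛ vs j) ≡ b)
adjacentᴰ i j true = record
  { formula = level i ∼ level j ; closed = level< i ∷ level< j ∷ [] ; bounded = z≤n
  ; correct = λ {G} {ρ} ag → adj-correct {G} {ρ} (ag i) (ag j) }
adjacentᴰ i j false = record
  { formula = ¬' (level i ∼ level j) ; closed = level< i ∷ level< j ∷ [] ; bounded = z≤n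
  ; correct = λ {G} {ρ} ag → (λ n → Bool.¬-not (n ∘ proj₂ (adj-correct {G} {ρ} (ag i) (ag j))))
                           , (λ e t → contra e (proj₁ (adj-correct {G} {ρ} (ag i) (ag j)) t)) }
  where
  contra : ∀ {b} → b ≡ false → b ≡ true → ⊥
  contra refl ()

memberᴰ : ∀ {k d C} → DefinableClass k C → ∀ i → Definable k d (λ G vs → C G vs (lookupᵛ vs i))
memberᴰ D i = record
  { formula = formula D (level i)
  ; closed = All.map [ id , (λ { refl → level< i }) ]′ (closed D (level i))
  ; bounded = ≤-trans (bounded D (level i)) z≤n
  ; correct = λ ag → correct D ag (ag i) }

infixl 7 _∩ᶜ_
_∩ᶜ_ : ∀ {k C C′} → DefinableClass k C → DefinableClass k C′ → DefinableClass k (λ G vs v → C G vs v × C′ G vs v)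
D ∩ᶜ E = record
  { formula = λ z → formula D z ∧' formula E z
  ; closed = λ z → Allₚ.++⁺ (closed D z) (closed E z)
  ; bounded = λ z → ⊔-lub (bounded D z) (bounded E z)
  ; correct = λ ag e → Product.map (proj₁ (correct D ag e)) (proj₁ (correct E ag e))
                     , Product.map (proj₂ (correct D ag e)) (proj₂ (correct E ag e)) }

differsᶜ : ∀ {k} (i : Fin k) → DefinableClass k (λ G vs v → lookupᵛ vs i ≢ v)
differsᶜ i = record
  { formula = λ z → ¬' (level i ≐ z) ; closed = λ z → inj₁ (level< i) ∷ inj₂ refl ∷ [] ; bounded = λ z → z≤n
  ; correct = λ {G} {ρ} ag e → (λ n → n ∘ proj₂ (eq-correct {G} {ρ} (ag i) e))
                             , (λ n → n ∘ proj₁ (eq-correct {G} {ρ} (ag i) e)) }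

adjacentᶜ : ∀ {k} (i : Fin k) b → DefinableClass k (λ G vs v → adj G (lookupᵛ vs i) v ≡ b)
adjacentᶜ i true = record
  { formula = λ z → level i ∼ z ; closed = λ z → inj₁ (level< i) ∷ inj₂ refl ∷ [] ; bounded = λ z → z≤n
  ; correct = λ {G} {ρ} ag e → adj-correct {G} {ρ} (ag i) e }
adjacentᶜ i false = record
  { formula = λ z → ¬' (level i ∼ z) ; closed = λ z → inj₁ (level< i) ∷ inj₂ refl ∷ [] ; bounded = λ z → z≤n
  ; correct = λ {G} {ρ} ag e → (λ n → Bool.¬-not (n ∘ proj₂ (adj-correct {G} {ρ} (ag i) e)))
                             , (λ eq t → contra eq (proj₁ (adj-correct {G} {ρ} (ag i) e) t)) }
  where
  contra : ∀ {b} → b ≡ false → b ≡ true → ⊥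
  contra refl ()

-- Lower bounds on the size of a class

module _ (G : Graph) where

  Refine : (V G → Set) → V G → Bool → V G → Set
  Refine C v b z = C z × (v ≢ z × adj G v z ≡ b)

  -- The depth of a conjunction is a maximum, so both parts may use all of the remaining `d`; this
  -- is how `n` vertices can be certified with fewer than `n` quantifiers. The sizes of the parts
  -- are chosen by a finite disjunction, not by a quantifier.
  Split : ℕ → ℕ → (V G → Set) → Set
  Split zero d C = ⊤
  Split (suc n) zero C = ⊥
  Split (suc n) (suc d) C = Σ (V G) λ v → C v × Σ (Fin (suc n)) λ a →
    Split (toℕ a) d (Refine C v true) × Split (n ∸ toℕ a) d (Refine C v false)

  Homogeneous : Bool → ℕ → (V G → Set) → Set
  Homogeneous b zero C = ⊤
  Homogeneous b (suc a) C = Σ (V G) λ v → C v × Homogeneous b a (Refine C v b)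

  -- No t vertices meet all pairs in C whose adjacency differs from b.
  Uncovered : Bool → ℕ → (V G → Set) → Set
  Uncovered b zero C = Σ (V G) λ v → C v × Σ (V G) (Refine C v (not b))
  Uncovered b (suc t) C = ∀ x → Uncovered b t (λ z → C z × x ≢ z)

  -- In a class with fewer than n vertices, the at most n − a − 1 vertices outside a homogeneous set of
  -- size a would meet every pair of the other kind.
  Balanced : Bool → ℕ → ℕ → (V G → Set) → Set
  Balanced b n d C = Σ (Fin n) λ a → (toℕ a ≤ d × 2 + (n ∸ suc (toℕ a)) ≤ d) ×
    (Homogeneous b (toℕ a) C × Uncovered b (n ∸ suc (toℕ a)) C)

  Large : ℕ → ℕ → (V G → Set) → Set
  Large n d C = (Homogeneous true d C ⊎ Homogeneous false d C) ⊎
    (Balanced true n d C ⊎ Balanced false n d C) ⊎ Split n d C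

refineᶜ : ∀ {k C} → DefinableClass k C → ∀ b →
  DefinableClass (suc k) (λ G vs → Refine G (C G (tailᵛ vs)) (lookupᵛ vs zero) b)
refineᶜ D b = weaken D ∩ᶜ (differsᶜ zero ∩ᶜ adjacentᶜ zero b)

splitᴰ : ∀ n d {k C} → DefinableClass (suc k) C → Definable (suc k) d (λ G vs → Split G n d (C G vs))
splitᴰ zero d D = ⊤ᴰ
splitᴰ (suc n) zero D = ⊥ᴰ
splitᴰ (suc n) (suc d) D = ∃ᴰ (memberᴰ (weaken D) zero ∧ᴰ
  ⋁ᴰ (suc n) λ a → splitᴰ (toℕ a) d (refineᶜ D true) ∧ᴰ splitᴰ (n ∸ toℕ a) d (refineᶜ D false))

homogeneousᴰ : ∀ b a {k C} → DefinableClass (suc k) C → Definable (suc k) a (λ G vs → Homogeneous G b a (C G vs))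
homogeneousᴰ b zero D = ⊤ᴰ
homogeneousᴰ b (suc a) D = ∃ᴰ (memberᴰ (weaken D) zero ∧ᴰ homogeneousᴰ b a (refineᶜ D b))

uncoveredᴰ : ∀ b t {k C} → DefinableClass (suc k) C → Definable (suc k) (2 + t) (λ G vs → Uncovered G b t (C G vs))
uncoveredᴰ b zero D = ∃ᴰ (memberᴰ (weaken D) zero ∧ᴰ ∃ᴰ (memberᴰ (weaken (refineᶜ D (not b))) zero))
uncoveredᴰ b (suc t) D = ∀ᴰ (uncoveredᴰ b t (weaken D ∩ᶜ differsᶜ zero))

balancedᴰ : ∀ b n d {k C} → DefinableClass (suc k) C → Definable (suc k) d (λ G vs → Balanced G b n d (C G vs))
balancedᴰ b n d D = ⋁ᴰ n λ a → guardᴰ (toℕ a ≤? d ×-dec 2 + (n ∸ suc (toℕ a)) ≤? d) λ { (a≤d , t≤d) →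
  relax a≤d (homogeneousᴰ b (toℕ a) D) ∧ᴰ relax t≤d (uncoveredᴰ b (n ∸ suc (toℕ a)) D) }

largeᴰ : ∀ n d {k C} → DefinableClass (suc k) C → Definable (suc k) d (λ G vs → Large G n d (C G vs))
largeᴰ n d D = (homogeneousᴰ true d D ∨ᴰ homogeneousᴰ false d D) ∨ᴰ
  (balancedᴰ true n d D ∨ᴰ balancedᴰ false n d D) ∨ᴰ splitᴰ n d D

module _ {G : Graph} where

  Uniform : Bool → List (V G) → Set
  Uniform b = AllPairs (λ u v → u ≢ v × adj G u v ≡ b)

  uniform⇒unique : ∀ {b L} → Uniform b L → Unique L
  uniform⇒unique = AllPairs.map proj₁

  homogeneous-mono : ∀ {b m n C C′} → n ≤ m → (∀ {z} → C z → C′ z) → Homogeneous G b m C → Homogeneous G b n C′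
  homogeneous-mono {n = zero} _ _ _ = tt
  homogeneous-mono {n = suc n} (s≤s n≤m) sub (v , Cv , H) =
    v , sub Cv , homogeneous-mono n≤m (λ { (Cz , r) → sub Cz , r }) H

  homogeneous? : ∀ b n {C} → Decidable C → Dec (Homogeneous G b n C)
  homogeneous? b zero C? = yes tt
  homogeneous? b (suc n) C? = Fin.any? λ v → C? v ×-dec
    homogeneous? b n (λ z → C? z ×-dec (¬? (v Fin.≟ z) ×-dec (adj G v z Bool.≟ b)))

  uniform⇒homogeneous : ∀ {b L C} → Uniform b L → All C L → Homogeneous G b (length L) C
  uniform⇒homogeneous [] [] = tt
  uniform⇒homogeneous {L = v ∷ L} (r ∷ u) (Cv ∷ CL) =
    v , Cv , uniform⇒homogeneous u (All.zip (CL , r))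

  homogeneous⇒uniform : ∀ {b} n {C} → Homogeneous G b n C → ∃ λ L → Uniform b L × All C L × length L ≡ n
  homogeneous⇒uniform zero _ = [] , [] , [] , refl
  homogeneous⇒uniform (suc n) (v , Cv , H) with homogeneous⇒uniform n H
  ... | L , u , CL , eq = v ∷ L , All.map proj₂ CL ∷ u , Cv ∷ All.map proj₁ CL , cong suc eq

  side? : ∀ v b → Decidable (λ z → v ≢ z × adj G v z ≡ b)
  side? v b z = ¬? (v Fin.≟ z) ×-dec (adj G v z Bool.≟ b)

  side : V G → Bool → List (V G) → List (V G)
  side v b = filter (side? v b)

  side-lengths-∷ : ∀ {v x} L → v ≢ x →
    length (side v true (x ∷ L)) + length (side v false (x ∷ L)) ≡ suc (length (side v true L) + length (side v false L))
  side-lengths-∷ {v} {x} L v≢x = by-adjacency (adj G v x) refl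
    where
    by-adjacency : ∀ b → adj G v x ≡ b →
      length (side v true (x ∷ L)) + length (side v false (x ∷ L)) ≡ suc (length (side v true L) + length (side v false L))
    by-adjacency true e
      rewrite filter-accept (side? v true) {x} {L} (v≢x , e)
            | filter-reject (side? v false) {x} {L} (λ { (_ , e′) → Bool.not-¬ e′ e }) = refl
    by-adjacency false e
      rewrite filter-accept (side? v false) {x} {L} (v≢x , e)
            | filter-reject (side? v true) {x} {L} (λ { (_ , e′) → Bool.not-¬ e′ e }) = +-suc _ _

  side-lengths : ∀ {v L} → All (v ≢_) L → length (side v true L) + length (side v false L) ≡ length L
  side-lengths [] = refl
  side-lengths {v} {x ∷ L} (v≢x ∷ v≢) = trans (side-lengths-∷ L v≢x) (cong suc (side-lengths v≢))

  side-lengths-∈ : ∀ {v L} → Unique L → v ∈ L → suc (length (side v true L) + length (side v false L)) ≡ length L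
  side-lengths-∈ {v} {x ∷ L} (v≢ ∷ u) (here refl)
    rewrite filter-reject (side? v true) {v} {L} (λ { (n , _) → n refl })
          | filter-reject (side? v false) {v} {L} (λ { (n , _) → n refl }) = cong suc (side-lengths v≢)
  side-lengths-∈ {v} {x ∷ L} (x≢ ∷ u) (there v∈) =
    cong suc (trans (side-lengths-∷ L λ { refl → All≢⇒∉ x≢ v∈ }) (side-lengths-∈ u v∈))

  side-class : ∀ {v b L C} → All C L → All (Refine G C v b) (side v b L)
  side-class {v} {b} {L} CL = All.tabulate λ z∈ → let (z∈L , r) = ∈-filter⁻ (side? v b) {xs = L} z∈ in All.lookup CL z∈L , r

  pairwise⇒uniform : ∀ {b L} → Unique L → (∀ {y z} → y ∈ L → z ∈ L → y ≢ z → adj G y z ≡ b) → Uniform b L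
  pairwise⇒uniform [] _ = []
  pairwise⇒uniform (y≢ ∷ u) R =
    All.tabulate (λ z∈ → All.lookup y≢ z∈ , R (here refl) (there z∈) (All.lookup y≢ z∈))
    ∷ pairwise⇒uniform u (λ y∈ z∈ → R (there y∈) (there z∈))

  -- Every other vertex of `L` has adjacency `b` to `x`. So it has `x` on its `b`-side and, being
  -- one-sided, nothing on the other.
  one-sided⇒uniform : ∀ {b x L} → Unique L → x ∈ L →
    (∀ {y} → y ∈ L → ¬ (1 ≤ length (side y b L) × 1 ≤ length (side y (not b) L))) →
    ¬ (1 ≤ length (side x (not b) L)) → Uniform b L
  one-sided⇒uniform {b} {x} {L} u x∈ one-sided none = pairwise⇒uniform u λ {y} {z} → pair y z
    where
    occupied : ∀ {y z c} → z ∈ L → y ≢ z → adj G y z ≡ c → 1 ≤ length (side y c L)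
    occupied {y} {z} {c} z∈ y≢z e = filter-some (side? y c) (lose {P = λ z → y ≢ z × adj G y z ≡ c} z∈ (y≢z , e))
    from-x : ∀ {z} → z ∈ L → x ≢ z → adj G x z ≡ b
    from-x {z} z∈ x≢z with adj G x z Bool.≟ b
    ... | yes e = e
    ... | no ne = ⊥-elim (none (occupied z∈ x≢z (Bool.¬-not ne)))
    pair : ∀ y z → y ∈ L → z ∈ L → y ≢ z → adj G y z ≡ b
    pair y z y∈ z∈ y≢z with x Fin.≟ y
    ... | yes refl = from-x z∈ y≢z
    ... | no x≢y with adj G y z Bool.≟ b
    ...   | yes e = e
    ...   | no ne = ⊥-elim (one-sided y∈ (occupied x∈ (x≢y ∘ ≡-sym) (adjacent-sym {G = G} (from-x y∈ x≢y))
                                        , occupied z∈ y≢z (Bool.¬-not ne)))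

  nonempty : ∀ {n} (L : List (V G)) → length L ≡ suc n → ∃ (_∈ L)
  nonempty (v ∷ _) _ = v , here refl

  -- If n > d and n + h ≤ 2d, then n > h: the list is not homogeneous, and splitting it at a vertex
  -- with both neighbours and non-neighbours in it keeps n + h ≤ 2d on both sides.
  split-complete : ∀ {n} d {h C} {L : List (V G)} → Unique L → All C L → length L ≡ n →
    n ≤ d ⊎ n + h ≤ d + d → (∀ b → ¬ Homogeneous G b (suc h) C) → Split G n d C
  split-complete {zero} d _ _ _ _ _ = tt
  split-complete {suc n} zero u CL eq (inj₂ ()) none
  split-complete {suc n} (suc d) {h} {C} {L} u CL eq room none = choose (suc n ≤? suc d) room
    where
    A B : V G → ℕ
    A v = length (side v true L)
    B v = length (side v false L)
    A+B≡n : ∀ {v} → v ∈ L → A v + B v ≡ n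
    A+B≡n v∈ = suc-injective (trans (side-lengths-∈ u v∈) eq)
    Room : ℕ → Set
    Room m = m ≤ d ⊎ m + h ≤ d + d
    split-at : ∀ {v} → v ∈ L → Room (A v) → Room (B v) → Split G (suc n) (suc d) C
    split-at {v} v∈ roomA roomB = v , All.lookup CL v∈ , fromℕ< (s≤s A≤n) ,
      subst (λ m → Split G m d (Refine G C v true)) (≡-sym (Fin.toℕ-fromℕ< (s≤s A≤n)))
        (split-complete d (Uniqueₚ.filter⁺ _ u) (side-class CL) refl roomA none′) ,
      subst (λ m → Split G m d (Refine G C v false)) (≡-sym B≡)
        (split-complete d (Uniqueₚ.filter⁺ _ u) (side-class CL) refl roomB none′)
      where
      A≤n = subst (A v ≤_) (A+B≡n v∈) (m≤m+n (A v) (B v))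
      B≡ : n ∸ toℕ (fromℕ< (s≤s A≤n)) ≡ B v
      B≡ = trans (cong₂ _∸_ (≡-sym (A+B≡n v∈)) (Fin.toℕ-fromℕ< (s≤s A≤n))) (m+n∸m≡n (A v) (B v))
      none′ : ∀ {c} b → ¬ Homogeneous G b (suc h) (Refine G C v c)
      none′ b H = none b (homogeneous-mono ≤-refl proj₁ H)
    first : ∃ (_∈ L)
    first = nonempty L eq
    choose : Dec (suc n ≤ suc d) → suc n ≤ suc d ⊎ suc n + h ≤ suc d + suc d → Split G (suc n) (suc d) C
    choose (yes (s≤s n≤d)) _ = split-at (proj₂ first)
      (inj₁ (≤-trans (m≤m+n _ _) (≤-trans (≤-reflexive (A+B≡n (proj₂ first))) n≤d)))
      (inj₁ (≤-trans (m≤n+m _ _) (≤-trans (≤-reflexive (A+B≡n (proj₂ first))) n≤d)))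
    choose (no n≰d) (inj₁ n≤d) = ⊥-elim (n≰d n≤d)
    choose (no n≰d) (inj₂ n+h≤) with Any.any? (λ v → (1 ≤? A v) ×-dec (1 ≤? B v)) L
    ... | yes both = let (v , v∈ , 1≤A , 1≤B) = find both in
              split-at v∈ (inj₂ (shrink (m+1≤ 1≤B (A+B≡n v∈))))
                          (inj₂ (shrink (m+1≤ 1≤A (trans (+-comm (B v) (A v)) (A+B≡n v∈)))))
      where
      m+1≤ : ∀ {m m′} → 1 ≤ m′ → m + m′ ≡ n → suc m ≤ n
      m+1≤ {m} {m′} 1≤m′ e = subst₂ _≤_ (+-comm m 1) e (+-monoʳ-≤ m 1≤m′)
      shrink : ∀ {m} → suc m ≤ n → m + h ≤ d + d
      shrink {m} m<n = s≤s⁻¹ (s≤s⁻¹ (begin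
        suc (suc m + h) ≤⟨ s≤s (+-monoˡ-≤ h m<n) ⟩
        suc n + h ≤⟨ n+h≤ ⟩
        suc d + suc d ≡⟨ cong suc (+-suc d d) ⟩
        suc (suc (d + d)) ∎))
        where open ≤-Reasoning
    ... | no ¬both = ⊥-elim (by-first (1 ≤? B (proj₁ first)))
      where
      x∈ = proj₂ first
      split-free : ∀ {y} → y ∈ L → ¬ (1 ≤ A y × 1 ≤ B y)
      split-free y∈ p = ¬both (lose {P = λ v → 1 ≤ A v × 1 ≤ B v} y∈ p)
      h<n : suc h ≤ length L
      h<n = subst (suc h ≤_) (≡-sym eq) (+-cancelʳ-≤ (suc n) (suc h) (suc n) (begin
        suc h + suc n ≡⟨ cong suc (+-comm h (suc n)) ⟩
        suc (suc n + h) ≤⟨ s≤s n+h≤ ⟩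
        suc (suc d) + suc d ≤⟨ +-mono-≤ (≰⇒> n≰d) (<⇒≤ (≰⇒> n≰d)) ⟩
        suc n + suc n ∎))
        where open ≤-Reasoning
      absurd : ∀ b → Uniform b L → ⊥
      absurd b unif = none b (homogeneous-mono h<n id (uniform⇒homogeneous unif CL))
      by-first : Dec (1 ≤ B (proj₁ first)) → ⊥
      by-first (no none-B) = absurd true (one-sided⇒uniform u x∈ split-free none-B)
      by-first (yes some-B) = absurd false (one-sided⇒uniform u x∈ (λ y∈ p → split-free y∈ (proj₂ p , proj₁ p))
        (λ some-A → split-free x∈ (some-A , some-B)))

  split-sound : ∀ n d {C} → Split G n d C → ∃ λ L → Unique L × All C L × length L ≡ n
  split-sound zero d _ = [] , [] , [] , refl
  split-sound (suc n) (suc d) (v , Cv , a , S₁ , S₂) with split-sound (toℕ a) d S₁ | split-sound (n ∸ toℕ a) d S₂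
  ... | L₁ , u₁ , C₁ , eq₁ | L₂ , u₂ , C₂ , eq₂ =
    v ∷ L₁ ++ L₂
    , Allₚ.++⁺ (All.map (proj₁ ∘ proj₂) C₁) (All.map (proj₁ ∘ proj₂) C₂)
      ∷ ++-unique u₁ u₂ (λ x∈₁ x∈₂ → Bool.not-¬ (proj₂ (proj₂ (All.lookup C₁ x∈₁))) (proj₂ (proj₂ (All.lookup C₂ x∈₂))))
    , Cv ∷ Allₚ.++⁺ (All.map proj₁ C₁) (All.map proj₁ C₂)
    , cong suc (trans (length-++ L₁) (trans (cong₂ _+_ eq₁ eq₂) (m+[n∸m]≡n (s≤s⁻¹ (Fin.toℕ<n a)))))

module _ {G : Graph} where

  uniform-lookup : ∀ {b L y z} → Uniform {G} b L → y ∈ L → z ∈ L → y ≢ z → adj G y z ≡ b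
  uniform-lookup (r ∷ u) (here refl) (here refl) y≢z = ⊥-elim (y≢z refl)
  uniform-lookup (r ∷ u) (here refl) (there z∈) y≢z = proj₂ (All.lookup r z∈)
  uniform-lookup (r ∷ u) (there y∈) (here refl) y≢z = adjacent-sym {G = G} (proj₂ (All.lookup r y∈))
  uniform-lookup (r ∷ u) (there y∈) (there z∈) y≢z = uniform-lookup u y∈ z∈ y≢z

  -- Removing a vertex takes at most one member from `L`, so more than `a` members survive `t`
  -- removals. They are not homogeneous and contain a pair of the other kind.
  uncovered-complete : ∀ {b a} t {C} {L : List (V G)} → Unique L → All C L → suc (a + t) ≤ length L →
    ¬ Homogeneous G b (suc a) C → Uncovered G b t C
  uncovered-complete {b} {a} zero {C} {L} u CL a< none
    with Any.any? (λ y → 1 ≤? length (side {G} y (not b) L)) L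
  ... | yes some = bad-pair (find some)
    where
    bad-pair : (∃ λ y → y ∈ L × 1 ≤ length (side {G} y (not b) L)) → Uncovered G b 0 C
    bad-pair (y , y∈ , 1≤) with side {G} y (not b) L in e
    ... | z ∷ _ = let (z∈ , r) = ∈-filter⁻ (side? {G} y (not b)) {xs = L} (subst (z ∈_) (≡-sym e) (here refl)) in
      y , All.lookup CL y∈ , z , All.lookup CL z∈ , r
  ... | no ¬some = ⊥-elim (none (homogeneous-mono (subst (_≤ length L) (+-identityʳ (suc a)) a<) id
      (uniform⇒homogeneous (pairwise⇒uniform {G} u pair) CL)))
    where
    pair : ∀ {y z} → y ∈ L → z ∈ L → y ≢ z → adj G y z ≡ b
    pair {y} {z} y∈ z∈ y≢z with adj G y z Bool.≟ b
    ... | yes e = e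
    ... | no ne = ⊥-elim (¬some (lose {P = λ y → 1 ≤ length (side {G} y (not b) L)} y∈
      (filter-some (side? {G} y (not b)) (lose {P = λ z → y ≢ z × adj G y z ≡ not b} z∈ (y≢z , Bool.¬-not ne)))))
  uncovered-complete {b} {a} (suc t) {C} {L} u CL a< none x =
    uncovered-complete t (Uniqueₚ.filter⁺ x≢? u)
      (All.tabulate λ z∈ → let (z∈L , x≢z) = ∈-filter⁻ x≢? {xs = L} z∈ in All.lookup CL z∈L , x≢z)
      (s≤s⁻¹ (≤-trans (≤-reflexive (≡-sym (+-suc (suc a) t))) (≤-trans a< (unique-⊆⇒length≤ u keep))))
      (λ H → none (homogeneous-mono ≤-refl proj₁ H))
    where
    x≢? : Decidable (x ≢_)
    x≢? z = ¬? (x Fin.≟ z)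
    keep : ∀ {z} → z ∈ L → z ∈ x ∷ filter x≢? L
    keep {z} z∈ with x Fin.≟ z
    ... | yes refl = here refl
    ... | no x≢z = there (∈-filter⁺ x≢? z∈ x≢z)

  -- The vertices of `R` are fed to the universal quantifiers one after the other; `v₀` fills those
  -- left over when `R` is shorter than `t`.
  uncovered-avoids : ∀ {b} t {C} → V G → Uncovered G b t C → ∀ R → length R ≤ t →
    ∃₂ λ y z → (C y × y ∉ R) × (C z × z ∉ R) × (y ≢ z × adj G y z ≡ not b)
  uncovered-avoids zero _ (y , Cy , z , Cz , r) [] _ = y , z , (Cy , λ ()) , (Cz , λ ()) , r
  uncovered-avoids (suc t) v₀ U [] _ with uncovered-avoids t v₀ (U v₀) [] z≤n
  ... | y , z , ((Cy , _) , y∉) , ((Cz , _) , z∉) , r = y , z , (Cy , y∉) , (Cz , z∉) , r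
  uncovered-avoids (suc t) v₀ U (x ∷ R) (s≤s R≤t) with uncovered-avoids t v₀ (U x) R R≤t
  ... | y , z , ((Cy , x≢y) , y∉) , ((Cz , x≢z) , z∉) , r = y , z , (Cy , avoid x≢y y∉) , (Cz , avoid x≢z z∉) , r
    where
    avoid : ∀ {w} → x ≢ w → w ∉ R → w ∉ x ∷ R
    avoid x≢w w∉ (here w≡x) = x≢w (≡-sym w≡x)
    avoid x≢w w∉ (there w∈) = w∉ w∈

  balanced-sound : ∀ {b} n d {C} → Decidable C → V G → Balanced G b n d C →
    ∃ λ L → Unique L × All C L × length L ≡ n
  balanced-sound {b} n d {C} C? v₀ (a , _ , H , U) with n ≤? length (filter C? (allFin (size G)))
  ... | yes n≤ = take n F , Uniqueₚ.take⁺ n (Uniqueₚ.filter⁺ C? (Uniqueₚ.allFin⁺ _))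
               , All.tabulate (λ z∈ → proj₂ (∈-filter⁻ C? {xs = allFin _} (∈-take n F z∈))) , length-take-≤ n≤
    where F = filter C? (allFin (size G))
  ... | no n≰ = ⊥-elim (absurd (homogeneous⇒uniform (toℕ a) H))
    where
    F = filter C? (allFin (size G))
    absurd : (∃ λ A → Uniform {G} b A × All C A × length A ≡ toℕ a) → ⊥
    absurd (A , uA , CA , lenA) =
      let (y , z , (Cy , y∉) , (Cz , z∉) , y≢z , e) = uncovered-avoids (n ∸ suc (toℕ a)) v₀ U R R≤
      in Bool.not-¬ (uniform-lookup uA (inA Cy y∉) (inA Cz z∉) y≢z) e
      where
      A? = λ v → _∈?_ G v A
      R = filter (¬? ∘ A?) F
      inF : ∀ {y} → C y → y ∈ F
      inF {y} Cy = ∈-filter⁺ C? (∈-allFin y) Cy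
      inA : ∀ {y} → C y → y ∉ R → y ∈ A
      inA {y} Cy y∉ with A? y
      ... | yes y∈ = y∈
      ... | no y∉A = ⊥-elim (y∉ (∈-filter⁺ (¬? ∘ A?) (inF Cy) y∉A))
      A≤ : toℕ a ≤ length (filter A? F)
      A≤ = subst (_≤ length (filter A? F)) lenA (unique-⊆⇒length≤ (uniform⇒unique {G} uA)
        (λ y∈ → ∈-filter⁺ A? (inF (All.lookup CA y∈)) y∈))
      R≤ : length R ≤ n ∸ suc (toℕ a)
      R≤ = m+n≤o⇒m≤o∸n (length R) (begin
        length R + suc (toℕ a) ≡⟨ +-comm (length R) _ ⟩
        suc (toℕ a + length R) ≤⟨ s≤s (+-monoˡ-≤ (length R) A≤) ⟩
        suc (length (filter A? F) + length R) ≡⟨ cong suc (filter-length-split A? F) ⟩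
        suc (length F) ≤⟨ ≰⇒> n≰ ⟩
        n ∎)
        where open ≤-Reasoning

  large-sound : ∀ n d {C} → Decidable C → V G → Large G n d C →
    (∃ λ L → Unique L × All C L × length L ≡ n) ⊎ (∃₂ λ b L → Uniform {G} b L × All C L × length L ≡ d)
  large-sound n d C? v₀ (inj₁ (inj₁ H)) = inj₂ (true , homogeneous⇒uniform d H)
  large-sound n d C? v₀ (inj₁ (inj₂ H)) = inj₂ (false , homogeneous⇒uniform d H)
  large-sound n d C? v₀ (inj₂ (inj₁ (inj₁ B))) = inj₁ (balanced-sound n d C? v₀ B)
  large-sound n d C? v₀ (inj₂ (inj₁ (inj₂ B))) = inj₁ (balanced-sound n d C? v₀ B)
  large-sound n d C? v₀ (inj₂ (inj₂ S)) = inj₁ (split-sound n d S)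

  homogeneous-bounded : ∀ {C} b → ¬ Homogeneous G b (suc (size G)) C
  homogeneous-bounded b H with homogeneous⇒uniform (suc (size G)) H
  ... | U , uU , _ , lenU = 1+n≰n (subst₂ _≤_ lenU (length-tabulate id)
    (unique-⊆⇒length≤ (uniform⇒unique {G} uU) λ {y} _ → ∈-allFin y))

  crossover : ∀ {P : ℕ → Set} → (∀ i → Dec (P i)) → ∀ m k → P m → ¬ P (m + k) →
    ∃ λ a → m ≤ a × a < m + k × P a × ¬ P (suc a)
  crossover {P} P? m zero Pm ¬P = ⊥-elim (¬P (subst P (≡-sym (+-identityʳ m)) Pm))
  crossover {P} P? m (suc k) Pm ¬P with P? (suc m)
  ... | no ¬Psm = m , ≤-refl , m<m+n m (s≤s z≤n) , Pm , ¬Psm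
  ... | yes Psm with crossover P? (suc m) k Psm (¬P ∘ subst P (≡-sym (+-suc m k)))
  ...   | a , m<a , a< , Pa , ¬Psa = a , <⇒≤ m<a , subst (a <_) (≡-sym (+-suc m k)) a< , Pa , ¬Psa

  -- If some homogeneous set has more than `n ∸ d` vertices, then sets of its kind either reach size
  -- `d` or stop at a size for which `Balanced` holds; otherwise `split-complete` applies with
  -- `h = n ∸ d`. Homogeneity is decidable in a finite graph, which makes the case distinction
  -- constructive.
  large-complete : ∀ n d {C} {L : List (V G)} → Decidable C → Unique L → All C L → length L ≡ n → 2 ≤ d →
    suc (n ∸ d) ≤ d → n + (n ∸ d) ≤ d + d → Large G n d C
  large-complete n d {C} {L} C? u CL eq 2≤d e<d room = choose (n ≤? d)
    where
    e = n ∸ d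
    balanced : ∀ b → ¬ n ≤ d → Homogeneous G b (suc e) C → ¬ Homogeneous G b d C → Balanced G b n d C
    balanced b n≰d H ¬H
      with crossover {λ i → Homogeneous G b i C} (λ i → homogeneous? b i C?) (suc e) (d ∸ suc e) H
             (¬H ∘ subst (λ i → Homogeneous G b i C) (m+[n∸m]≡n e<d))
    ... | a , e<a , a< , Ha , ¬Hsa = fromℕ< a<n ,
      subst (λ i → (i ≤ d × 2 + (n ∸ suc i) ≤ d) × (Homogeneous G b i C × Uncovered G b (n ∸ suc i) C))
        (≡-sym (Fin.toℕ-fromℕ< a<n))
        ((<⇒≤ a<d , t≤d) , Ha , uncovered-complete (n ∸ suc a) u CL
          (≤-reflexive (trans (m+[n∸m]≡n a<n) (≡-sym eq))) ¬Hsa)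
      where
      a<d : a < d
      a<d = subst (a <_) (m+[n∸m]≡n e<d) a<
      a<n : a < n
      a<n = <-trans a<d (≰⇒> n≰d)
      -- Here `a > e` is what keeps the covering test within depth `d`: its `n - a + 1` quantifiers
      -- are at most `n - e`.
      t≤d : 2 + (n ∸ suc a) ≤ d
      t≤d = +-cancelʳ-≤ e (2 + (n ∸ suc a)) d (begin
        2 + (n ∸ suc a) + e ≡⟨ +-comm (2 + (n ∸ suc a)) e ⟩
        e + suc (suc (n ∸ suc a)) ≡⟨ +-suc e _ ⟩
        suc e + suc (n ∸ suc a) ≤⟨ +-monoˡ-≤ (suc (n ∸ suc a)) e<a ⟩
        a + suc (n ∸ suc a) ≡⟨ +-suc a _ ⟩
        suc a + (n ∸ suc a) ≡⟨ m+[n∸m]≡n a<n ⟩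
        n ≤⟨ m≤n+m∸n n d ⟩
        d + e ∎)
        where open ≤-Reasoning
    choose : Dec (n ≤ d) → Large G n d C
    -- Taking `h = size G` lets `homogeneous-bounded` discharge the last hypothesis of
    -- `split-complete`.
    choose (yes n≤d) = inj₂ (inj₂ (split-complete d {h = size G} u CL eq (inj₁ n≤d) homogeneous-bounded))
    choose (no n≰d) with homogeneous? true (suc e) C? | homogeneous? false (suc e) C?
    ... | yes H | _ with homogeneous? true d C?
    ...   | yes H′ = inj₁ (inj₁ H′)
    ...   | no ¬H = inj₂ (inj₁ (inj₁ (balanced true n≰d H ¬H)))
    choose (no n≰d) | no _ | yes H with homogeneous? false d C?
    ...   | yes H′ = inj₁ (inj₂ H′)
    ...   | no ¬H = inj₂ (inj₁ (inj₂ (balanced false n≰d H ¬H)))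
    choose (no n≰d) | no ¬T | no ¬F =
      inj₂ (inj₂ (split-complete d {h = e} u CL eq (inj₂ room) λ { true → ¬T ; false → ¬F }))

-- Paths, cycles and balls

-- A path of n further vertices from u inside A, at most y of them adjacent to c, whose last vertex has
-- adjacency `end` to c.
PathFrom : (G : Graph) → Bool → V G → ℕ → ℕ → V G → (V G → Set) → Set
PathFrom G end c zero y u A = adj G c u ≡ end
PathFrom G end c (suc n) y u A = Σ (V G) λ v → adj G u v ≡ true × A v ×
  ((adj G c v ≡ true × (1 ≤ y × PathFrom G end c n (y ∸ 1) v (λ z → A z × v ≢ z))) ⊎
   (adj G c v ≡ false × PathFrom G end c n y v (λ z → A z × v ≢ z)))

pathᴰ : ∀ end n y {k} (i j : Fin (suc k)) {A} → DefinableClass (suc k) A →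
  Definable (suc k) n (λ G vs → PathFrom G end (lookupᵛ vs i) n y (lookupᵛ vs j) (A G vs))
pathᴰ end zero y i j D = adjacentᴰ i j end
pathᴰ end (suc n) y i j D = ∃ᴰ (adjacentᴰ (suc j) zero true ∧ᴰ memberᴰ (weaken D) zero ∧ᴰ
  ((adjacentᴰ (suc i) zero true ∧ᴰ guardᴰ (1 ≤? y) (λ _ → pathᴰ end n (y ∸ 1) (suc i) zero (weaken D ∩ᶜ differsᶜ zero))) ∨ᴰ
   (adjacentᴰ (suc i) zero false ∧ᴰ pathᴰ end n y (suc i) zero (weaken D ∩ᶜ differsᶜ zero))))

module _ {G : Graph} where

  record Trail (end : Bool) (c : V G) (n y : ℕ) (u : V G) (A : V G → Set) : Set where
    constructor trail
    field
      {vertices} : List (V G)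
      walk : Walk G u vertices
      unique : Unique vertices
      allowed : All A vertices
      length≡ : length vertices ≡ n
      few : length (filter (adjacent? G c) vertices) ≤ y
      ending : adj G c (endpoint G u vertices) ≡ end

  path-sound : ∀ {end c} n {y u A} → PathFrom G end c n y u A → Trail end c n y u A
  path-sound zero e = trail [] [] [] refl z≤n e
  path-sound {end} {c} (suc n) {y} {u} {A} (v , e , Av , inj₁ (cv , 1≤y , rest)) with path-sound n rest
  ... | trail {P} w uP AP len few en = trail (e ∷ w) (All.map proj₂ AP ∷ uP) (Av ∷ All.map proj₁ AP) (cong suc len)
    (subst (λ L → length L ≤ y) (≡-sym (filter-accept (adjacent? G c) {v} {P} cv))
      (subst (suc _ ≤_) (m+[n∸m]≡n 1≤y) (s≤s few))) en
  path-sound {end} {c} (suc n) {y} {u} {A} (v , e , Av , inj₂ (cv , rest)) with path-sound n rest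
  ... | trail {P} w uP AP len few en = trail (e ∷ w) (All.map proj₂ AP ∷ uP) (Av ∷ All.map proj₁ AP) (cong suc len)
    (subst (λ L → length L ≤ y) (≡-sym (filter-reject (adjacent? G c) {v} {P} (λ cv′ → Bool.not-¬ cv cv′))) few) en

  path-complete : ∀ {end c y u A P} → Walk G u P → Unique P → All A P → length (filter (adjacent? G c) P) ≤ y →
    adj G c (endpoint G u P) ≡ end → PathFrom G end c (length P) y u A
  path-complete [] _ _ _ en = en
  path-complete {end} {c} {y} {u} {A} {v ∷ P} (e ∷ w) (v≢ ∷ uP) (Av ∷ AP) few en =
    v , e , Av , by-adjacency (adj G c v) refl
    where
    Goal = (adj G c v ≡ true × (1 ≤ y × PathFrom G end c (length P) (y ∸ 1) v (λ z → A z × v ≢ z))) ⊎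
           (adj G c v ≡ false × PathFrom G end c (length P) y v (λ z → A z × v ≢ z))
    by-adjacency : ∀ b → adj G c v ≡ b → Goal
    by-adjacency true cv = inj₁ (cv , ≤-trans (s≤s z≤n) few′ ,
        path-complete w uP (All.zip (AP , v≢)) (∸-monoˡ-≤ 1 few′) en)
      where
      few′ : suc (length (filter (adjacent? G c) P)) ≤ y
      few′ = subst (λ L → length L ≤ y) (filter-accept (adjacent? G c) {v} {P} cv) few
    by-adjacency false cv = inj₂ (cv , path-complete w uP (All.zip (AP , v≢))
      (subst (λ L → length L ≤ y) (filter-reject (adjacent? G c) {v} {P} (λ cv′ → Bool.not-¬ cv cv′)) few) en)

  common-length : ∀ {Q : V G → Set} (Q? : Decidable Q) {M P} → Unique M → All Q M →
    length (filter (λ v → _∈?_ G v P) M) ≤ length (filter Q? P)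
  common-length Q? {M} {P} uM QM = unique-⊆⇒length≤ (Uniqueₚ.filter⁺ _ uM) λ x∈ →
    let (x∈M , x∈P) = ∈-filter⁻ (λ v → _∈?_ G v P) {xs = M} x∈ in ∈-filter⁺ Q? x∈P (All.lookup QM x∈M)

  -- Consecutive vertices of the walk are adjacent, so each occurrence of a vertex of `A` is
  -- followed by a vertex outside `A`. The last occurrence has a successor because the walk does not
  -- end in `A`.
  independent-half : ∀ {A u P} → Uniform {G} false A → Walk G u P → endpoint G u P ∉ A →
    length (filter (λ v → _∈?_ G v A) P) + length (filter (λ v → _∈?_ G v A) P) ≤ length P
  independent-half uA [] _ = z≤n
  independent-half {A} {u} {v ∷ P} uA (e ∷ w) end∉ with _∈?_ G v A
  ... | no v∉ = m≤n⇒m≤1+n (independent-half uA w end∉)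
  independent-half {A} {u} {v ∷ []} uA (e ∷ []) end∉ | yes v∈ = ⊥-elim (end∉ v∈)
  independent-half {A} {u} {v ∷ x ∷ P} uA (e ∷ e′ ∷ w) end∉ | yes v∈ with _∈?_ G x A
  ... | yes x∈ = ⊥-elim (Bool.not-¬ (uniform-lookup {G} uA v∈ x∈ (adjacent⇒≢ {G} e′)) e′)
  ... | no x∉ = s≤s (subst (_≤ suc (length P)) (≡-sym (+-suc _ _)) (s≤s (independent-half uA w end∉)))

  uniform-walk : ∀ {x L} → Uniform {G} true (x ∷ L) → Walk G x L
  uniform-walk {L = []} _ = []
  uniform-walk {L = y ∷ L} (((_ , e) ∷ _) ∷ u) = e ∷ uniform-walk u

  endpoint-∈ : ∀ u v P → endpoint G u (v ∷ P) ∈ v ∷ P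
  endpoint-∈ u v [] = here refl
  endpoint-∈ u v (x ∷ P) = there (endpoint-∈ v x P)

  record Cycle (p : ℕ) : Set where
    constructor cycle
    field
      {start} : V G
      {rest} : List (V G)
      walk : Walk G start rest
      unique : Unique (start ∷ rest)
      length≡ : length rest ≡ p
      closing : Adjacent G (endpoint G start rest) start

  walk-split : ∀ {u} xs {x ys} → Walk G u (xs ++ x ∷ ys) → Walk G u xs × Walk G x ys
  walk-split [] (e ∷ w) = [] , w
  walk-split (v ∷ xs) (e ∷ w) with walk-split xs w
  ... | w₁ , w₂ = e ∷ w₁ , w₂

  endpoint-++ : ∀ u xs x ys → endpoint G u (xs ++ x ∷ ys) ≡ endpoint G x ys
  endpoint-++ u [] x ys = refl
  endpoint-++ u (v ∷ xs) x ys = endpoint-++ v xs x ys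

  module _ {p} (Z : Cycle p) where
    open Cycle Z

    -- With the cycle written as `start`, `xs`, `x`, `ys`, the new walk runs from `x` through `ys`,
    -- takes the closing edge to `start` and continues through `xs`.
    rotate : ∀ {x} → x ∈ start ∷ rest → ∃ λ Q → Walk G x Q × Unique (x ∷ Q) × length Q ≡ p ×
      (∀ {z} → z ∈ Q → z ∈ start ∷ rest)
    rotate (here refl) = rest , walk , unique , length≡ , there
    rotate {x} (there x∈) with ∈-∃++ x∈
    ... | xs , ys , refl with walk-split xs walk | ++-unique⁻ (start ∷ xs) unique
    ... | w₁ , w₂ | u₁ , x∉ys ∷ u₂ , disj =
      ys ++ start ∷ xs
      , walk-++ {G} w₂ (subst (λ v → Adjacent G v start) (endpoint-++ start xs x ys) closing ∷ w₁)
      , Allₚ.++⁺ x∉ys (∉⇒All≢ λ x∈ → disj x∈ (here refl)) ∷ ++-unique u₂ u₁ (λ z∈ys z∈xs → disj z∈xs (there z∈ys))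
      , trans (length-++ ys) (trans (+-comm (length ys) _) (trans (≡-sym (trans (length-++ xs) (+-suc (length xs) (length ys)))) length≡))
      , λ z∈ → back (∈-++⁻ ys z∈)
      where
      back : ∀ {z} → z ∈ ys ⊎ z ∈ start ∷ xs → z ∈ start ∷ xs ++ x ∷ ys
      back (inj₁ z∈) = there (∈-++⁺ʳ xs (there z∈))
      back (inj₂ z∈) = ∈-++⁺ˡ z∈

    -- The list contains the starting vertex but not the end `x`: the end will lie on the cycle, all
    -- listed vertices outside it.
    data Lead : V G → List (V G) → V G → Set where
      stop : ∀ {x} → Lead x [] x
      go : ∀ {v w X x} → Adjacent G v w → Lead w X x → Lead v (v ∷ X) x

    record Approach (v : V G) : Set where
      constructor approach
      field
        {before} : List (V G)
        {entry} : V G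
        lead : Lead v before entry
        simple : Unique before
        outside : All (_∉ start ∷ rest) before
        inside : entry ∈ start ∷ rest

    shortcut : ∀ {v w X x} → Lead w X x → Unique X → All (_∉ start ∷ rest) X → x ∈ start ∷ rest → v ∈ X → Approach v
    shortcut l@(go _ _) u o i (here refl) = approach l u o i
    shortcut (go e l) (_ ∷ u) (_ ∷ o) i (there v∈) = shortcut l u o i v∈

    -- A `Reach` derivation may revisit vertices and the cycle. It is processed from its far end: a
    -- vertex on the cycle restarts the list, and a repeated vertex truncates it by `shortcut`.
    approaches : ∀ {v w} → Reach G v w → w ∈ start ∷ rest → Approach v
    approaches Reach.here w∈ = approach stop [] [] w∈
    approaches {v} (step e r) w∈ with _∈?_ G v (start ∷ rest)
    ... | yes v∈ = approach stop [] [] v∈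
    ... | no v∉ with approaches r w∈
    ...   | approach {X} l u o i with _∈?_ G v X
    ...     | yes v∈X = shortcut l u o i v∈X
    ...     | no v∉X = approach (go e l) (∉⇒All≢ v∉X ∷ u) (v∉ ∷ o) i

    lead-walk : ∀ {v X x Q} → Lead v X x → Walk G x Q → ∃ λ Q′ → v ∷ Q′ ≡ X ++ x ∷ Q × Walk G v Q′
    lead-walk stop w = _ , refl , w
    lead-walk {X = v ∷ X} (go e l) w with lead-walk l w
    ... | Q′ , eq , w′ = _ , cong (v ∷_) eq , e ∷ w′

    -- Go to the cycle and then around it. The `p` vertices that follow the entry on the cycle
    -- already suffice, and the path is cut to length `p`.
    path-to-cycle : ∀ {v} → Reach G v start → ∃ λ Q → Walk G v Q × Unique (v ∷ Q) × length Q ≡ p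
    path-to-cycle {v} r with approaches r (here refl)
    ... | approach {X} {x} l u o i with rotate i
    ... | Q , w , uQ , lenQ , sub with lead-walk l w
    ... | Q′ , eq , w′ = take p Q′ , walk-take p w′
        , Uniqueₚ.take⁺ (suc p) (subst Unique (≡-sym eq) (++-unique u uQ disj))
        , length-take-≤ (s≤s⁻¹ (≤-trans (s≤s (≤-reflexive (≡-sym lenQ)))
            (≤-trans (m≤n+m (suc (length Q)) (length X)) (≤-reflexive (trans (≡-sym (length-++ X)) (cong length (≡-sym eq)))))))
      where
      disj : ∀ {z} → z ∈ X → z ∉ x ∷ Q
      disj z∈X (here refl) = All.lookup o z∈X i
      disj z∈X (there z∈Q) = All.lookup o z∈X (sub z∈Q)

  ball : V G → ℕ → List (V G)
  ball c zero = c ∷ []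
  ball c (suc k) = ball c k ++ concatMap (neighbours G) (ball c k)

  length-concatMap-≤ : ∀ {D} (f : V G → List (V G)) xs → (∀ v → length (f v) ≤ D) → length (concatMap f xs) ≤ length xs * D
  length-concatMap-≤ f [] f≤ = z≤n
  length-concatMap-≤ f (x ∷ xs) f≤ = ≤-trans (≤-reflexive (length-++ (f x))) (+-mono-≤ (f≤ x) (length-concatMap-≤ f xs f≤))

  length-ball : ∀ {D} c k → (∀ v → length (neighbours G v) ≤ D) → length (ball c k) ≤ suc D ^ k
  length-ball c zero _ = ≤-refl
  length-ball {D} c (suc k) deg≤ = begin
    length (ball c k ++ concatMap (neighbours G) (ball c k)) ≡⟨ length-++ (ball c k) ⟩
    length (ball c k) + length (concatMap (neighbours G) (ball c k)) ≤⟨ +-monoʳ-≤ _ (length-concatMap-≤ (neighbours G) (ball c k) deg≤) ⟩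
    length (ball c k) + length (ball c k) * D ≡⟨ *-suc (length (ball c k)) D ⟨
    length (ball c k) * suc D ≤⟨ *-monoˡ-≤ (suc D) (length-ball c k deg≤) ⟩
    suc D ^ k * suc D ≡⟨ *-comm (suc D ^ k) (suc D) ⟩
    suc D ^ suc k ∎
    where open ≤-Reasoning

  ∈-ball-step : ∀ {c k x y} → x ∈ ball c k → Adjacent G x y → y ∈ ball c (suc k)
  ∈-ball-step {c} {k} x∈ e = ∈-++⁺ʳ (ball c k) (∈-concatMap⁺ (neighbours G) (lose {P = λ x → _ ∈ neighbours G x} x∈ (∈-neighbours {G} e)))

  outside-ball : ∀ {D} c k → (∀ v → length (neighbours G v) ≤ D) → suc D ^ k < size G → ∃ (_∉ ball c k)
  outside-ball {D} c k deg≤ big with Fin.any? (λ v → ¬? (_∈?_ G v (ball c k)))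
  ... | yes far = far
  ... | no all = ⊥-elim (<⇒≱ big (≤-trans (subst (_≤ length (ball c k)) (length-tabulate id)
      (unique-⊆⇒length≤ (Uniqueₚ.allFin⁺ (size G)) λ {v} _ → inside v)) (length-ball c k deg≤)))
    where
    inside : ∀ v → v ∈ ball c k
    inside v with _∈?_ G v (ball c k)
    ... | yes v∈ = v∈
    ... | no v∉ = ⊥-elim (all (v , v∉))

  exit : ∀ {B u v} → Reach G u v → u ∈ B → v ∉ B → ∃₂ λ x y → x ∈ B × y ∉ B × Adjacent G x y
  exit Reach.here u∈ v∉ = ⊥-elim (v∉ u∈)
  exit {B} {u} (step {w = w} e r) u∈ v∉ with _∈?_ G w B
  ... | yes w∈ = exit r w∈ v∉
  ... | no w∉ = u , w , u∈ , w∉ , e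

  -- The path is built backwards, one layer of the ball at a time, with `acc` the part already
  -- present. All vertices after the first lie outside the ball of radius 1, so only the first is
  -- adjacent to `c`.
  geodesic : ∀ {c u acc} k → u ∈ ball c (suc k) → u ∉ ball c k → Walk G u acc → Unique (u ∷ acc) →
    All (_∉ ball c (suc k)) acc →
    ∃ λ P → Walk G c P × Unique (c ∷ P) × length P ≡ suc k + length acc × length (filter (adjacent? G c) P) ≤ 1
  geodesic {c} {u} {acc} k u∈ u∉ w un far with ∈-++⁻ (ball c k) u∈
  ... | inj₁ u∈′ = ⊥-elim (u∉ u∈′)
  ... | inj₂ u∈′ with find (∈-concatMap⁻ (neighbours G) {xs = ball c k} u∈′)
  ... | x , x∈ , u∈x with proj₂ (∈-filter⁻ (adjacent? G x) {xs = allFin _} u∈x)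
  geodesic {c} {u} {acc} zero u∈ u∉ w un far | inj₂ _ | x , here refl , _ | e =
    u ∷ acc , e ∷ w
    , ((λ { refl → u∉ (here refl) }) ∷ All.map (λ { z∉ refl → z∉ (here refl) }) far) ∷ un
    , refl
    , ≤-reflexive (trans (cong length (filter-accept (adjacent? G c) {u} {acc} e)) (cong (suc ∘ length)
        (filter-none (adjacent? G c) (All.map (λ z∉ cz → z∉ (∈-ball-step {c} {0} (here refl) cz)) far))))
  geodesic {c} {u} {acc} (suc k) u∈ u∉ w un far | inj₂ _ | x , x∈ , _ | e
    with geodesic k x∈ (λ x∈′ → u∉ (∈-ball-step {c} {k} x∈′ e)) (e ∷ w)
           (((λ { refl → u∉ x∈ }) ∷ All.map (λ { z∉ refl → z∉ (∈-++⁺ˡ x∈) }) far) ∷ un)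
           (u∉ ∷ All.map (λ z∉ z∈ → z∉ (∈-++⁺ˡ z∈)) far)
  ... | P , wP , uP , lenP , few = P , wP , uP , trans lenP (cong suc (+-suc k (length acc))) , few

-- The upper bound on the depth

module UpperBound (q p s d : ℕ) (1≤q : 1 ≤ q) (2≤p : 2 ≤ p) (p≤ : p ≤ suc (s + s))
  (p<d : suc p ≤ d) (q+s≤ : q + s ≤ suc d) where

  -- The vertex of degree at least `q` is quantified separately: when a cycle or a large clique is
  -- found, the sparkler is centred at that vertex or at one of huge degree, since the `c` of the
  -- second part may have too few neighbours. In the last disjunct `y` ranges below `p` because the
  -- end of the path is not adjacent to `c`.
  Criterion : Graph → Set
  Criterion G =
    (Σ (V G) λ c → Split G q q (Adjacent G c)) ×
    (Σ (V G) λ c → PathFrom G true c p p c (c ≢_) ⊎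
      (Σ (Fin p) λ y → PathFrom G false c p (toℕ y) c (c ≢_) × Large G (q ∸ 1 + toℕ y) d (Adjacent G c)))

  1≤s : 1 ≤ s
  1≤s = n≢0⇒n>0 λ s≡0 → <⇒≱ 2≤p (subst (λ n → p ≤ suc (n + n)) s≡0 p≤)

  q≤d : q ≤ d
  q≤d = s≤s⁻¹ (≤-trans (≤-reflexive (+-comm 1 q)) (≤-trans (+-monoʳ-≤ q 1≤s) q+s≤))

  q-1+s≤d : q ∸ 1 + s ≤ d
  q-1+s≤d = subst (_≤ d) (+-∸-comm s 1≤q) (∸-monoˡ-≤ 1 q+s≤)

  criterionᴰ : Definable 0 (suc d) (λ G _ → Criterion G)
  criterionᴰ =
    ∃ᴰ (relax q≤d (splitᴰ q q (adjacentᶜ zero true))) ∧ᴰ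
    ∃ᴰ (relax (<⇒≤ p<d) (pathᴰ true p p zero zero (differsᶜ zero)) ∨ᴰ
      ⋁ᴰ p λ y → relax (<⇒≤ p<d) (pathᴰ false p (toℕ y) zero zero (differsᶜ zero)) ∧ᴰ
                 largeᴰ (q ∸ 1 + toℕ y) d (adjacentᶜ zero true))

  -- Bounding one `y` by `p` and the other by `2s` gives the total `p + 2(q - 1 + s)`, where `p` and
  -- `q - 1 + s` are both at most `d`.
  2n≤3d : ∀ {y} → y < p → (q ∸ 1 + y) + (q ∸ 1 + y) ≤ d + (d + d)
  2n≤3d {y} y<p = begin
    (q′ + y) + (q′ + y) ≤⟨ +-mono-≤ (+-monoʳ-≤ q′ (<⇒≤ y<p)) (≤-trans (+-monoʳ-≤ q′ (s≤s⁻¹ (≤-trans y<p p≤))) q-1+s+s) ⟩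
    (q′ + p) + (s + d) ≡⟨ rearrange ⟩
    p + ((q′ + s) + d) ≤⟨ +-mono-≤ (<⇒≤ p<d) (+-monoˡ-≤ d q-1+s≤d) ⟩
    d + (d + d) ∎
    where
    open ≤-Reasoning
    q′ = q ∸ 1
    q-1+s+s : q′ + (s + s) ≤ s + d
    q-1+s+s = ≤-trans (≤-reflexive (trans (≡-sym (+-assoc q′ s s)) (+-comm (q′ + s) s))) (+-monoʳ-≤ s q-1+s≤d)
    rearrange : (q′ + p) + (s + d) ≡ p + ((q′ + s) + d)
    rearrange = trans (cong (_+ (s + d)) (+-comm q′ p)) (trans (+-assoc p q′ (s + d)) (cong (p +_) (≡-sym (+-assoc q′ s d))))

  excess-bound : ∀ n → n + n ≤ d + (d + d) → n + (n ∸ d) ≤ d + d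
  excess-bound n 2n≤ with n ≤? d
  ... | yes n≤d = subst (_≤ d + d) (≡-sym (trans (cong (n +_) (m≤n⇒m∸n≡0 n≤d)) (+-identityʳ n))) (≤-trans n≤d (m≤m+n d d))
  ... | no n≰d = +-cancelˡ-≤ d _ _ (begin
    d + (n + (n ∸ d)) ≡⟨ +-comm d _ ⟩
    n + (n ∸ d) + d ≡⟨ +-assoc n (n ∸ d) d ⟩
    n + (n ∸ d + d) ≡⟨ cong (n +_) (m∸n+n≡m (<⇒≤ (≰⇒> n≰d))) ⟩
    n + n ≤⟨ 2n≤ ⟩
    d + (d + d) ∎)
    where open ≤-Reasoning

  excess< : ∀ {y} → y < p → suc (q ∸ 1 + y ∸ d) ≤ d
  excess< {y} y<p = ≤-trans (s≤s (≤-trans (∸-monoˡ-≤ d (+-monoˡ-≤ y q-1≤d)) (≤-reflexive (m+n∸m≡n d y)))) (≤-trans y<p (<⇒≤ p<d))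
    where
    q-1≤d : q ∸ 1 ≤ d
    q-1≤d = ≤-trans (m≤m+n _ s) q-1+s≤d

  complete : ∀ {G} → Sparkles G q p → Criterion G
  complete {G} S =
    -- With as many quantifiers as vertices every set can be split, so this part just says that the
    -- degree is at least `q`.
    (centre , split-complete q {h = size G} (Uniqueₚ.take⁺ q (neighbours-unique {G} centre))
      (All.tabulate λ z∈ → All.lookup (neighbours-adjacent {G} centre) (∈-take q (neighbours G centre) z∈))
      (length-take-≤ degree≥q) (inj₁ ≤-refl) homogeneous-bounded) ,
    (centre , by-closing (adj G centre (endpoint G centre path)) refl)
    where
    open Sparkles S
    c≢ : All (centre ≢_) path
    c≢ with distinct
    ... | c∉ ∷ _ = Allₚ.++⁻ʳ leaves c∉
    u-parts = ++-unique⁻ leaves (AllPairs.tail distinct)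
    -- The `y` of the criterion will be `length nb`; the `q ∸ 1 + y` neighbours to be certified are
    -- the leaves together with `nb`.
    nb = filter (adjacent? G centre) path
    leaves≡ : length leaves ≡ q ∸ 1
    leaves≡ = cong (_∸ 1) leaves-length
    star-unique : Unique (leaves ++ nb)
    star-unique = ++-unique (proj₁ u-parts) (Uniqueₚ.filter⁺ _ (proj₁ (proj₂ u-parts)))
      (λ x∈ x∈nb → proj₂ (proj₂ u-parts) x∈ (proj₁ (∈-filter⁻ (adjacent? G centre) {xs = path} x∈nb)))
    star-adjacent : All (Adjacent G centre) (leaves ++ nb)
    star-adjacent = Allₚ.++⁺ leaves-adjacent (Allₚ.all-filter (adjacent? G centre) path)
    star-length : length (leaves ++ nb) ≡ q ∸ 1 + length nb
    star-length = trans (length-++ leaves) (cong (_+ length nb) leaves≡)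
    1≤nb : 1 ≤ length nb
    1≤nb = first path-walk (subst (2 ≤_) (≡-sym path-length) 2≤p)
      where
      first : ∀ {P} → Walk G centre P → 2 ≤ length P → 1 ≤ length (filter (adjacent? G centre) P)
      first {v ∷ P} (e ∷ _) _ = subst (λ L → 1 ≤ length L) (≡-sym (filter-accept (adjacent? G centre) {v} {P} e)) (s≤s z≤n)
    degree≥q : q ≤ length (neighbours G centre)
    degree≥q = begin
      q ≡⟨ m∸n+n≡m 1≤q ⟨
      q ∸ 1 + 1 ≤⟨ +-monoʳ-≤ (q ∸ 1) 1≤nb ⟩
      q ∸ 1 + length nb ≡⟨ star-length ⟨
      length (leaves ++ nb) ≤⟨ unique-⊆⇒length≤ star-unique (λ x∈ → ∈-neighbours {G} (All.lookup star-adjacent x∈)) ⟩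
      length (neighbours G centre) ∎
      where open ≤-Reasoning
    path-unique = proj₁ (proj₂ u-parts)
    nb≤ : length nb ≤ p
    nb≤ = subst (length nb ≤_) path-length (length-filter (adjacent? G centre) path)
    Goal = PathFrom G true centre p p centre (centre ≢_) ⊎
      (Σ (Fin p) λ y → PathFrom G false centre p (toℕ y) centre (centre ≢_) × Large G (q ∸ 1 + toℕ y) d (Adjacent G centre))
    by-closing : ∀ b → adj G centre (endpoint G centre path) ≡ b → Goal
    by-closing true e = inj₁ (subst (λ n → PathFrom G true centre n p centre (centre ≢_)) path-length
      (path-complete path-walk path-unique c≢ nb≤ e))
    by-closing false e = inj₂ (fromℕ< nb<p ,
      subst (λ y → PathFrom G false centre p y centre (centre ≢_) × Large G (q ∸ 1 + y) d (Adjacent G centre))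
        (≡-sym (Fin.toℕ-fromℕ< nb<p))
        ( subst (λ n → PathFrom G false centre n (length nb) centre (centre ≢_)) path-length
            (path-complete path-walk path-unique c≢ ≤-refl e)
        , large-complete _ d (adjacent? G centre) star-unique star-adjacent star-length
            (≤-trans 2≤p (<⇒≤ p<d)) (excess< nb<p) (excess-bound _ (2n≤3d nb<p))))
      where
      last-missing : ∀ {P} → 2 ≤ length P → adj G centre (endpoint G centre P) ≡ false → length (filter (adjacent? G centre) P) < length P
      last-missing {v ∷ P} _ e = filter-notAll (adjacent? G centre) (v ∷ P)
        (lose {P = λ z → ¬ Adjacent G centre z} (endpoint-∈ {G} centre v P) (λ e′ → Bool.not-¬ e e′))
      nb<p : length nb < p
      nb<p = subst (length nb <_) path-length (last-missing {path} (subst (2 ≤_) (≡-sym path-length) 2≤p) e)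

  -- One more than a ball of radius `p ∸ 1` can contain when all degrees are at most `q + p`.
  threshold : ℕ
  threshold = suc (suc (q + p) ^ (p ∸ 1))

  module Sound {G : Graph} (connected : Connected G) (big : threshold ≤ size G) where

    -- Some edge leaves the ball of radius `p ∸ 1` about `c`, and its far end is at distance exactly
    -- `p`. The geodesic to it contains at most one of the `q` given neighbours, which leaves
    -- `q - 1` leaves.
    bounded-degree : (∀ v → length (neighbours G v) ≤ q + p) → ∀ {c M} → Unique M → All (Adjacent G c) M →
      length M ≡ q → Sparkles G q p
    bounded-degree deg≤ {c} {M} uM adjM lenM with outside-ball c (p ∸ 1) deg≤ big
    ... | v , v∉ with exit (connected c v) c∈ v∉
      where
      c∈ball : ∀ k → c ∈ ball {G} c k
      c∈ball zero = here refl
      c∈ball (suc k) = ∈-++⁺ˡ (c∈ball k)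
      c∈ = c∈ball (p ∸ 1)
    ... | x , y , x∈ , y∉ , e with geodesic (p ∸ 1) (∈-ball-step {G} {c} {p ∸ 1} x∈ e) y∉ [] ([] ∷ []) []
    ... | P , w , u , len , few = sparkles-from {G} 1≤q w u
        (trans len (trans (+-identityʳ _) (trans (+-comm 1 (p ∸ 1)) (m∸n+n≡m (≤-trans (s≤s z≤n) 2≤p)))))
        uM adjM (≤-trans (common-length {G} (adjacent? G c) uM adjM) few)
        (≤-reflexive (trans (m∸n+n≡m 1≤q) (≡-sym lenM)))

    -- A path of `p` vertices, wherever it runs on its way to the cycle, occupies at most `p` of the
    -- neighbours of `c`.
    high-degree : ∀ {c} → q + p ≤ length (neighbours G c) → Cycle {G} p → Sparkles G q p
    high-degree {c} deg≥ Z with path-to-cycle Z (connected c _)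
    ... | P , w , u , len = sparkles-from {G} {M = neighbours G c} 1≤q w u len (neighbours-unique {G} c) (neighbours-adjacent {G} c)
        (subst (length (filter (λ v → _∈?_ G v P) (neighbours G c)) ≤_) len
          (unique-⊆⇒length≤ (Uniqueₚ.filter⁺ _ (neighbours-unique {G} c)) λ x∈ → proj₂ (∈-filter⁻ (λ v → _∈?_ G v P) {xs = neighbours G c} x∈)))
        (≤-trans (+-monoˡ-≤ p (m∸n≤m q 1)) deg≥)

    clique-cycle : ∀ L → Uniform {G} true L → suc p ≤ length L → Cycle {G} p
    clique-cycle L u p<L = from-clique (take (suc p) L) (take-uniform (suc p) u) (length-take-≤ {xs = L} p<L)
      where
      take-uniform : ∀ n {L} → Uniform {G} true L → Uniform {G} true (take n L)
      take-uniform n = AllPairsₚ.take⁺ n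
      from-clique : ∀ L → Uniform {G} true L → length L ≡ suc p → Cycle {G} p
      from-clique (x ∷ []) u eq = ⊥-elim (<⇒≱ 2≤p (subst (_≤ 1) (suc-injective eq) z≤n))
      from-clique (x ∷ y ∷ L) u@(r ∷ _) eq = cycle (uniform-walk u) (uniform⇒unique {G} u) (suc-injective eq)
        (adjacent-sym {G = G} (proj₂ (All.lookup r (endpoint-∈ {G} x y L))))

    cyclic : ∀ {c M} → Unique M → All (Adjacent G c) M → length M ≡ q → Cycle {G} p → Sparkles G q p
    cyclic uM adjM lenM Z with Fin.any? (λ v → q + p ≤? length (neighbours G v))
    ... | yes (v , deg≥) = high-degree deg≥ Z
    ... | no low = bounded-degree (λ v → <⇒≤ (≰⇒> λ deg≥ → low (v , deg≥))) uM adjM lenM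

    sound : Criterion G → Sparkles G q p
    sound ((c₁ , S) , c , form) with split-sound q q S
    ... | M , uM , adjM , lenM = by-form form
      where
      by-form : _ → Sparkles G q p
      by-form (inj₁ closed-path) with path-sound p closed-path
      ... | trail w u c≢ len _ e = cyclic uM adjM lenM (cycle w (c≢ ∷ u) len (adjacent-sym {G = G} e))
      by-form (inj₂ (y , open-path , large)) with path-sound p open-path | large-sound _ d (adjacent? G c) c large
      ... | trail {P} w u c≢ len few e | inj₁ (L , uL , adjL , lenL) =
        sparkles-from {G} 1≤q w (c≢ ∷ u) len uL adjL (≤-trans (common-length {G} (adjacent? G c) uL adjL) few) (≤-reflexive (≡-sym lenL))
      ... | trail w u c≢ len few e | inj₂ (true , L , uL , adjL , lenL) =
        cyclic uM adjM lenM (clique-cycle L uL (subst (suc p ≤_) (≡-sym lenL) p<d))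
      -- The path ends at a vertex not adjacent to `c`, hence outside `L`. This keeps the number of
      -- its vertices in `L` at `s` even when `p` is odd; the `d` vertices of `L` then include
      -- `q - 1` leaves.
      ... | trail {P} w u c≢ len few e | inj₂ (false , L , uL , adjL , lenL) =
        sparkles-from {G} 1≤q w (c≢ ∷ u) len (uniform⇒unique {G} uL) adjL
          (≤-trans (common-length {G} (λ v → _∈?_ G v L) (uniform⇒unique {G} uL) (All.tabulate id)) x≤s)
          (subst (q ∸ 1 + s ≤_) (≡-sym lenL) q-1+s≤d)
        where
        x = length (filter (λ v → _∈?_ G v L) P)
        2x≤p : x + x ≤ p
        2x≤p = subst (x + x ≤_) len (independent-half {G} uL w λ end∈ → Bool.not-¬ e (All.lookup adjL end∈))
        x≤s : x ≤ s
        x≤s = ≮⇒≥ λ s<x → <⇒≱ (≤-trans (s≤s (≤-trans 2x≤p p≤)) (≤-reflexive (cong suc (≡-sym (+-suc s s))))) (+-mono-≤ s<x s<x)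

  upper-bound : Σ Formula λ Φ → DefinesAsympConn Φ (𝒞 (Sparkler q p)) × depth Φ ≤ suc d
  upper-bound = Definable.formula criterionᴰ
    , (no-free _ (Definable.closed criterionᴰ)
      , threshold , λ G connected big →
          (λ sat → sparkles⇒subgraph (Sound.sound connected big (proj₁ (meaning G) sat)))
        , (λ sub → proj₂ (meaning G) (complete (subgraph⇒sparkles 1≤q sub))))
    , Definable.bounded criterionᴰ
    where
    no-free : ∀ xs → All (_< 0) xs → xs ≡ []
    no-free [] [] = refl
    meaning : ∀ G → (G ⊨ Definable.formula criterionᴰ) ⇔ Criterion G
    meaning G = Definable.correct criterionᴰ {G} {λ _ → nothing} {[]} λ ()

-- Graphs given by labels

count : ℕ → List ℕ → ℕ
count t Ls = length (filter (t ≟_) Ls)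

members : ℕ → (Ls : List ℕ) → List (Fin (length Ls))
members t [] = []
members t (x ∷ Ls) with t ≟ x
... | yes _ = zero ∷ map suc (members t Ls)
... | no _ = map suc (members t Ls)

length-members : ∀ t Ls → length (members t Ls) ≡ count t Ls
length-members t [] = refl
length-members t (x ∷ Ls) with t ≟ x
... | yes t≡x = trans (cong suc (trans (length-map suc (members t Ls)) (length-members t Ls)))
                      (≡-sym (cong length (filter-accept (t ≟_) {x} {Ls} t≡x)))
... | no t≢x = trans (trans (length-map suc (members t Ls)) (length-members t Ls))
                     (≡-sym (cong length (filter-reject (t ≟_) {x} {Ls} t≢x)))

∈-members⁺ : ∀ {t} Ls {v} → lookup Ls v ≡ t → v ∈ members t Ls
∈-members⁺ {t} (x ∷ Ls) {v} e with t ≟ x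
∈-members⁺ (x ∷ Ls) {zero} e | yes _ = here refl
∈-members⁺ (x ∷ Ls) {suc v} e | yes _ = there (∈-map⁺ suc (∈-members⁺ Ls e))
∈-members⁺ (x ∷ Ls) {zero} e | no t≢x = ⊥-elim (t≢x (≡-sym e))
∈-members⁺ (x ∷ Ls) {suc v} e | no _ = ∈-map⁺ suc (∈-members⁺ Ls e)

∈-members⁻ : ∀ {t} Ls {v} → v ∈ members t Ls → lookup Ls v ≡ t
∈-members⁻ {t} (x ∷ Ls) v∈ with t ≟ x
∈-members⁻ (x ∷ Ls) (here refl) | yes t≡x = ≡-sym t≡x
∈-members⁻ (x ∷ Ls) (there v∈) | yes _ with ∈-map⁻ suc v∈
... | w , w∈ , refl = ∈-members⁻ Ls w∈
∈-members⁻ (x ∷ Ls) v∈ | no _ with ∈-map⁻ suc v∈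
... | w , w∈ , refl = ∈-members⁻ Ls w∈

members-unique : ∀ t Ls → Unique (members t Ls)
members-unique t [] = []
members-unique t (x ∷ Ls) with t ≟ x
... | yes _ = Allₚ.map⁺ (All.tabulate λ _ ()) ∷ Uniqueₚ.map⁺ Fin.suc-injective (members-unique t Ls)
... | no _ = Uniqueₚ.map⁺ Fin.suc-injective (members-unique t Ls)

unique⇒length≤count : ∀ {t} Ls {vs} → Unique vs → All (λ v → lookup Ls v ≡ t) vs → length vs ≤ count t Ls
unique⇒length≤count {t} Ls u labels = subst (_ ≤_) (length-members t Ls)
  (unique-⊆⇒length≤ u λ v∈ → ∈-members⁺ Ls (All.lookup labels v∈))

count-++ : ∀ t xs ys → count t (xs ++ ys) ≡ count t xs + count t ys
count-++ t xs ys = trans (cong length (filter-++ (t ≟_) xs ys)) (length-++ (filter (t ≟_) xs))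

count-replicate : ∀ t n → count t (replicate n t) ≡ n
count-replicate t n = trans (cong length (filter-all (t ≟_) (Allₚ.replicate⁺ n refl))) (length-replicate n)

count-absent : ∀ {t xs} → All (t ≢_) xs → count t xs ≡ 0
count-absent {t} ab = cong length (filter-none (t ≟_) ab)

count-replicate-≢ : ∀ {t x} n → t ≢ x → count t (replicate n x) ≡ 0
count-replicate-≢ n t≢x = count-absent (Allₚ.replicate⁺ n t≢x)

-- The condition for answering in `Ls′` every move made in `Ls` with `k` pebbles: a class of twins
-- may be smaller than its counterpart only if it has at least `k` vertices.
record _≼[_]_ (Ls : List ℕ) (k : ℕ) (Ls′ : List ℕ) : Set where
  constructor covers
  field cover : ∀ t → count t Ls ≤ count t Ls′ ⊎ k ≤ count t Ls′

module Labelled (R : ℕ → ℕ → Bool) where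

  linked : ℕ → ℕ → Bool
  linked a b = R a b ∨ R b a

  -- Adjacency of distinct vertices depends on their labels only, so vertices with the same label
  -- are twins, adjacent to each other exactly when `R` relates that label to itself.
  labelled : List ℕ → Graph
  labelled Ls = record
    { size = length Ls
    ; adj = λ u v → not (does (u Fin.≟ v)) ∧ linked (lookup Ls u) (lookup Ls v)
    ; sym = symmetric
    ; irrefl = irreflexive }
    where
    symmetric : ∀ u v → not (does (u Fin.≟ v)) ∧ linked (lookup Ls u) (lookup Ls v)
                      ≡ not (does (v Fin.≟ u)) ∧ linked (lookup Ls v) (lookup Ls u)
    symmetric u v with u Fin.≟ v | v Fin.≟ u
    ... | yes _ | yes _ = refl
    ... | yes refl | no v≢u = ⊥-elim (v≢u refl)
    ... | no u≢v | yes refl = ⊥-elim (u≢v refl)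
    ... | no _ | no _ = Bool.∨-comm (R (lookup Ls u) (lookup Ls v)) _
    irreflexive : ∀ u → not (does (u Fin.≟ u)) ∧ linked (lookup Ls u) (lookup Ls u) ≡ false
    irreflexive u with u Fin.≟ u
    ... | yes _ = refl
    ... | no u≢u = ⊥-elim (u≢u refl)

  adj⁺ : ∀ Ls {u v} → u ≢ v → linked (lookup Ls u) (lookup Ls v) ≡ true → adj (labelled Ls) u v ≡ true
  adj⁺ Ls {u} {v} u≢v e with u Fin.≟ v
  ... | yes u≡v = ⊥-elim (u≢v u≡v)
  ... | no _ = e

  adj⁻ : ∀ Ls {u v} → adj (labelled Ls) u v ≡ true → u ≢ v × linked (lookup Ls u) (lookup Ls v) ≡ true
  adj⁻ Ls {u} {v} e with u Fin.≟ v
  ... | no u≢v = u≢v , e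

  -- The pebble game on labelled graphs, with the variables in `X` as pebbles

  module Game (X : List ℕ) where

    data Match {Ls Ls′ : List ℕ} : Maybe (Fin (length Ls)) → Maybe (Fin (length Ls′)) → Set where
      none : Match nothing nothing
      some : ∀ {u u′} → lookup Ls u ≡ lookup Ls′ u′ → Match (just u) (just u′)

    match-sym : ∀ {Ls Ls′ m m′} → Match {Ls} {Ls′} m m′ → Match {Ls′} {Ls} m′ m
    match-sym none = none
    match-sym (some e) = some (≡-sym e)

    -- A winning position for the player who imitates: labels and equality of pebbled vertices are
    -- preserved, and these determine adjacency.
    record Similar {Ls Ls′ : List ℕ} (ρ : Env (labelled Ls)) (ρ′ : Env (labelled Ls′)) : Set where
      constructor similar
      field
        match : ∀ {x} → x ∈ X → Match {Ls} {Ls′} (ρ x) (ρ′ x)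
        coherent : ∀ {x y u v u′ v′} → x ∈ X → y ∈ X → ρ x ≡ just u → ρ y ≡ just v →
          ρ′ x ≡ just u′ → ρ′ y ≡ just v′ → u ≡ v ⇔ u′ ≡ v′
    open Similar

    similar-sym : ∀ {Ls Ls′ ρ ρ′} → Similar {Ls} {Ls′} ρ ρ′ → Similar {Ls′} {Ls} ρ′ ρ
    similar-sym S = similar (match-sym ∘ match S) λ x∈ y∈ a b c d → swap (coherent S x∈ y∈ c d a b)

    module Respond {Ls Ls′ : List ℕ} (Ls≼ : Ls ≼[ length X ] Ls′) {ρ ρ′} (S : Similar {Ls} {Ls′} ρ ρ′)
      {x : ℕ} (x∈ : x ∈ X) (u : Fin (length Ls)) where

      -- The pebbles that stay in place while `x` moves. There are fewer than `length X`, so they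
      -- cannot occupy all of a class with `length X` vertices.
      Y : List ℕ
      Y = filter (¬? ∘ (x ≟_)) X

      Y⊆X : ∀ {y} → y ∈ Y → y ∈ X
      Y⊆X = proj₁ ∘ ∈-filter⁻ (¬? ∘ (x ≟_))

      ∈Y : ∀ {y} → y ∈ X → x ≢ y → y ∈ Y
      ∈Y = ∈-filter⁺ (¬? ∘ (x ≟_))

      Y<X : length Y < length X
      Y<X = filter-notAll (¬? ∘ (x ≟_)) X (lose {P = λ y → ¬ (x ≢ y)} x∈ (λ n → n refl))

      extend : ∀ u′ → lookup Ls u ≡ lookup Ls′ u′ →
        (∀ {y v v′} → y ∈ Y → ρ y ≡ just v → ρ′ y ≡ just v′ → u ≡ v ⇔ u′ ≡ v′) →
        Similar {Ls} {Ls′} (update {labelled Ls} ρ x u) (update {labelled Ls′} ρ′ x u′)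
      extend u′ same-label fits = similar match′ coherent′
        where
        ρ₁ = update {labelled Ls} ρ x u
        ρ₁′ = update {labelled Ls′} ρ′ x u′
        match′ : ∀ {z} → z ∈ X → Match {Ls} {Ls′} (ρ₁ z) (ρ₁′ z)
        match′ {z} z∈ with x ≟ z
        ... | yes refl = subst₂ Match (≡-sym (update-same {labelled Ls} ρ x u)) (≡-sym (update-same {labelled Ls′} ρ′ x u′)) (some same-label)
        ... | no x≢z = subst₂ Match (≡-sym (update-other {labelled Ls} ρ u x≢z)) (≡-sym (update-other {labelled Ls′} ρ′ u′ x≢z)) (match S z∈)
        new : ∀ {v} → ρ₁ x ≡ just v → u ≡ v
        new e = just-injective (trans (≡-sym (update-same {labelled Ls} ρ x u)) e)
        new′ : ∀ {v} → ρ₁′ x ≡ just v → u′ ≡ v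
        new′ e = just-injective (trans (≡-sym (update-same {labelled Ls′} ρ′ x u′)) e)
        old : ∀ {y v} → x ≢ y → ρ₁ y ≡ just v → ρ y ≡ just v
        old x≢y e = trans (≡-sym (update-other {labelled Ls} ρ u x≢y)) e
        old′ : ∀ {y v} → x ≢ y → ρ₁′ y ≡ just v → ρ′ y ≡ just v
        old′ x≢y e = trans (≡-sym (update-other {labelled Ls′} ρ′ u′ x≢y)) e
        coherent′ : ∀ {y z v w v′ w′} → y ∈ X → z ∈ X → ρ₁ y ≡ just v → ρ₁ z ≡ just w →
          ρ₁′ y ≡ just v′ → ρ₁′ z ≡ just w′ → v ≡ w ⇔ v′ ≡ w′
        coherent′ {y} {z} y∈ z∈ a b c d with x ≟ y | x ≟ z
        ... | yes refl | yes refl = (λ _ → trans (≡-sym (new′ c)) (new′ d)) , (λ _ → trans (≡-sym (new a)) (new b))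
        ... | yes refl | no x≢z rewrite ≡-sym (new a) | ≡-sym (new′ c) = fits (∈Y z∈ x≢z) (old x≢z b) (old′ x≢z d)
        ... | no x≢y | yes refl rewrite ≡-sym (new b) | ≡-sym (new′ d) =
          let (f , g) = fits (∈Y y∈ x≢y) (old x≢y a) (old′ x≢y c) in ≡-sym ∘ f ∘ ≡-sym , ≡-sym ∘ g ∘ ≡-sym
        ... | no x≢y | no x≢z = coherent S y∈ z∈ (old x≢y a) (old x≢z b) (old′ x≢y c) (old′ x≢z d)

      Response : Set
      Response = ∃ λ u′ → Similar {Ls} {Ls′} (update {labelled Ls} ρ x u) (update {labelled Ls′} ρ′ x u′)

      t = lookup Ls u
      C′ = members t Ls′

      Pebbled : Fin (length Ls) → Set
      Pebbled v = Any.Any (λ y → ρ y ≡ just v) Y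
      Pebbled′ : Fin (length Ls′) → Set
      Pebbled′ v′ = Any.Any (λ y → ρ′ y ≡ just v′) Y

      pebbled? : Decidable Pebbled
      pebbled? v = Any.any? (λ y → ≡-dec Fin._≟_ (ρ y) (just v)) Y
      pebbled′? : Decidable Pebbled′
      pebbled′? v = Any.any? (λ y → ≡-dec Fin._≟_ (ρ′ y) (just v)) Y

      match-of : ∀ {y v} → y ∈ X → ρ y ≡ just v → ∃ λ v′ → ρ′ y ≡ just v′ × lookup Ls v ≡ lookup Ls′ v′
      match-of {y} y∈ e with ρ y | ρ′ y | match S y∈
      match-of y∈ refl | just v | just v′ | some e′ = v′ , refl , e′

      match-of′ : ∀ {y v′} → y ∈ X → ρ′ y ≡ just v′ → ∃ λ v → ρ y ≡ just v × lookup Ls v ≡ lookup Ls′ v′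
      match-of′ {y} y∈ e with ρ y | ρ′ y | match S y∈
      match-of′ y∈ refl | just v | just v′ | some e′ = v , refl , e′

      copy : Pebbled u → Response
      copy peb with find peb
      ... | y , y∈ , e with match-of (Y⊆X y∈) e
      ... | u′ , e′ , lab = u′ , extend u′ lab λ z∈ a b → coherent S (Y⊆X y∈) (Y⊆X z∈) e a e′ b

      fresh : ¬ Pebbled u → ∀ {u′} → u′ ∈ C′ → ¬ Pebbled′ u′ → Response
      fresh ¬peb {u′} u′∈ ¬peb′ = u′ , extend u′ (≡-sym (∈-members⁻ Ls′ u′∈)) λ {y} y∈ a b →
        (λ { refl → ⊥-elim (¬peb (lose {P = λ y → ρ y ≡ just u} y∈ a)) }) ,
        (λ { refl → ⊥-elim (¬peb′ (lose {P = λ y → ρ′ y ≡ just u′} y∈ b)) })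

      Partner : List (Fin (length Ls′)) → Fin (length Ls) → Set
      Partner D v = ∃₂ λ y v′ → y ∈ Y × v′ ∈ D × ρ y ≡ just v × ρ′ y ≡ just v′ × lookup Ls v ≡ lookup Ls′ v′

      -- Similarity reflects distinctness, so distinct pebbled vertices correspond to distinct
      -- vertices under the same pebbles on the other side.
      pull-back : ∀ D → Unique D → All Pebbled′ D → ∃ λ E → length E ≡ length D × Unique E × All (Partner D) E
      pull-back [] _ _ = [] , refl , [] , []
      pull-back (v′ ∷ D) (v′∉ ∷ uD) (peb ∷ pebs) with pull-back D uD pebs | find peb
      ... | E , len , uE , partners | y , y∈ , e′ with match-of′ (Y⊆X y∈) e′
      ... | v , e , lab = v ∷ E , cong suc len ,
          All.map (λ { (z , w′ , z∈ , w′∈ , a , a′ , _) v≡w →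
            All.lookup v′∉ w′∈ (proj₁ (coherent S (Y⊆X y∈) (Y⊆X z∈) e a e′ a′) v≡w) }) partners ∷ uE ,
          (y , v′ , y∈ , here refl , e , e′ , lab) ∷ All.map (λ { (z , w′ , z∈ , w′∈ , r) → z , w′ , z∈ , there w′∈ , r }) partners

      ∈-images : ∀ {v′} ys → Any.Any (λ y → ρ′ y ≡ just v′) ys → v′ ∈ mapMaybe ρ′ ys
      ∈-images (y ∷ ys) (here e) rewrite e = here refl
      ∈-images (y ∷ ys) (there a) with ρ′ y
      ... | just _ = there (∈-images ys a)
      ... | nothing = ∈-images ys a

      -- A class with at least `length X` vertices has too many for the pebbles in `Y`. In the other
      -- case the class in `Ls` is no larger than `C′`, yet it contains the pulled-back copy of `C′`
      -- and also the unpebbled `u`.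
      exhausted : ¬ Pebbled u → All Pebbled′ C′ → ⊥
      exhausted ¬peb pebs with pull-back C′ (members-unique t Ls′) pebs | _≼[_]_.cover Ls≼ t
      ... | _ | inj₂ k≤ = <⇒≱ Y<X (≤-trans k≤ (≤-trans (≤-reflexive (≡-sym (length-members t Ls′)))
          (≤-trans (unique-⊆⇒length≤ (members-unique t Ls′) (λ v′∈ → ∈-images Y (All.lookup pebs v′∈))) (length-mapMaybe ρ′ Y))))
      ... | E , len , uE , partners | inj₁ fewer = 1+n≰n (≤-trans
          (unique⇒length≤count Ls {u ∷ E} (All.map new partners ∷ uE) (refl ∷ All.map label partners))
          (≤-trans fewer (≤-reflexive (trans (≡-sym (length-members t Ls′)) (≡-sym len)))))
        where
        new : ∀ {v} → Partner C′ v → u ≢ v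
        new (y , _ , y∈ , _ , e , _) refl = ¬peb (lose {P = λ y → ρ y ≡ just u} y∈ e)
        label : ∀ {v} → Partner C′ v → lookup Ls v ≡ t
        label (_ , v′ , _ , v′∈ , _ , _ , lab) = trans lab (∈-members⁻ Ls′ v′∈)

      respond : Response
      respond with pebbled? u
      ... | yes peb = copy peb
      ... | no ¬peb with Any.any? (¬? ∘ pebbled′?) C′
      ...   | yes free = let (u′ , u′∈ , ¬peb′) = find free in fresh ¬peb u′∈ ¬peb′
      ...   | no taken = ⊥-elim (exhausted ¬peb (All.tabulate pebbled))
        where
        pebbled : ∀ {v′} → v′ ∈ C′ → Pebbled′ v′
        pebbled {v′} v′∈ with pebbled′? v′
        ... | yes peb = peb
        ... | no ¬peb′ = ⊥-elim (taken (lose {P = λ v → ¬ Pebbled′ v} v′∈ ¬peb′))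

    -- Negations and premises reverse the direction, and universal quantifiers are answered in the
    -- opposite graph, so both comparisons are carried along.
    transfer : ∀ {Ls Ls′} → Ls ≼[ length X ] Ls′ → Ls′ ≼[ length X ] Ls → ∀ φ → (∀ {x} → x ∈ vars φ → x ∈ X) →
      ∀ {ρ ρ′} → Similar {Ls} {Ls′} ρ ρ′ → Sat (labelled Ls) ρ φ → Sat (labelled Ls′) ρ′ φ
    transfer {Ls} {Ls′} f g (x ≐ y) sub {ρ} {ρ′} S sat
      with ρ x in a | ρ y in b | ρ′ x in c | ρ′ y in d | match S (sub (here refl)) | match S (sub (there (here refl)))
    ... | just u | just v | just _ | just _ | some _ | some _ = proj₁ (coherent S (sub (here refl)) (sub (there (here refl))) a b c d) sat
    transfer {Ls} {Ls′} f g (x ∼ y) sub {ρ} {ρ′} S sat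
      with ρ x in a | ρ y in b | ρ′ x in c | ρ′ y in d | match S (sub (here refl)) | match S (sub (there (here refl)))
    ... | just u | just v | just _ | just _ | some e | some e′ = let (u≢v , l) = adj⁻ Ls sat in
      adj⁺ Ls′ (u≢v ∘ proj₂ (coherent S (sub (here refl)) (sub (there (here refl))) a b c d)) (subst₂ (λ i j → linked i j ≡ true) e e′ l)
    transfer f g (¬' φ) sub S sat sat′ = sat (transfer g f φ sub (similar-sym S) sat′)
    transfer f g (φ ∧' ψ) sub S (s₁ , s₂) = transfer f g φ (sub ∘ ∈-++⁺ˡ) S s₁ , transfer f g ψ (sub ∘ ∈-++⁺ʳ (vars φ)) S s₂
    transfer f g (φ ∨' ψ) sub S (inj₁ s) = inj₁ (transfer f g φ (sub ∘ ∈-++⁺ˡ) S s)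
    transfer f g (φ ∨' ψ) sub S (inj₂ s) = inj₂ (transfer f g ψ (sub ∘ ∈-++⁺ʳ (vars φ)) S s)
    transfer f g (φ ⇒' ψ) sub S sat sat′ =
      transfer f g ψ (sub ∘ ∈-++⁺ʳ (vars φ)) S (sat (transfer g f φ (sub ∘ ∈-++⁺ˡ) (similar-sym S) sat′))
    transfer f g (∃' x φ) sub S (u , sat) =
      let (u′ , S′) = Respond.respond f S (sub (here refl)) u in u′ , transfer f g φ (sub ∘ there) S′ sat
    transfer f g (∀' x φ) sub S sat u′ =
      let (u , S′) = Respond.respond g (similar-sym S) (sub (here refl)) u′ in
      transfer f g φ (sub ∘ there) (similar-sym S′) (sat u)

  indistinguishable : ∀ {Ls Ls′} Φ → Ls ≼[ width Φ ] Ls′ → Ls′ ≼[ width Φ ] Ls → labelled Ls ⊨ Φ → labelled Ls′ ⊨ Φ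
  indistinguishable Φ f g = transfer f g Φ (∈-deduplicate⁺ _≟_) (similar (λ _ → none) λ { _ _ () })
    where open Game (deduplicate _≟_ (vars Φ))

-- The lower bounds on the width

index-of : ∀ {t : ℕ} {Ls} → t ∈ Ls → ∃ λ v → lookup Ls v ≡ t
index-of (here refl) = zero , refl
index-of (there t∈) = let (v , e) = index-of t∈ in suc v , e

single : ∀ {t} Ls {u v} → count t Ls ≤ 1 → lookup Ls u ≡ t → lookup Ls v ≡ t → u ≡ v
single Ls {u} {v} c≤1 eu ev with u Fin.≟ v
... | yes u≡v = u≡v
... | no u≢v = ⊥-elim (1+n≰n (≤-trans (unique⇒length≤count Ls ((u≢v ∷ []) ∷ [] ∷ []) (eu ∷ ev ∷ [])) c≤1))

apart : ∀ (Ls : List ℕ) {u v a b} → a ≢ b → lookup Ls u ≡ a → lookup Ls v ≡ b → u ≢ v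
apart Ls a≢b eu ev refl = a≢b (trans (≡-sym eu) ev)

two-labels : ∀ {a b} Ls {vs} → Unique vs → All (λ v → lookup Ls v ≡ a ⊎ lookup Ls v ≡ b) vs →
  length vs ≤ count a Ls + count b Ls
two-labels {a} {b} Ls {vs} u labels = ≤-trans (≤-reflexive (≡-sym (filter-length-split A? vs)))
  (+-mono-≤ (unique⇒length≤count Ls (Uniqueₚ.filter⁺ A? u) (Allₚ.all-filter A? vs))
            (unique⇒length≤count Ls (Uniqueₚ.filter⁺ (¬? ∘ A?) u) (All.tabulate other)))
  where
  A? : Decidable (λ v → lookup Ls v ≡ a)
  A? v = lookup Ls v ≟ a
  other : ∀ {v} → v ∈ filter (¬? ∘ A?) vs → lookup Ls v ≡ b
  other v∈ with ∈-filter⁻ (¬? ∘ A?) {xs = vs} v∈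
  ... | v∈vs , ≢a with All.lookup labels v∈vs
  ... | inj₁ ≡a = ⊥-elim (≢a ≡a)
  ... | inj₂ ≡b = ≡b

reach-trans : ∀ {G u v w} → Reach G u v → Reach G v w → Reach G u w
reach-trans Reach.here r = r
reach-trans (step e r) r′ = step e (reach-trans r r′)

reach-sym : ∀ {G u v} → Reach G u v → Reach G v u
reach-sym Reach.here = Reach.here
reach-sym {G} (step e r) = reach-trans (reach-sym r) (step (adjacent-sym {G = G} e) Reach.here)

replicate-≼ : ∀ {w k rest} → w ≤ k → ∀ m n → k ≤ n → (replicate m 0 ++ rest) ≼[ w ] (replicate n 0 ++ rest)
replicate-≼ {w} {k} {rest} w≤k m n k≤n = covers enough
  where
  enough : ∀ t → count t (replicate m 0 ++ rest) ≤ count t (replicate n 0 ++ rest) ⊎ w ≤ count t (replicate n 0 ++ rest)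
  enough zero = inj₂ (begin
    w ≤⟨ ≤-trans w≤k k≤n ⟩
    n ≡⟨ count-replicate 0 n ⟨
    count 0 (replicate n 0) ≤⟨ m≤m+n _ _ ⟩
    count 0 (replicate n 0) + count 0 rest ≡⟨ count-++ 0 (replicate n 0) rest ⟨
    count 0 (replicate n 0 ++ rest) ∎)
    where open ≤-Reasoning
  enough (suc t) = inj₁ (≤-reflexive (trans (count-rest m) (≡-sym (count-rest n))))
    where
    count-rest : ∀ n → count (suc t) (replicate n 0 ++ rest) ≡ count (suc t) rest
    count-rest n = trans (count-++ (suc t) (replicate n 0) rest) (cong (_+ count (suc t) rest) (count-replicate-≢ n λ ()))

module Family (R : ℕ → ℕ → Bool) (rest : ℕ → List ℕ) where
  open Labelled R public

  member : ℕ → ℕ → Graph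
  member n N = labelled (replicate n 0 ++ rest N)

  -- A sentence of width at most `k` does not notice that the class of label 0 grows from `k` to
  -- `k + 1`. The parameter `N` takes the graphs past the size from which the sentence is correct.
  needs-width : ∀ {q p k} → 1 ≤ q → (∀ N → N ≤ length (rest N)) →
    (∀ N → Connected (member k N)) → (∀ N → Connected (member (suc k) N)) →
    (∀ N → ¬ Sparkles (member k N) q p) → (∀ N → Sparkles (member (suc k) N) q p) →
    ∀ Φ → DefinesAsympConn Φ (𝒞 (Sparkler q p)) → k < width Φ
  needs-width {q} {p} {k} 1≤q big connected connected⁺ without with-sparkler Φ (_ , N , defines) = ≰⇒> λ w≤k →
    without N (subgraph⇒sparkles 1≤q (proj₁ (defines (member k N) (connected N) (large k))
      (indistinguishable Φ (replicate-≼ w≤k (suc k) k ≤-refl) (replicate-≼ w≤k k (suc k) (n≤1+n k))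
        (proj₂ (defines (member (suc k) N) (connected⁺ N) (large (suc k))) (sparkles⇒subgraph (with-sparkler N))))))
    where
    large : ∀ n → N ≤ size (member n N)
    large n = ≤-trans (big N) (≤-trans (m≤n+m _ _) (≤-reflexive (≡-sym (length-++ (replicate n 0)))))

module Connectivity (R : ℕ → ℕ → Bool) (Ls : List ℕ) (h : Fin (length Ls)) where
  open Labelled R

  ReachFrom : ℕ → Set
  ReachFrom t = ∀ {u} → lookup Ls u ≡ t → Reach (labelled Ls) u h

  reach-step : ∀ {t t′} → t ≢ t′ → linked t t′ ≡ true → t′ ∈ Ls → ReachFrom t′ → ReachFrom t
  reach-step t≢t′ l t′∈ r {u} refl with index-of t′∈
  ... | v , refl = step (adj⁺ Ls (λ { refl → t≢t′ refl }) l) (r refl)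

  connected-from : All ReachFrom Ls → Connected (labelled Ls)
  connected-from rs u v = reach-trans (to-hub u) (reach-sym (to-hub v))
    where
    to-hub : ∀ u → Reach (labelled Ls) u h
    to-hub u = All.lookup rs (∈-lookup {xs = Ls} u) refl

module _ {G : Graph} {q p} (S : Sparkles G q p) where
  open Sparkles S

  first-edge : 1 ≤ p → ∃₂ λ v P → path ≡ v ∷ P × Adjacent G centre v × Walk G v P
  first-edge 1≤p with path | path-length | path-walk
  ... | [] | refl | _ = ⊥-elim (1+n≰n 1≤p)
  ... | v ∷ P | _ | e ∷ w = v , P , refl , e , w

  star : ∀ {v P} → path ≡ v ∷ P → Adjacent G centre v → Unique (v ∷ leaves) × All (Adjacent G centre) (v ∷ leaves) × length (v ∷ leaves) ≡ q
  star refl e with ++-unique⁻ leaves (AllPairs.tail distinct)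
  ... | u , _ , disj = ∉⇒All≢ (λ v∈ → disj v∈ (here refl)) ∷ u , e ∷ leaves-adjacent , leaves-length

-- Long path with leaves at one end: labels 0 (leaf) and 1, 2, 3, … (path).
module Broom where
  R : ℕ → ℕ → Bool
  R a b = b ≡ᵇ suc a

  neighbour-labels : ∀ a b → (R a b ∨ R b a) ≡ true → b ≡ suc a ⊎ a ≡ suc b
  neighbour-labels a b e with Equivalence.to Bool.T-∨ (Equivalence.from Bool.T-≡ e)
  ... | inj₁ t = inj₁ (≡ᵇ⇒≡ b (suc a) t)
  ... | inj₂ t = inj₂ (≡ᵇ⇒≡ a (suc b) t)

  next : ∀ a → (R a (suc a) ∨ R (suc a) a) ≡ true
  next a rewrite ≡ᵇ-refl a = refl

  module _ (p : ℕ) where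
    rest : ℕ → List ℕ
    rest N = applyUpTo suc (N + suc p)
    open Family R rest

    big : ∀ N → N ≤ length (rest N)
    big N = ≤-trans (m≤m+n N (suc p)) (≤-reflexive (≡-sym (length-applyUpTo suc (N + suc p))))

    module _ (n N : ℕ) where
      Ls = replicate n 0 ++ rest N
      label = lookup Ls

      suc∈ : ∀ {i} → i < N + suc p → suc i ∈ Ls
      suc∈ i< = ∈-++⁺ʳ (replicate n 0) (∈-applyUpTo⁺ suc i<)

      count-path : ∀ t → count (suc t) Ls ≤ 1
      count-path t = ≤-trans
        (≤-reflexive (trans (count-++ (suc t) (replicate n 0) (rest N)) (cong (_+ count (suc t) (rest N)) (count-replicate-≢ n λ ()))))
        (unique-⊆⇒length≤ {ys = suc t ∷ []}
          (Uniqueₚ.filter⁺ (suc t ≟_) (Uniqueₚ.applyUpTo⁺₁ suc (N + suc p) λ i<j _ e → <⇒≢ i<j (suc-injective e)))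
          λ x∈ → here (≡-sym (proj₂ (∈-filter⁻ (suc t ≟_) {xs = rest N} x∈))))

      count-leaves : count 0 Ls ≡ n
      count-leaves = trans (count-++ 0 (replicate n 0) (rest N)) (trans (cong₂ _+_ (count-replicate 0 n)
        (count-absent {0} {rest N} (Allₚ.applyUpTo⁺₂ suc (N + suc p) λ _ ()))) (+-identityʳ n))

      hub = index-of (suc∈ {0} (≤-trans (s≤s z≤n) (m≤n+m (suc p) N)))

      open Connectivity R Ls (proj₁ hub)

      connected : Connected (member n N)
      connected = connected-from (Allₚ.++⁺ (Allₚ.replicate⁺ n from-leaf) (Allₚ.applyUpTo⁺₁ suc _ from-path))
        where
        from-one : ReachFrom 1
        from-one e rewrite single Ls (count-path 0) e (proj₂ hub) = Reach.here
        from-leaf : ReachFrom 0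
        from-leaf = reach-step (λ ()) refl (suc∈ {0} (≤-trans (s≤s z≤n) (m≤n+m (suc p) N))) from-one
        from-path : ∀ {i} → i < N + suc p → ReachFrom (suc i)
        from-path {zero} _ = from-one
        from-path {suc i} i< = reach-step (λ e → 1+n≢n e) (trans (Bool.∨-comm (R (suc (suc i)) (suc i)) _) (next (suc i)))
          (suc∈ (<-trans (n<1+n i) i<)) (from-path (<-trans (n<1+n i) i<))

      -- The centre of a sparkler has `q` neighbours, the leaves and the first vertex of the path.
      -- Here a vertex of label 1 has at most `n + 1` neighbours and any other vertex at most two.
      low-degree : ∀ {q} → 3 ≤ q → 2 + n ≤ q → 1 ≤ p → ¬ Sparkles (member n N) q p
      low-degree {q} 3≤q n≤ 1≤p S with first-edge S 1≤p
      ... | v , P , eq , e , _ with star S eq e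
      ... | u , adjacent , len = by-label (label centre) refl
        where
        open Sparkles S
        nbr : ∀ {w} → Adjacent (member n N) centre w → label w ≡ suc (label centre) ⊎ label centre ≡ suc (label w)
        nbr e = neighbour-labels _ _ (proj₂ (adj⁻ Ls e))
        few : ∀ {m} → m < q → length (v ∷ leaves) ≤ m → ⊥
        few m<q ≤m = <⇒≱ m<q (subst (_≤ _) len ≤m)
        by-label : ∀ t → label centre ≡ t → ⊥
        by-label zero e₀ = few (≤-trans (s≤s (s≤s z≤n)) 3≤q) (≤-trans (unique⇒length≤count Ls u (All.map one adjacent)) (count-path 0))
          where
          one : ∀ {w} → Adjacent (member n N) centre w → label w ≡ 1
          one e with nbr e
          ... | inj₁ e′ = trans e′ (cong suc e₀)
          ... | inj₂ e′ with trans (≡-sym e₀) e′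
          ...   | ()
        by-label (suc t) e₀ = few (bound t) (two-labels Ls u (All.map either adjacent))
          where
          either : ∀ {w} → Adjacent (member n N) centre w → label w ≡ suc (suc t) ⊎ label w ≡ t
          either e with nbr e
          ... | inj₁ e′ = inj₁ (trans e′ (cong suc e₀))
          ... | inj₂ e′ = inj₂ (suc-injective (trans (≡-sym e′) e₀))
          bound : ∀ t → count (suc (suc t)) Ls + count t Ls < q
          bound zero = ≤-trans (s≤s (+-mono-≤ (count-path 1) (≤-reflexive count-leaves))) n≤
          bound (suc t) = ≤-trans (s≤s (+-mono-≤ (count-path (suc (suc t))) (count-path t))) 3≤q

      climb : ∀ m {i u} → label u ≡ suc i → i + m < N + suc p →
        ∃ λ P → Walk (member n N) u P × Unique P × All (λ w → suc i < label w) P × length P ≡ m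
      climb zero _ _ = [] , [] , [] , [] , refl
      climb (suc m) {i} {u} e i+m<
        with index-of (suc∈ {suc i} (≤-trans (s≤s (≤-trans (s≤s (m≤m+n i m)) (≤-reflexive (≡-sym (+-suc i m))))) i+m<))
      ... | w , e′ with climb m e′ (subst (_< N + suc p) (+-suc i m) i+m<)
      ... | P , walk , uP , above , len =
        w ∷ P
        , adj⁺ Ls (λ { refl → 1+n≢n (trans (≡-sym e′) e) }) (subst₂ (λ a b → linked a b ≡ true) (≡-sym e) (≡-sym e′) (next (suc i))) ∷ walk
        , All.map (λ { w< refl → <⇒≢ w< (≡-sym e′) }) above ∷ uP
        , ≤-reflexive (≡-sym e′) ∷ All.map (<-trans (n<1+n (suc i))) above
        , cong suc len

      sparkler : Sparkles (member n N) (suc n) p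
      sparkler with climb p (proj₂ hub) (≤-trans (n<1+n p) (m≤n+m (suc p) N))
      ... | P , walk , uP , above , len = record
        { centre = proj₁ hub ; leaves = members 0 Ls ; path = P
        ; leaves-length = cong suc (trans (length-members 0 Ls) count-leaves)
        ; path-length = len
        ; distinct = Allₚ.++⁺ (All.map (apart Ls (λ ()) (proj₂ hub)) leaf-labels)
                              (All.map (λ { w> refl → <⇒≢ w> (≡-sym (proj₂ hub)) }) above)
            ∷ ++-unique (members-unique 0 Ls) uP (λ x∈ x∈P → n≮0 (subst (1 <_) (All.lookup leaf-labels x∈) (All.lookup above x∈P)))
        ; leaves-adjacent = All.map (λ e → adj⁺ Ls (apart Ls (λ ()) (proj₂ hub) e)
            (subst₂ (λ a b → linked a b ≡ true) (≡-sym (proj₂ hub)) (≡-sym e) refl)) leaf-labels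
        ; path-walk = walk }
        where
        leaf-labels : All (λ w → label w ≡ 0) (members 0 Ls)
        leaf-labels = All.tabulate (∈-members⁻ Ls)

  width-bound : ∀ {q p} → 3 ≤ q → 1 ≤ p → ∀ Φ → DefinesAsympConn Φ (𝒞 (Sparkler q p)) → q ∸ 1 ≤ width Φ
  width-bound {suc zero} (s≤s ())
  width-bound {suc (suc k)} {p} 3≤q 1≤p = needs-width (s≤s z≤n) (big p) (connected p k) (connected p (suc k))
    (λ N → low-degree p k N 3≤q ≤-refl 1≤p) (sparkler p (suc k))
    where open Family R (rest p)

_∈ₑ?_ : ∀ e es → Dec (e ∈ es)
_∈ₑ?_ = DecMembership._∈?_ (Productₚ.≡-dec _≟_ _≟_)

among : List (ℕ × ℕ) → ℕ → ℕ → Bool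
among es a b = does ((a , b) ∈ₑ? es)

among⁻ : ∀ es a b → (among es a b ∨ among es b a) ≡ true → (a , b) ∈ es ⊎ (b , a) ∈ es
among⁻ es a b e with (a , b) ∈ₑ? es | (b , a) ∈ₑ? es
... | yes e∈ | _ = inj₁ e∈
... | no _ | yes e∈ = inj₂ e∈

-- A clique (label 0) containing a hub (label 1) with many pendant neighbours (label 2).
module Jellyfish where
  -- Both orientations of every edge, as a family over the labels: pattern matching then leaves only
  -- the possible continuations of a walk.
  data Edge : ℕ → ℕ → Set where
    00-edge : Edge 0 0
    01-edge : Edge 0 1
    10-edge : Edge 1 0
    12-edge : Edge 1 2
    21-edge : Edge 2 1

  edges : List (ℕ × ℕ)
  edges = (0 , 0) ∷ (0 , 1) ∷ (1 , 2) ∷ []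

  R = among edges

  edge : ∀ {a b} → (R a b ∨ R b a) ≡ true → Edge a b
  edge {a} {b} e with among⁻ edges a b e
  ... | inj₁ (here refl) = 00-edge
  ... | inj₁ (there (here refl)) = 01-edge
  ... | inj₁ (there (there (here refl))) = 12-edge
  ... | inj₂ (here refl) = 00-edge
  ... | inj₂ (there (here refl)) = 10-edge
  ... | inj₂ (there (there (here refl))) = 21-edge

  module _ (q : ℕ) where
    rest : ℕ → List ℕ
    -- The additional `q` pendant vertices provide the leaves of a sparkler for every `N`.
    rest N = 1 ∷ replicate (N + q) 2
    open Family R rest

    big : ∀ N → N ≤ length (rest N)
    big N = ≤-trans (m≤m+n N q) (≤-trans (≤-reflexive (≡-sym (length-replicate (N + q)))) (n≤1+n _))

    module _ (n N : ℕ) where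
      Ls = replicate n 0 ++ rest N
      label = lookup Ls
      G = member n N

      count-clique : count 0 Ls ≡ n
      count-clique = trans (count-++ 0 (replicate n 0) (rest N)) (trans (cong₂ _+_ (count-replicate 0 n)
        (count-replicate-≢ (N + q) (λ ()))) (+-identityʳ n))

      count-hub : count 1 Ls ≡ 1
      count-hub = trans (count-++ 1 (replicate n 0) (rest N)) (cong₂ _+_ (count-replicate-≢ n (λ ()))
        (cong suc (count-replicate-≢ (N + q) (λ ()))))

      count-pendant : count 2 Ls ≡ N + q
      count-pendant = trans (count-++ 2 (replicate n 0) (rest N)) (cong₂ _+_ (count-replicate-≢ n (λ ()))
        (count-replicate 2 (N + q)))

      hub = index-of (∈-++⁺ʳ (replicate n 0) {rest N} (here refl))

      same-hub : ∀ {u v} → label u ≡ 1 → label v ≡ 1 → u ≡ v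
      same-hub = single Ls (≤-reflexive count-hub)

      open Connectivity R Ls (proj₁ hub)

      connected : Connected G
      connected = connected-from (Allₚ.++⁺ (Allₚ.replicate⁺ n (λ {u} → from 0 (λ ()) refl {u}))
        ((λ {u} → from-hub {u}) ∷ Allₚ.replicate⁺ (N + q) (λ {u} → from 2 (λ ()) refl {u})))
        where
        from-hub : ReachFrom 1
        from-hub e rewrite same-hub e (proj₂ hub) = Reach.here
        from : ∀ t → t ≢ 1 → linked t 1 ≡ true → ReachFrom t
        from t t≢1 l = reach-step t≢1 l (∈-++⁺ʳ (replicate n 0) (here refl)) from-hub

      edge-of : ∀ {u v} → Adjacent G u v → Edge (label u) (label v)
      edge-of {u} {v} e = edge {label u} {label v} (proj₂ (adj⁻ Ls e))

      edge-from : ∀ {u v t} → label u ≡ t → Adjacent G u v → ∃ λ t′ → label v ≡ t′ × Edge t t′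
      edge-from refl e = _ , refl , edge-of e

      stays-in-clique : ∀ {h u P} → label h ≡ 1 → label u ≡ 0 → Walk G u P → All (h ≢_) P → All (λ v → label v ≡ 0) P
      stays-in-clique eh eu [] [] = []
      stays-in-clique eh eu (e ∷ w) (h≢v ∷ h≢) with edge-from eu e
      ... | _ , ev , 00-edge = ev ∷ stays-in-clique eh ev w h≢
      ... | _ , ev , 01-edge = ⊥-elim (h≢v (same-hub eh ev))

      core? : Decidable (λ v → label v ≢ 2)
      core? v = ¬? (label v ≟ 2)

      pendant-neighbour : ∀ {u v} → label u ≡ 2 → Adjacent G u v → label v ≡ 1
      pendant-neighbour eu e with edge-from eu e
      ... | _ , ev , 21-edge = ev

      pendant-stuck : ∀ {u v P} → label v ≡ 2 → Adjacent G u v → Walk G v P → All (u ≢_) P → length P ≡ 0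
      pendant-stuck v≡2 e [] _ = refl
      pendant-stuck v≡2 e (e′ ∷ _) (u≢x ∷ _) =
        ⊥-elim (u≢x (same-hub (pendant-neighbour v≡2 (adjacent-sym {G = G} e)) (pendant-neighbour v≡2 e′)))

      -- A pendant vertex has no neighbour but the hub, from which the path has just come, so the
      -- path ends as soon as it enters one.
      one-pendant : ∀ {u P} → Walk G u P → Unique (u ∷ P) → length P ≤ suc (length (filter core? P))
      one-pendant [] _ = z≤n
      one-pendant {u} {v ∷ P} (e ∷ w) ((_ ∷ u≢) ∷ un) with label v ≟ 2
      ... | no v≢2 = subst (λ L → suc (length P) ≤ suc (length L)) (≡-sym (filter-accept core? {v} {P} v≢2)) (s≤s (one-pendant w un))
      ... | yes v≡2 = s≤s (≤-trans (≤-reflexive (pendant-stuck v≡2 e w u≢)) z≤n)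

      target : ∀ {a b} → Edge a b → b ≢ 2 → b ≡ 0 ⊎ b ≡ 1
      target 00-edge _ = inj₁ refl
      target 10-edge _ = inj₁ refl
      target 01-edge _ = inj₂ refl
      target 21-edge _ = inj₂ refl
      target 12-edge 2≢2 = ⊥-elim (2≢2 refl)

      core-labels : ∀ {u P} → Walk G u P → All (λ v → label v ≢ 2 → label v ≡ 0 ⊎ label v ≡ 1) P
      core-labels [] = []
      core-labels (e ∷ w) = target (edge-of e) ∷ core-labels w

      -- Let p = n + 1. With the centre in the clique, all vertices of the sparkler except at most
      -- one are in the clique or equal to the hub, but these are only p vertices. With the hub as
      -- centre, the path stops at a pendant vertex or is confined to the p - 1 vertices of the
      -- clique. Pendant vertices have degree one.
      sparkler-free : 3 ≤ q → 1 ≤ n → ¬ Sparkles G q (suc n)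
      sparkler-free 3≤q 1≤n S with first-edge S (s≤s z≤n)
      ... | v , P , refl , e , w with star S refl e
      ... | u , adjacent , len = by-edge (edge-of e) refl refl
        where
        open Sparkles S
        parts = ++-unique⁻ leaves (AllPairs.tail distinct)
        path-unique = proj₁ (proj₂ parts)
        c≢path : All (centre ≢_) (v ∷ P)
        c≢path = Allₚ.++⁻ʳ leaves (AllPairs.head distinct)
        at-clique : label centre ≡ 0 → ⊥
        at-clique c≡0 = <⇒≱ (≤-trans (s≤s (s≤s z≤n)) 3≤q) (+-cancelʳ-≤ n q 1 (begin
          q + n ≤⟨ +-monoʳ-≤ q (s≤s⁻¹ (subst (_≤ suc (length F)) path-length (one-pendant path-walk (c≢path ∷ path-unique)))) ⟩
          q + length F ≡⟨ cong (_+ length F) leaves-length ⟨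
          suc (length leaves) + length F ≡⟨ cong suc (length-++ leaves) ⟨
          length (centre ∷ leaves ++ F) ≤⟨ two-labels Ls total-unique total-labels ⟩
          count 0 Ls + count 1 Ls ≡⟨ cong₂ _+_ count-clique count-hub ⟩
          n + 1 ≡⟨ +-comm n 1 ⟩
          1 + n ∎))
          where
          open ≤-Reasoning
          F = filter core? (v ∷ P)
          total-unique : Unique (centre ∷ leaves ++ F)
          total-unique = Allₚ.++⁺ (Allₚ.++⁻ˡ leaves (AllPairs.head distinct)) (Allₚ.filter⁺ core? c≢path)
            ∷ ++-unique (proj₁ parts) (Uniqueₚ.filter⁺ core? path-unique)
                (λ x∈ x∈F → proj₂ (proj₂ parts) x∈ (proj₁ (∈-filter⁻ core? {xs = v ∷ P} x∈F)))
          leaf-label : ∀ {x} → Adjacent G centre x → label x ≡ 0 ⊎ label x ≡ 1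
          leaf-label e with edge-from c≡0 e
          ... | _ , ex , 00-edge = inj₁ ex
          ... | _ , ex , 01-edge = inj₂ ex
          total-labels : All (λ x → label x ≡ 0 ⊎ label x ≡ 1) (centre ∷ leaves ++ F)
          total-labels = inj₁ c≡0 ∷ Allₚ.++⁺ (All.map leaf-label leaves-adjacent)
            (All.tabulate λ x∈F → let (x∈ , x≢2) = ∈-filter⁻ core? {xs = v ∷ P} x∈F in All.lookup (core-labels path-walk) x∈ x≢2)
        by-edge : ∀ {a b} → Edge a b → label centre ≡ a → label v ≡ b → ⊥
        by-edge 00-edge ec ev = at-clique ec
        by-edge 01-edge ec ev = at-clique ec
        by-edge 10-edge ec ev = 1+n≰n (subst₂ _≤_ path-length count-clique
          (unique⇒length≤count Ls path-unique (ev ∷ stays-in-clique ec ev w (All.tail c≢path))))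
        by-edge 12-edge ec ev = <⇒≢ 1≤n (trans (≡-sym (pendant-stuck ev e w (All.tail c≢path))) (suc-injective path-length))
        by-edge 21-edge ec ev = <⇒≱ (≤-trans (s≤s (s≤s z≤n)) 3≤q)
          (subst₂ _≤_ len count-hub (unique⇒length≤count Ls u (All.map (pendant-neighbour ec) adjacent)))

      clique-walk : ∀ {u P} → Unique (u ∷ P) → linked (label u) 0 ≡ true → All (λ v → label v ≡ 0) P → Walk G u P
      clique-walk {u} _ _ [] = []
      clique-walk {u} ((u≢v ∷ _) ∷ un) l (ev ∷ es) =
        adj⁺ Ls u≢v (subst (λ t → linked (label u) t ≡ true) (≡-sym ev) l)
        ∷ clique-walk un (subst (λ t → linked t 0 ≡ true) (≡-sym ev) refl) es

      sparkler : 1 ≤ q → Sparkles G q n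
      sparkler 1≤q = record
        { centre = h ; leaves = L ; path = members 0 Ls
        ; leaves-length = trans (cong suc (length-take-≤ {xs = members 2 Ls} enough)) (m+[n∸m]≡n 1≤q)
        ; path-length = trans (length-members 0 Ls) count-clique
        ; distinct = Allₚ.++⁺ (All.map (apart Ls (λ ()) (proj₂ hub)) L-labels) h∉
            ∷ ++-unique (Uniqueₚ.take⁺ (q ∸ 1) (members-unique 2 Ls)) (members-unique 0 Ls)
                (λ x∈ x∈′ → 0≢1+n (trans (≡-sym (∈-members⁻ Ls x∈′)) (All.lookup L-labels x∈)))
        ; leaves-adjacent = All.map (λ e → adj⁺ Ls (apart Ls (λ ()) (proj₂ hub) e)
            (subst₂ (λ a b → linked a b ≡ true) (≡-sym (proj₂ hub)) (≡-sym e) refl)) L-labels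
        ; path-walk = clique-walk (h∉ ∷ members-unique 0 Ls) (subst (λ t → linked t 0 ≡ true) (≡-sym (proj₂ hub)) refl) zeros }
        where
        h = proj₁ hub
        L = take (q ∸ 1) (members 2 Ls)
        enough : q ∸ 1 ≤ length (members 2 Ls)
        enough = ≤-trans (m∸n≤m q 1) (≤-trans (m≤n+m q N) (≤-reflexive (≡-sym (trans (length-members 2 Ls) count-pendant))))
        L-labels : All (λ v → label v ≡ 2) L
        L-labels = All.tabulate λ x∈ → ∈-members⁻ Ls (∈-take (q ∸ 1) (members 2 Ls) x∈)
        zeros : All (λ v → label v ≡ 0) (members 0 Ls)
        zeros = All.tabulate (∈-members⁻ Ls)
        h∉ : All (h ≢_) (members 0 Ls)
        h∉ = All.map (apart Ls (λ ()) (proj₂ hub)) zeros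

  width-bound : ∀ {q p} → 3 ≤ q → 2 ≤ p → ∀ Φ → DefinesAsympConn Φ (𝒞 (Sparkler q p)) → p ≤ width Φ
  width-bound {q} {suc k} 3≤q (s≤s 1≤k) = needs-width 1≤q (big q) (connected q k) (connected q (suc k))
    (λ N → sparkler-free q k N 3≤q 1≤k) (λ N → sparkler q (suc k) N 1≤q)
    where
    open Family R (rest q)
    1≤q = ≤-trans (s≤s z≤n) 3≤q

-- Used for paths that zigzag between the two sides of a complete bipartite graph, starting and
-- ending on the side of the first list, which is longer by one.
weave : ∀ {A : Set} → List A → List A → List A
weave (x ∷ xs) (y ∷ ys) = x ∷ y ∷ weave xs ys
weave xs [] = xs
weave [] _ = []

module _ {A : Set} where

  weave-∈ : ∀ {z : A} xs ys → z ∈ weave xs ys → z ∈ xs ⊎ z ∈ ys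
  weave-∈ (x ∷ xs) (y ∷ ys) (here e) = inj₁ (here e)
  weave-∈ (x ∷ xs) (y ∷ ys) (there (here e)) = inj₂ (here e)
  weave-∈ (x ∷ xs) (y ∷ ys) (there (there z∈)) with weave-∈ xs ys z∈
  ... | inj₁ z∈xs = inj₁ (there z∈xs)
  ... | inj₂ z∈ys = inj₂ (there z∈ys)
  weave-∈ (x ∷ xs) [] z∈ = inj₁ z∈
  weave-∈ [] [] ()
  weave-∈ [] (_ ∷ _) ()

  weave-unique : ∀ {xs ys : List A} → Unique xs → Unique ys → (∀ {z} → z ∈ xs → z ∉ ys) → Unique (weave xs ys)
  weave-unique {x ∷ xs} {y ∷ ys} (x∉ ∷ u) (y∉ ∷ u′) disj =
    ((λ { refl → disj (here refl) (here refl) }) ∷ ∉⇒All≢ (λ x∈ → fresh-x (weave-∈ xs ys x∈)))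
    ∷ ∉⇒All≢ (λ y∈ → fresh-y (weave-∈ xs ys y∈))
    ∷ weave-unique u u′ (λ z∈ z∈′ → disj (there z∈) (there z∈′))
    where
    fresh-x : x ∈ xs ⊎ x ∈ ys → ⊥
    fresh-x (inj₁ x∈) = All≢⇒∉ x∉ x∈
    fresh-x (inj₂ x∈) = disj (here refl) (there x∈)
    fresh-y : y ∈ xs ⊎ y ∈ ys → ⊥
    fresh-y (inj₁ y∈) = disj (there y∈) (here refl)
    fresh-y (inj₂ y∈) = All≢⇒∉ y∉ y∈
  weave-unique {x ∷ xs} {[]} u _ _ = u
  weave-unique {[]} {[]} _ _ _ = []
  weave-unique {[]} {_ ∷ _} _ _ _ = []

  weave-length : ∀ (xs ys : List A) → length xs ≡ suc (length ys) → length (weave xs ys) ≡ suc (length ys + length ys)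
  weave-length (x ∷ xs) (y ∷ ys) eq =
    cong (λ k → suc (suc k)) (trans (weave-length xs ys (suc-injective eq)) (≡-sym (+-suc (length ys) (length ys))))
  weave-length (x ∷ xs) [] eq = eq

-- Labels: a complete bipartite graph with sides 0 and {1, 2}, where 1 is a single hub carrying
-- pendant vertices (3) and the tail 4 – 5 – 6.
module Kraken where
  data Edge : ℕ → ℕ → Set where
    01-edge : Edge 0 1
    10-edge : Edge 1 0
    02-edge : Edge 0 2
    20-edge : Edge 2 0
    13-edge : Edge 1 3
    31-edge : Edge 3 1
    14-edge : Edge 1 4
    41-edge : Edge 4 1
    45-edge : Edge 4 5
    54-edge : Edge 5 4
    56-edge : Edge 5 6
    65-edge : Edge 6 5

  edges : List (ℕ × ℕ)
  edges = (0 , 1) ∷ (0 , 2) ∷ (1 , 3) ∷ (1 , 4) ∷ (4 , 5) ∷ (5 , 6) ∷ []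

  R = among edges

  edge : ∀ {a b} → (R a b ∨ R b a) ≡ true → Edge a b
  edge {a} {b} e with among⁻ edges a b e
  ... | inj₁ (here refl) = 01-edge
  ... | inj₁ (there (here refl)) = 02-edge
  ... | inj₁ (there (there (here refl))) = 13-edge
  ... | inj₁ (there (there (there (here refl)))) = 14-edge
  ... | inj₁ (there (there (there (there (here refl))))) = 45-edge
  ... | inj₁ (there (there (there (there (there (here refl)))))) = 56-edge
  ... | inj₂ (here refl) = 10-edge
  ... | inj₂ (there (here refl)) = 20-edge
  ... | inj₂ (there (there (here refl))) = 31-edge
  ... | inj₂ (there (there (there (here refl)))) = 41-edge
  ... | inj₂ (there (there (there (there (here refl))))) = 54-edge
  ... | inj₂ (there (there (there (there (there (here refl)))))) = 65-edge

  onSide : Bool → ℕ → Bool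
  onSide true 0 = true
  onSide false 1 = true
  onSide false 2 = true
  onSide _ _ = false

  bit : Bool → ℕ
  bit true = 1
  bit false = 0

  module _ (x : ℕ) where
    rest : ℕ → List ℕ
    rest N = 1 ∷ 4 ∷ 5 ∷ 6 ∷ replicate x 2 ++ replicate N 3
    open Family R rest

    big : ∀ N → N ≤ length (rest N)
    big N = begin
      N ≡⟨ length-replicate N ⟨
      length (replicate N 3) ≤⟨ m≤n+m _ (length (replicate x 2)) ⟩
      length (replicate x 2) + length (replicate N 3) ≡⟨ length-++ (replicate x 2) ⟨
      length (replicate x 2 ++ replicate N 3) ≤⟨ m≤n+m _ 4 ⟩
      length (rest N) ∎
      where open ≤-Reasoning

    module _ (n N : ℕ) where
      Ls = replicate n 0 ++ rest N
      label = lookup Ls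
      G = member n N

      count-parts : ∀ t → count t Ls ≡
        count t (replicate n 0) + (count t (1 ∷ 4 ∷ 5 ∷ 6 ∷ []) + (count t (replicate x 2) + count t (replicate N 3)))
      count-parts t = trans (count-++ t (replicate n 0) (rest N)) (cong (count t (replicate n 0) +_)
        (trans (count-++ t (1 ∷ 4 ∷ 5 ∷ 6 ∷ []) (replicate x 2 ++ replicate N 3))
          (cong (count t (1 ∷ 4 ∷ 5 ∷ 6 ∷ []) +_) (count-++ t (replicate x 2) (replicate N 3)))))

      count-0 : count 0 Ls ≡ n
      count-0 = trans (count-parts 0) (trans (cong₂ _+_ (count-replicate 0 n)
        (cong₂ _+_ (count-replicate-≢ x (λ ())) (count-replicate-≢ N (λ ())))) (+-identityʳ n))

      count-2 : count 2 Ls ≡ x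
      count-2 = trans (count-parts 2) (trans (cong₂ _+_ (count-replicate-≢ n (λ ()))
        (cong₂ _+_ (count-replicate 2 x) (count-replicate-≢ N (λ ())))) (+-identityʳ x))

      count-single : ∀ {t} → t ≢ 0 → t ≢ 2 → t ≢ 3 → count t (1 ∷ 4 ∷ 5 ∷ 6 ∷ []) ≡ 1 → count t Ls ≤ 1
      count-single {t} ≢0 ≢2 ≢3 one = ≤-reflexive (trans (count-parts t) (cong₂ _+_ (count-replicate-≢ n ≢0)
        (cong₂ _+_ one (cong₂ _+_ (count-replicate-≢ x ≢2) (count-replicate-≢ N ≢3)))))

      count-1 : count 1 Ls ≤ 1
      count-1 = count-single (λ ()) (λ ()) (λ ()) refl
      count-4 : count 4 Ls ≤ 1
      count-4 = count-single (λ ()) (λ ()) (λ ()) refl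
      count-5 : count 5 Ls ≤ 1
      count-5 = count-single (λ ()) (λ ()) (λ ()) refl
      count-6 : count 6 Ls ≤ 1
      count-6 = count-single (λ ()) (λ ()) (λ ()) refl

      rest∈ : ∀ {t} → t ∈ rest N → t ∈ Ls
      rest∈ = ∈-++⁺ʳ (replicate n 0)

      v₁ = index-of (rest∈ (here refl))
      v₄ = index-of (rest∈ (there (here refl)))
      v₅ = index-of (rest∈ (there (there (here refl))))
      v₆ = index-of (rest∈ (there (there (there (here refl)))))

      open Connectivity R Ls (proj₁ v₁)

      connected : 1 ≤ n → Connected G
      connected 1≤n = connected-from (Allₚ.++⁺ (Allₚ.replicate⁺ n (λ {u} → from-0 {u}))
        ((λ {u} → from-1 {u}) ∷ (λ {u} → from-4 {u}) ∷ (λ {u} → from-5 {u}) ∷ (λ {u} → from-6 {u}) ∷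
          Allₚ.++⁺ (Allₚ.replicate⁺ x (λ {u} → from-2 {u})) (Allₚ.replicate⁺ N (λ {u} → from-3 {u}))))
        where
        0∈ : ∀ n → 1 ≤ n → 0 ∈ replicate n 0
        0∈ (suc _) _ = here refl
        from-1 : ReachFrom 1
        from-1 e rewrite single Ls count-1 e (proj₂ v₁) = Reach.here
        from-0 : ReachFrom 0
        from-0 = reach-step (λ ()) refl (rest∈ (here refl)) from-1
        from-2 : ReachFrom 2
        from-2 = reach-step (λ ()) refl (∈-++⁺ˡ (0∈ n 1≤n)) from-0
        from-3 : ReachFrom 3
        from-3 = reach-step (λ ()) refl (rest∈ (here refl)) from-1
        from-4 : ReachFrom 4
        from-4 = reach-step (λ ()) refl (rest∈ (here refl)) from-1
        from-5 : ReachFrom 5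
        from-5 = reach-step (λ ()) refl (rest∈ (there (here refl))) from-4
        from-6 : ReachFrom 6
        from-6 = reach-step (λ ()) refl (rest∈ (there (there (here refl)))) from-5

      edge-of : ∀ {u v} → Adjacent G u v → Edge (label u) (label v)
      edge-of {u} {v} e = edge {label u} {label v} (proj₂ (adj⁻ Ls e))

      edge-from : ∀ {u v t} → label u ≡ t → Adjacent G u v → ∃ λ t′ → label v ≡ t′ × Edge t t′
      edge-from refl e = _ , refl , edge-of e

      pendant-stuck : ∀ {h v P} → label h ≡ 1 → label v ≡ 3 → Walk G v P → All (h ≢_) P → length P ≡ 0
      pendant-stuck eh ev [] _ = refl
      pendant-stuck eh ev (e ∷ _) (h≢ ∷ _) with edge-from ev e
      ... | _ , ex , 31-edge = ⊥-elim (h≢ (single Ls count-1 eh ex))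

      tail-short : ∀ {h v P} → label h ≡ 1 → label v ≡ 4 → Walk G v P → All (h ≢_) P → Unique (v ∷ P) → length P ≤ 2
      tail-short eh ev [] _ _ = z≤n
      tail-short eh ev (e ∷ w) (h≢ ∷ _) ((_ ∷ v≢) ∷ u) with edge-from ev e
      ... | _ , ex , 41-edge = ⊥-elim (h≢ (single Ls count-1 eh ex))
      ... | _ , ex , 45-edge = s≤s (from-5 w v≢ u)
        where
        from-6 : ∀ {y z P} → label y ≡ 5 → label z ≡ 6 → Walk G z P → All (y ≢_) P → length P ≡ 0
        from-6 ey ez [] _ = refl
        from-6 ey ez (e ∷ _) (y≢ ∷ _) with edge-from ez e
        ... | _ , e′ , 65-edge = ⊥-elim (y≢ (single Ls count-5 ey e′))
        from-5 : ∀ {P} → Walk G _ P → All (_ ≢_) P → Unique (_ ∷ P) → length P ≤ 1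
        from-5 [] _ _ = z≤n
        from-5 (e ∷ w) (v≢ ∷ _) ((_ ∷ x≢) ∷ _) with edge-from ex e
        ... | _ , ez , 54-edge = ⊥-elim (v≢ (single Ls count-4 ev ez))
        ... | _ , ez , 56-edge = s≤s (≤-reflexive (from-6 ex ez w x≢))

      onSide? : ∀ b → Decidable (λ v → onSide b (label v) ≡ true)
      onSide? b v = onSide b (label v) Bool.≟ true

      data Core : ℕ → Set where
        core-0 : Core 0
        core-1 : Core 1
        core-2 : Core 2

      -- The path alternates between the sides until it leaves through the hub, and then has at most
      -- three more vertices. If it starts on the counted side, its first vertex may be on the other
      -- side, which accounts for the extra `bit`.
      walk-bound : ∀ b {t u P} → Core t → label u ≡ t → Walk G u P → Unique (u ∷ P) →
        length P ≤ (length (filter (onSide? b) P) + length (filter (onSide? b) P)) + (3 + bit (onSide b t))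
      core-step : ∀ b {t t′ v P} → onSide b t′ ≡ not (onSide b t) → Core t′ → label v ≡ t′ → Walk G v P → Unique (v ∷ P) →
        length (v ∷ P) ≤ (length (filter (onSide? b) (v ∷ P)) + length (filter (onSide? b) (v ∷ P))) + (3 + bit (onSide b t))

      walk-bound b c eu [] _ = z≤n
      walk-bound b {t} {u} c eu (e ∷ w) ((_ ∷ u≢) ∷ un) with c | edge-from eu e
      walk-bound true c eu (e ∷ w) (_ ∷ un) | core-0 | _ , ev , 01-edge = core-step true {0} refl core-1 ev w un
      walk-bound false c eu (e ∷ w) (_ ∷ un) | core-0 | _ , ev , 01-edge = core-step false {0} refl core-1 ev w un
      walk-bound true c eu (e ∷ w) (_ ∷ un) | core-0 | _ , ev , 02-edge = core-step true {0} refl core-2 ev w un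
      walk-bound false c eu (e ∷ w) (_ ∷ un) | core-0 | _ , ev , 02-edge = core-step false {0} refl core-2 ev w un
      walk-bound true c eu (e ∷ w) (_ ∷ un) | core-1 | _ , ev , 10-edge = core-step true {1} refl core-0 ev w un
      walk-bound false c eu (e ∷ w) (_ ∷ un) | core-1 | _ , ev , 10-edge = core-step false {1} refl core-0 ev w un
      walk-bound true c eu (e ∷ w) (_ ∷ un) | core-2 | _ , ev , 20-edge = core-step true {2} refl core-0 ev w un
      walk-bound false c eu (e ∷ w) (_ ∷ un) | core-2 | _ , ev , 20-edge = core-step false {2} refl core-0 ev w un
      walk-bound b c eu (e ∷ w) ((_ ∷ u≢) ∷ un) | core-1 | _ , ev , 13-edge =
        ≤-trans (s≤s (≤-reflexive (pendant-stuck eu ev w u≢))) (≤-trans (s≤s z≤n) (≤-trans (m≤m+n 3 _) (m≤n+m _ _)))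
      walk-bound b c eu (e ∷ w) ((_ ∷ u≢) ∷ un) | core-1 | _ , ev , 14-edge =
        ≤-trans (s≤s (tail-short eu ev w u≢ un)) (≤-trans (m≤m+n 3 _) (m≤n+m _ _))

      core-step b {t} {t′} {v} {P} flip c ev w un = by-side (onSide b t′) refl
        where
        m = length (filter (onSide? b) P)
        IH : length P ≤ (m + m) + (3 + bit (onSide b t′))
        IH = walk-bound b c ev w un
        Goal : ℕ → Set
        Goal k = suc (length P) ≤ (k + k) + (3 + bit (onSide b t))
        by-side : ∀ c → onSide b t′ ≡ c → Goal (length (filter (onSide? b) (v ∷ P)))
        by-side true e = subst (λ L → Goal (length L)) (≡-sym (filter-accept (onSide? b) {v} {P} (trans (cong (onSide b) ev) e)))
          (begin
            suc (length P) ≤⟨ s≤s IH ⟩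
            suc (m + m + (3 + bit (onSide b t′))) ≡⟨ cong (λ c → suc (m + m + (3 + bit c))) e ⟩
            suc (m + m + 4) ≡⟨ cong suc (+-suc (m + m) 3) ⟩
            suc (suc (m + m)) + 3 ≡⟨ cong (λ k → suc k + 3) (+-suc m m) ⟨
            suc m + suc m + 3 ≤⟨ +-monoʳ-≤ (suc m + suc m) (m≤m+n 3 _) ⟩
            suc m + suc m + (3 + bit (onSide b t)) ∎)
          where open ≤-Reasoning
        by-side false e = subst (λ L → Goal (length L))
          (≡-sym (filter-reject (onSide? b) {v} {P} (λ e′ → Bool.not-¬ (trans (cong (onSide b) ev) e) e′)))
          (begin
            suc (length P) ≤⟨ s≤s IH ⟩
            suc (m + m + (3 + bit (onSide b t′))) ≡⟨ cong (λ c → suc (m + m + (3 + bit c))) e ⟩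
            suc (m + m + 3) ≡⟨ +-suc (m + m) 3 ⟨
            m + m + 4 ≡⟨ cong (λ c → m + m + (3 + bit c)) (Bool.not-injective (trans (≡-sym flip) e)) ⟨
            m + m + (3 + bit (onSide b t)) ∎)
          where open ≤-Reasoning

      two? : Decidable (λ v → label v ≡ 2)
      two? v = label v ≟ 2

      -- Without the hub a path cannot reach the pendant vertices or the tail, so it alternates
      -- between labels 0 and 2.
      hubless₀ : ∀ {h u P} → label h ≡ 1 → label u ≡ 0 → Walk G u P → All (h ≢_) P →
        length P ≤ length (filter two? P) + length (filter two? P)
      hubless₂ : ∀ {h u P} → label h ≡ 1 → label u ≡ 2 → Walk G u P → All (h ≢_) P →
        length P ≤ suc (length (filter two? P) + length (filter two? P))
      hubless₀ eh eu [] _ = z≤n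
      hubless₀ {P = v ∷ P} eh eu (e ∷ w) (h≢v ∷ h≢) with edge-from eu e
      ... | _ , ev , 01-edge = ⊥-elim (h≢v (single Ls count-1 eh ev))
      ... | _ , ev , 02-edge = subst (λ L → suc (length P) ≤ length L + length L) (≡-sym (filter-accept two? {v} {P} ev))
        (s≤s (≤-trans (hubless₂ eh ev w h≢) (≤-reflexive (≡-sym (+-suc _ _)))))
      hubless₂ eh eu [] _ = z≤n
      hubless₂ {P = v ∷ P} eh eu (e ∷ w) (h≢v ∷ h≢) with edge-from eu e
      ... | _ , ev , 20-edge = subst (λ L → suc (length P) ≤ suc (length L + length L))
        (≡-sym (filter-reject two? {v} {P} (λ e′ → 0≢1+n (trans (≡-sym ev) e′)))) (s≤s (hubless₀ eh ev w h≢))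

      -- A centre of label 0 or 2 has its `q - 1` leaves on the opposite side, which leaves fewer
      -- than `x` vertices there for the path and limits it to 2x + 1 < p vertices. The hub has
      -- enough leaves, but its paths have at most 2x + 1 vertices in the bipartite part and at most
      -- three in the tail, where `4 ≤ p` matters. All other vertices have degree at most two.
      sparkler-free : ∀ {q p} → 3 ≤ q → 1 ≤ x → 2 + x + x ≤ p → 4 ≤ p → suc n ≤ q ∸ 1 + x → ¬ Sparkles G q p
      sparkler-free {q} {p} 3≤q 1≤x 2+2x≤p 4≤p n≤ S with first-edge S (≤-trans (s≤s z≤n) 4≤p)
      ... | v , P , refl , e , w with star S refl e
      ... | u , adjacent , len = by-edge (edge-of e) refl refl
        where
        open Sparkles S
        parts = ++-unique⁻ leaves (AllPairs.tail distinct)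
        path-unique = proj₁ (proj₂ parts)
        c≢path : All (centre ≢_) (v ∷ P)
        c≢path = Allₚ.++⁻ʳ leaves (AllPairs.head distinct)
        leaves≡ : length leaves ≡ q ∸ 1
        leaves≡ = cong (_∸ 1) leaves-length
        low-degree : ∀ {a b} → count a Ls ≤ 1 → count b Ls ≤ 1 →
          (∀ {z} → Adjacent G centre z → label z ≡ a ⊎ label z ≡ b) → ⊥
        low-degree a≤1 b≤1 labels = <⇒≱ 3≤q (subst (_≤ 2) len
          (≤-trans (two-labels Ls u (All.map labels adjacent)) (+-mono-≤ a≤1 b≤1)))
        few-on-path : ∀ b y → length (leaves ++ filter (onSide? b) (v ∷ P)) ≤ y → y < q ∸ 1 + x →
          suc (length (filter (onSide? b) (v ∷ P))) ≤ x
        few-on-path b y ≤y y< = +-cancelˡ-≤ (q ∸ 1) _ _ (begin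
          q ∸ 1 + suc m ≡⟨ +-suc (q ∸ 1) m ⟩
          suc (q ∸ 1 + m) ≡⟨ cong (λ k → suc (k + m)) leaves≡ ⟨
          suc (length leaves + m) ≡⟨ cong suc (length-++ leaves) ⟨
          suc (length (leaves ++ filter (onSide? b) (v ∷ P))) ≤⟨ s≤s ≤y ⟩
          suc y ≤⟨ y< ⟩
          q ∸ 1 + x ∎)
          where
          open ≤-Reasoning
          m = length (filter (onSide? b) (v ∷ P))
        star-unique : ∀ b → Unique (leaves ++ filter (onSide? b) (v ∷ P))
        star-unique b = ++-unique (proj₁ parts) (Uniqueₚ.filter⁺ (onSide? b) path-unique)
          (λ z∈ z∈F → proj₂ (proj₂ parts) z∈ (proj₁ (∈-filter⁻ (onSide? b) {xs = v ∷ P} z∈F)))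
        short-path : ∀ b {t} → Core t → label centre ≡ t → onSide b t ≡ false → suc (length (filter (onSide? b) (v ∷ P))) ≤ x → ⊥
        short-path b {t} c ec off m<x = <⇒≱ (≤-trans (s≤s bound) 2+2x≤p) (≤-reflexive (≡-sym path-length))
          where
          open ≤-Reasoning
          m = length (filter (onSide? b) (v ∷ P))
          bound : length (v ∷ P) ≤ suc (x + x)
          bound = begin
            length (v ∷ P) ≤⟨ walk-bound b c ec path-walk (c≢path ∷ path-unique) ⟩
            m + m + (3 + bit (onSide b t)) ≡⟨ cong (λ k → m + m + (3 + bit k)) off ⟩
            m + m + 3 ≡⟨ +-comm (m + m) 3 ⟩
            suc (suc (suc (m + m))) ≡⟨ cong (λ k → suc (suc k)) (+-suc m m) ⟨
            suc (suc m + suc m) ≤⟨ s≤s (+-mono-≤ m<x m<x) ⟩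
            suc (x + x) ∎
        at-0 : label centre ≡ 0 → ⊥
        at-0 ec = short-path false core-0 ec refl (few-on-path false (1 + x)
          (≤-trans (two-labels Ls (star-unique false)
              (Allₚ.++⁺ (All.map leaf leaves-adjacent) (All.map coreLabel (Allₚ.all-filter (onSide? false) (v ∷ P)))))
            (+-mono-≤ count-1 (≤-reflexive count-2)))
          (+-monoˡ-≤ x (∸-monoˡ-≤ 1 3≤q)))
          where
          leaf : ∀ {z} → Adjacent G centre z → label z ≡ 1 ⊎ label z ≡ 2
          leaf e with edge-from ec e
          ... | _ , ez , 01-edge = inj₁ ez
          ... | _ , ez , 02-edge = inj₂ ez
          coreLabel : ∀ {z} → onSide false (label z) ≡ true → label z ≡ 1 ⊎ label z ≡ 2
          coreLabel {z} = decode (label z)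
            where
            decode : ∀ t → onSide false t ≡ true → t ≡ 1 ⊎ t ≡ 2
            decode 1 _ = inj₁ refl
            decode 2 _ = inj₂ refl
        at-2 : label centre ≡ 2 → ⊥
        at-2 ec = short-path true core-2 ec refl (few-on-path true n
          (subst (length (leaves ++ filter (onSide? true) (v ∷ P)) ≤_) count-0
            (unique⇒length≤count Ls (star-unique true)
              (Allₚ.++⁺ (All.map leaf leaves-adjacent) (All.map coreLabel (Allₚ.all-filter (onSide? true) (v ∷ P))))))
          n≤)
          where
          leaf : ∀ {z} → Adjacent G centre z → label z ≡ 0
          leaf e with edge-from ec e
          ... | _ , ez , 20-edge = ez
          coreLabel : ∀ {z} → onSide true (label z) ≡ true → label z ≡ 0
          coreLabel {z} = decode (label z)
            where
            decode : ∀ t → onSide true t ≡ true → t ≡ 0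
            decode 0 _ = refl
        at-4 : label centre ≡ 4 → ⊥
        at-4 ec = low-degree count-1 count-5 labels
          where
          labels : ∀ {z} → Adjacent G centre z → label z ≡ 1 ⊎ label z ≡ 5
          labels e with edge-from ec e
          ... | _ , ez , 41-edge = inj₁ ez
          ... | _ , ez , 45-edge = inj₂ ez
        at-5 : label centre ≡ 5 → ⊥
        at-5 ec = low-degree count-4 count-6 labels
          where
          labels : ∀ {z} → Adjacent G centre z → label z ≡ 4 ⊎ label z ≡ 6
          labels e with edge-from ec e
          ... | _ , ez , 54-edge = inj₁ ez
          ... | _ , ez , 56-edge = inj₂ ez
        by-edge : ∀ {a b} → Edge a b → label centre ≡ a → label v ≡ b → ⊥
        by-edge 01-edge ec _ = at-0 ec
        by-edge 02-edge ec _ = at-0 ec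
        by-edge 20-edge ec _ = at-2 ec
        by-edge 10-edge ec ev = <⇒≱ (≤-trans (s≤s (s≤s (begin
            length P ≤⟨ hubless₀ ec ev w (All.tail c≢path) ⟩
            length (filter two? P) + length (filter two? P) ≤⟨ +-mono-≤ twos twos ⟩
            x + x ∎))) 2+2x≤p) (≤-reflexive (≡-sym path-length))
          where
          open ≤-Reasoning
          twos : length (filter two? P) ≤ x
          twos = subst (length (filter two? P) ≤_) count-2
            (unique⇒length≤count Ls (Uniqueₚ.filter⁺ two? (AllPairs.tail path-unique)) (Allₚ.all-filter two? P))
        by-edge 13-edge ec ev = <⇒≱ (≤-trans (s≤s (s≤s z≤n)) 4≤p)
          (≤-reflexive (trans (≡-sym path-length) (cong suc (pendant-stuck ec ev w (All.tail c≢path)))))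
        by-edge 14-edge ec ev = <⇒≱ 4≤p (subst (_≤ 3) path-length (s≤s (tail-short ec ev w (All.tail c≢path) path-unique)))
        by-edge 31-edge ec _ = low-degree count-1 count-1 labels
          where
          labels : ∀ {z} → Adjacent G centre z → label z ≡ 1 ⊎ label z ≡ 1
          labels e with edge-from ec e
          ... | _ , ez , 31-edge = inj₁ ez
        by-edge 41-edge ec _ = at-4 ec
        by-edge 45-edge ec _ = at-4 ec
        by-edge 54-edge ec _ = at-5 ec
        by-edge 56-edge ec _ = at-5 ec
        by-edge 65-edge ec _ = low-degree count-5 count-5 labels
          where
          labels : ∀ {z} → Adjacent G centre z → label z ≡ 5 ⊎ label z ≡ 5
          labels e with edge-from ec e
          ... | _ , ez , 65-edge = inj₁ ez

      link : ∀ {u v a b} → a ≢ b → linked a b ≡ true → label u ≡ a → label v ≡ b → Adjacent G u v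
      link a≢b l eu ev = adj⁺ Ls (apart Ls a≢b eu ev) (subst₂ (λ a b → linked a b ≡ true) (≡-sym eu) (≡-sym ev) l)

      weave-walk : ∀ {u bs as T} → label u ≡ 2 → All (λ v → label v ≡ 0) bs → All (λ v → label v ≡ 2) as →
        length bs ≡ suc (length as) → (∀ {b} → label b ≡ 0 → Walk G b T) → Walk G u (weave bs as ++ T)
      weave-walk eu (eb ∷ ebs) (ea ∷ eas) len w =
        link (λ ()) refl eu eb ∷ link (λ ()) refl eb ea ∷ weave-walk ea ebs eas (suc-injective len) w
      weave-walk {bs = b ∷ []} eu (eb ∷ []) [] len w = link (λ ()) refl eu eb ∷ w eb

      sparkler : ∀ {q p} → 1 ≤ q → 1 ≤ x → q ∸ 1 + x ≡ n → p ≤ 3 + x + x → Sparkles G q p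
      sparkler {q} {p} 1≤q 1≤x q-1+x≡n p≤ = from-middle (members 2 Ls) (members-unique 2 Ls) (All.tabulate (∈-members⁻ Ls))
          (trans (length-members 2 Ls) count-2)
        where
        B = members 0 Ls
        lenB : length B ≡ q ∸ 1 + x
        lenB = trans (length-members 0 Ls) (trans count-0 (≡-sym q-1+x≡n))
        bs = take x B
        L = drop x B
        B≡ : bs ++ L ≡ B
        B≡ = take++drop≡id x B
        B-parts = ++-unique⁻ bs (subst Unique (≡-sym B≡) (members-unique 0 Ls))
        B-labels : All (λ v → label v ≡ 0) (bs ++ L)
        B-labels = subst (All _) (≡-sym B≡) (All.tabulate (∈-members⁻ Ls))
        b-labels = Allₚ.++⁻ˡ bs B-labels
        L-labels = Allₚ.++⁻ʳ bs B-labels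
        lenbs : length bs ≡ x
        lenbs = length-take-≤ {xs = B} (subst (x ≤_) (≡-sym lenB) (m≤n+m x (q ∸ 1)))
        arm = proj₁ v₁ ∷ proj₁ v₄ ∷ proj₁ v₅ ∷ proj₁ v₆ ∷ []
        T-walk : ∀ {b} → label b ≡ 0 → Walk G b arm
        T-walk eb = link (λ ()) refl eb (proj₂ v₁) ∷ link (λ ()) refl (proj₂ v₁) (proj₂ v₄) ∷
          link (λ ()) refl (proj₂ v₄) (proj₂ v₅) ∷ link (λ ()) refl (proj₂ v₅) (proj₂ v₆) ∷ []
        T-unique : Unique arm
        T-unique = (apart Ls (λ ()) (proj₂ v₁) (proj₂ v₄) ∷ apart Ls (λ ()) (proj₂ v₁) (proj₂ v₅) ∷ apart Ls (λ ()) (proj₂ v₁) (proj₂ v₆) ∷ [])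
          ∷ (apart Ls (λ ()) (proj₂ v₄) (proj₂ v₅) ∷ apart Ls (λ ()) (proj₂ v₄) (proj₂ v₆) ∷ [])
          ∷ (apart Ls (λ ()) (proj₂ v₅) (proj₂ v₆) ∷ []) ∷ [] ∷ []
        avoids-T : ∀ {z t} → label z ≡ t → t ≢ 1 → t ≢ 4 → t ≢ 5 → t ≢ 6 → z ∉ arm
        avoids-T e a b c d (here refl) = a (trans (≡-sym e) (proj₂ v₁))
        avoids-T e a b c d (there (here refl)) = b (trans (≡-sym e) (proj₂ v₄))
        avoids-T e a b c d (there (there (here refl))) = c (trans (≡-sym e) (proj₂ v₅))
        avoids-T e a b c d (there (there (there (here refl)))) = d (trans (≡-sym e) (proj₂ v₆))
        zero∉T : ∀ {z} → label z ≡ 0 → z ∉ arm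
        zero∉T e = avoids-T e (λ ()) (λ ()) (λ ()) (λ ())
        two∉T : ∀ {z} → label z ≡ 2 → z ∉ arm
        two∉T e = avoids-T e (λ ()) (λ ()) (λ ()) (λ ())
        from-middle : ∀ A → Unique A → All (λ v → label v ≡ 2) A → length A ≡ x → Sparkles G q p
        from-middle [] _ _ eq = ⊥-elim (<⇒≢ 1≤x eq)
        from-middle (a ∷ as) (a∉ ∷ uas) (ea ∷ eas) eq = record
          { centre = a ; leaves = L ; path = take p full
          ; leaves-length = trans (cong suc (trans (length-drop x B) (trans (cong (_∸ x) lenB) (m+n∸n≡m (q ∸ 1) x)))) (m+[n∸m]≡n 1≤q)
          ; path-length = length-take-≤ {xs = full} (≤-trans p≤ (≤-reflexive (≡-sym len-full)))
          ; distinct = ∉⇒All≢ a∉all ∷ ++-unique (proj₁ (proj₂ B-parts)) (Uniqueₚ.take⁺ p full-unique)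
              (λ z∈ z∈′ → leaf∉ z∈ (∈-++⁻ (weave bs as) (∈-take p full z∈′)))
          ; leaves-adjacent = All.map (link (λ ()) refl ea) L-labels
          ; path-walk = walk-take p (weave-walk ea b-labels eas lens T-walk) }
          where
          full = weave bs as ++ arm
          lens : length bs ≡ suc (length as)
          lens = trans lenbs (≡-sym eq)
          bs∉as : ∀ {z} → z ∈ bs → z ∉ as
          bs∉as z∈ z∈′ = 0≢1+n (trans (≡-sym (All.lookup b-labels z∈)) (All.lookup eas z∈′))
          weave∉T : ∀ {z} → z ∈ bs ⊎ z ∈ as → z ∉ arm
          weave∉T (inj₁ z∈) = zero∉T (All.lookup b-labels z∈)
          weave∉T (inj₂ z∈) = two∉T (All.lookup eas z∈)
          full-unique : Unique full
          full-unique = ++-unique (weave-unique (proj₁ B-parts) uas bs∉as) T-unique (weave∉T ∘ weave-∈ bs as)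
          len-full : length full ≡ 3 + x + x
          len-full = trans (length-++ (weave bs as)) (trans (cong (_+ 4) (weave-length bs as lens)) (begin
            suc (length as + length as) + 4 ≡⟨ +-comm (suc (length as + length as)) 4 ⟩
            4 + suc (length as + length as) ≡⟨ cong (4 +_) (+-suc (length as) (length as)) ⟨
            3 + suc (length as) + suc (length as) ≡⟨ cong (λ k → 3 + k + k) eq ⟩
            3 + x + x ∎))
            where open ≡-Reasoning
          leaf∉ : ∀ {z} → z ∈ L → z ∈ weave bs as ⊎ z ∈ arm → ⊥
          leaf∉ z∈ (inj₂ z∈T) = zero∉T (All.lookup L-labels z∈) z∈T
          leaf∉ z∈ (inj₁ z∈W) with weave-∈ bs as z∈W
          ... | inj₁ z∈bs = proj₂ (proj₂ B-parts) z∈bs z∈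
          ... | inj₂ z∈as = 0≢1+n (trans (≡-sym (All.lookup L-labels z∈)) (All.lookup eas z∈as))
          a∉path : a ∈ weave bs as ⊎ a ∈ arm → ⊥
          a∉path (inj₂ a∈) = two∉T ea a∈
          a∉path (inj₁ a∈) with weave-∈ bs as a∈
          ... | inj₁ a∈bs = 0≢1+n (trans (≡-sym (All.lookup b-labels a∈bs)) ea)
          ... | inj₂ a∈as = All≢⇒∉ a∉ a∈as
          a∉all : a ∉ L ++ take p full
          a∉all a∈ with ∈-++⁻ L a∈
          ... | inj₁ a∈L = 0≢1+n (trans (≡-sym (All.lookup L-labels a∈L)) ea)
          ... | inj₂ a∈P = a∉path (∈-++⁻ (weave bs as) (∈-take p full a∈P))

  width-bound : ∀ {q p x} → 3 ≤ q → 1 ≤ x → 2 + x + x ≤ p → p ≤ 3 + x + x →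
    ∀ Φ → DefinesAsympConn Φ (𝒞 (Sparkler q p)) → q ∸ 1 + x ≤ width Φ
  width-bound {suc q} {p} {suc y} (s≤s 2≤q) 1≤x ≤p p≤ Φ defines = subst (_≤ width Φ) (≡-sym (+-suc q y))
    (needs-width (s≤s z≤n) (big x) (λ N → connected x k N 1≤k) (λ N → connected x (suc k) N (s≤s z≤n))
      (λ N → sparkler-free x k N (s≤s 2≤q) 1≤x ≤p 4≤p (≤-reflexive (≡-sym (+-suc q y))))
      (λ N → sparkler x (suc k) N (s≤s z≤n) 1≤x (+-suc q y) p≤) Φ defines)
    where
    x = suc y
    k = q + y
    open Family R (rest x)
    1≤k : 1 ≤ k
    1≤k = ≤-trans (s≤s z≤n) (≤-trans 2≤q (m≤m+n q y))
    4≤p : 4 ≤ p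
    4≤p = ≤-trans (+-mono-≤ (s≤s (s≤s (s≤s (z≤n {y})))) (s≤s (z≤n {y}))) ≤p

-- Rounding in the bound, and assembly of the theorem

ceiling-half : ∀ p → (p + p % 2) / 2 + p / 2 ≡ p
ceiling-half p = by-parity (p % 2) refl (m%n<n p 2)
  where
  s = p / 2
  p≡ : p ≡ p % 2 + s * 2
  p≡ = m≡m%n+[m/n]*n p 2
  double : s * 2 ≡ s + s
  double = trans (*-comm s 2) (cong (s +_) (+-identityʳ s))
  by-parity : ∀ r → p % 2 ≡ r → r < 2 → (p + p % 2) / 2 + s ≡ p
  by-parity 0 e _ = begin
    (p + p % 2) / 2 + s ≡⟨ cong (λ m → m / 2 + s) (trans (cong (p +_) e) (trans (+-identityʳ p) (trans p≡ (cong (_+ s * 2) e)))) ⟩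
    (s * 2) / 2 + s ≡⟨ cong (_+ s) (m*n/n≡m s 2) ⟩
    s + s ≡⟨ double ⟨
    s * 2 ≡⟨ trans p≡ (cong (_+ s * 2) e) ⟨
    p ∎
    where open ≡-Reasoning
  by-parity 1 e _ = begin
    (p + p % 2) / 2 + s ≡⟨ cong (λ m → m / 2 + s) (trans (cong (p +_) e) (trans (+-comm p 1) (cong suc (trans p≡ (cong (_+ s * 2) e))))) ⟩
    (suc s * 2) / 2 + s ≡⟨ cong (_+ s) (m*n/n≡m (suc s) 2) ⟩
    suc s + s ≡⟨ cong suc double ⟨
    suc (s * 2) ≡⟨ trans p≡ (cong (_+ s * 2) e) ⟨
    p ∎
    where open ≡-Reasoning
  by-parity (suc (suc _)) _ (s≤s (s≤s ()))

sparkBound≡ : ∀ q p → sparkBound q p ≡ p ⊔ (q + p / 2 ∸ 2)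
sparkBound≡ q p = cong (λ m → p ⊔ (m ∸ 2)) (begin
  q + p ∸ c ≡⟨ cong (λ m → q + m ∸ c) (ceiling-half p) ⟨
  q + (c + p / 2) ∸ c ≡⟨ cong (λ m → q + m ∸ c) (+-comm c (p / 2)) ⟩
  q + (p / 2 + c) ∸ c ≡⟨ cong (_∸ c) (+-assoc q (p / 2) c) ⟨
  q + p / 2 + c ∸ c ≡⟨ m+n∸n≡m (q + p / 2) c ⟩
  q + p / 2 ∎)
  where
  open ≡-Reasoning
  c = (p + p % 2) / 2

half-bounds : ∀ p → p / 2 + p / 2 ≤ p × p ≤ suc (p / 2 + p / 2)
half-bounds p = ≤-trans (≤-reflexive (≡-sym double)) (≤-trans (m≤n+m (s * 2) (p % 2)) (≤-reflexive (≡-sym p≡)))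
  , ≤-trans (≤-reflexive p≡) (+-mono-≤ (s≤s⁻¹ (m%n<n p 2)) (≤-reflexive double))
  where
  s = p / 2
  p≡ : p ≡ p % 2 + s * 2
  p≡ = m≡m%n+[m/n]*n p 2
  double : s * 2 ≡ s + s
  double = trans (*-comm s 2) (cong (s +_) (+-identityʳ s))

-- The bipartite construction is used with `x = s - 1`. For `s = 1` it would have no vertex of label
-- 2 to serve as centre, and its tail would already be a long enough path from the hub; the broom
-- covers this case.
width-lower-bound : ∀ {q p s} → 3 ≤ q → 2 ≤ p → s + s ≤ p → p ≤ suc (s + s) →
  ∀ Φ → DefinesAsympConn Φ (𝒞 (Sparkler q p)) → q + s ∸ 2 ≤ width Φ
width-lower-bound {s = zero} _ 2≤p _ p≤ _ _ = ⊥-elim (<⇒≱ 2≤p p≤)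
width-lower-bound {q} {p} {s = suc zero} 3≤q 2≤p _ _ Φ defines =
  subst (_≤ width Φ) (cong (_∸ 2) (+-comm 1 q)) (Broom.width-bound 3≤q (≤-trans (s≤s z≤n) 2≤p) Φ defines)
width-lower-bound {q} {p} {s = suc x@(suc _)} 3≤q _ ≤p p≤ Φ defines =
  subst (_≤ width Φ) (≡-sym (trans (cong (_∸ 2) (+-suc q x)) (+-∸-comm x (≤-trans (s≤s z≤n) 3≤q))))
    (Kraken.width-bound 3≤q (s≤s z≤n) (≤-trans (≤-reflexive (≡-sym double)) ≤p) (≤-trans p≤ (≤-reflexive (cong suc double))) Φ defines)
  where
  double : suc x + suc x ≡ 2 + x + x
  double = cong suc (+-suc x x)

theorem1 : (q p : ℕ) → 3 ≤ q → 2 ≤ p →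
    ((Φ : Formula) → DefinesAsympConn Φ (𝒞 (Sparkler q p)) → sparkBound q p ≤ width Φ)
    × (Σ Formula λ Φ → DefinesAsympConn Φ (𝒞 (Sparkler q p)) × depth Φ ≤ sparkBound q p + 2)
theorem1 q p 3≤q 2≤p =
  (λ Φ defines → subst (_≤ width Φ) (≡-sym (sparkBound≡ q p))
    (⊔-lub (Jellyfish.width-bound 3≤q 2≤p Φ defines) (width-lower-bound 3≤q 2≤p 2s≤p p≤ Φ defines)))
  , subst (λ m → Σ Formula λ Φ → DefinesAsympConn Φ (𝒞 (Sparkler q p)) × depth Φ ≤ m)
      (trans (+-comm 2 b) (cong (_+ 2) (≡-sym (sparkBound≡ q p))))
      -- One of the `b + 2` quantifiers is spent on the centre, which leaves `d = b + 1`.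
      (UpperBound.upper-bound q p (p / 2) (suc b) (≤-trans (s≤s z≤n) 3≤q) 2≤p p≤
        (s≤s (m≤m⊔n p (q + p / 2 ∸ 2)))
        (≤-trans (m≤n+m∸n (q + p / 2) 2) (s≤s (s≤s (m≤n⊔m p (q + p / 2 ∸ 2))))))
  where
  b = p ⊔ (q + p / 2 ∸ 2)
  2s≤p = proj₁ (half-bounds p)
  p≤ = proj₂ (half-bounds p)
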